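{- Let $k\ge 2$ be an integer. There is an algorithm for the $n$-pairs shortest paths problem which, given an undirected unweighted graph $G=(V,E)$ with $n=|V|$, $m=|E|$, and vertex pairs $(s_i,t_i)$ for $1\leq i\leq O(n)$, computes for every $i$ an estimation $\hat{d}(s_i,t_i)$ such that $$d(s_i,t_i) \le \hat{d}(s_i,t_i) \le d(s_i,t_i) + 2\left\lceil\frac{d(s_i,t_i)}{2k}\right\rceil$$ in $\tilde{O}(m^{1-\frac{1}{k+1}}n)$ total time.
   Context: The $n$-pairs shortest paths problem ($n$-PSP): given a graph and a set of $O(n)$ vertex pairs $(s_i,t_i)$, compute (or here, approximate) $d(s_i,t_i)$ for each pair, where $d(u,v)$ is the length of a shortest path between $u$ and $v$ in $G$. $\tilde{O}(\cdot)$ hides factors polylogarithmic in $n$. The algorithm may be randomized. -}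

module Defs where

open import Data.Bool.Base using (Bool; true; false; if_then_else_)
open import Data.Fin.Base using (Fin; toℕ)
open import Data.List.Base as List using (List; []; _∷_; _++_; concatMap; drop; head; length)
open import Data.List.Membership.Propositional using (_∉_)
open import Data.Maybe.Base using (fromMaybe)
open import Data.Nat.Base using (ℕ; zero; suc; _+_; _*_; _∸_; _^_; _≤_; _<ᵇ_; _≡ᵇ_; _/_; _%_; NonZero)
open import Data.Nat.DivMod using (_mod_)
open import Data.Nat.Logarithm using (⌊log₂_⌋)
open import Data.Nat.Properties using (m^n≢0)
open import Data.Product.Base using (_×_; _,_; proj₁; proj₂; ∃-syntax; swap)
open import Data.Sum.Base using (_⊎_)
open import Data.Vec.Base as Vec using (Vec; lookup; toList; replicate; _[_]≔_)
open import Data.Vec.Functional using (Vector; updateAt)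
open import Function.Base using (const)
open import Relation.Binary.Construct.Add.Supremum.NonStrict _≤_ using () renaming (_≤⁺_ to _≤∞_) public
open import Relation.Binary.PropositionalEquality.Core using (_≡_; _≢_)
open import Relation.Nullary.Construct.Add.Supremum using (_⁺; [_]; ⊤⁺)
open import Relation.Nullary.Negation.Core using (¬_)

------------------------------------------------------------------------
-- Graphs and distances

-- A simple undirected graph on n vertices, presented by its m edges.  The
-- order of the edges and the orientation in which each one is written down
-- are arbitrary.
record Graph (n m : ℕ) : Set where
  field
    edges    : Vec (Fin n × Fin n) m
    loopless : ∀ e → proj₁ (lookup edges e) ≢ proj₂ (lookup edges e)
    distinct : ∀ e f → lookup edges e ≡ lookup edges f ⊎ lookup edges e ≡ swap (lookup edges f) → e ≡ f

  Adj : Fin n → Fin n → Set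
  Adj u v = ∃[ e ] (lookup edges e ≡ (u , v) ⊎ lookup edges e ≡ (v , u))

open Graph public

data Walk {n m} (G : Graph n m) : Fin n → Fin n → ℕ → Set where
  here : ∀ {u} → Walk G u u 0
  step : ∀ {u v x ℓ} → Adj G u v → Walk G v x ℓ → Walk G u x (suc ℓ)

-- Naturals with a greatest element ⊤⁺, the distance between vertices in
-- different components.
ℕ∞ : Set
ℕ∞ = ℕ ⁺

-- d(u,v) = d, as a relation.
Distance : ∀ {n m} → Graph n m → Fin n → Fin n → ℕ∞ → Set
Distance G u v [ d ] = Walk G u v d × (∀ ℓ → Walk G u v ℓ → d ≤ ℓ)
Distance G u v ⊤⁺    = ∀ ℓ → ¬ Walk G u v ℓ

-- ⌈ x / y ⌉; the value at y = 0 is a dummy.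
⌈_÷_⌉ : ℕ → ℕ → ℕ
⌈ x ÷ zero  ⌉ = 0
⌈ x ÷ suc y ⌉ = (x + y) / suc y

-- Number of bits of n (and 1 for n = 0), so that logarithmic factors never
-- vanish.
lg : ℕ → ℕ
lg n = suc ⌊log₂ n ⌋

------------------------------------------------------------------------
-- A structured word RAM: while-programs over finitely many registers and a
-- memory of 2 ^ w cells, all holding w-bit words.  Every operation on words,
-- memory access, test and coin toss costs one unit of time.

data Op : Set where
  add sub mul div mod lt eq : Op

data Expr (r : ℕ) : Set where
  lit  : ℕ → Expr r
  reg  : Fin r → Expr r
  load : Expr r → Expr r
  bin  : Op → Expr r → Expr r → Expr r

infix  6 _≔_
infixr 5 _⨾_

data Prog (r : ℕ) : Set where
  skip  : Prog r
  _≔_   : Fin r → Expr r → Prog r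
  store : (address value : Expr r) → Prog r
  flip  : Fin r → Prog r
  _⨾_   : Prog r → Prog r → Prog r
  cond  : Expr r → Prog r → Prog r → Prog r
  while : Expr r → Prog r → Prog r

cost : ∀ {r} → Expr r → ℕ
cost (lit _)     = 1
cost (reg _)     = 1
cost (load e)    = suc (cost e)
cost (bin _ e f) = suc (cost e + cost f)

bit : Bool → ℕ
bit b = if b then 1 else 0

-- Before reduction to w bits.  Subtraction is truncated at 0, and division
-- by 0 yields 0.
⟦_⟧ : Op → ℕ → ℕ → ℕ
⟦ add ⟧ x y       = x + y
⟦ sub ⟧ x y       = x ∸ y
⟦ mul ⟧ x y       = x * y
⟦ div ⟧ x zero    = 0
⟦ div ⟧ x (suc y) = x / suc y
⟦ mod ⟧ x zero    = 0
⟦ mod ⟧ x (suc y) = x % suc y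
⟦ lt  ⟧ x y       = bit (x <ᵇ y)
⟦ eq  ⟧ x y       = bit (x ≡ᵇ y)

Word : ℕ → Set
Word w = Fin (2 ^ w)

word : ∀ w → ℕ → Word w
word w x = _mod_ x (2 ^ w) {{m^n≢0 2 w}}

record State (w r : ℕ) : Set where
  constructor ⟨_,_,_⟩
  field
    regs  : Vec (Word w) r
    mem   : Vector (Word w) (2 ^ w)
    coins : List Bool

open State public

eval : ∀ {w r} → Expr r → State w r → Word w
eval {w} (lit x)     σ = word w x
eval     (reg i)     σ = lookup (regs σ) i
eval     (load e)    σ = mem σ (eval e σ)
eval {w} (bin o e f) σ = word w (⟦ o ⟧ (toℕ (eval e σ)) (toℕ (eval f σ)))

-- P , σ ⇓[ t ] τ: started in σ, the program P terminates in τ after time t.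
-- A coin toss consumes the first element of the tape and has no transition
-- on an empty tape.
infix 4 _,_⇓[_]_

data _,_⇓[_]_ {w r : ℕ} : Prog r → State w r → ℕ → State w r → Set where

  ⇓-skip : ∀ {σ} → skip , σ ⇓[ 1 ] σ

  ⇓-≔ : ∀ {i e σ} →
    i ≔ e , σ ⇓[ suc (cost e) ] ⟨ regs σ [ i ]≔ eval e σ , mem σ , coins σ ⟩

  ⇓-store : ∀ {e f σ} →
    store e f , σ ⇓[ suc (cost e + cost f) ]
      ⟨ regs σ , updateAt (mem σ) (eval e σ) (const (eval f σ)) , coins σ ⟩

  ⇓-flip : ∀ {i ρ μ b bs} →
    flip i , ⟨ ρ , μ , b ∷ bs ⟩ ⇓[ 1 ] ⟨ ρ [ i ]≔ word w (bit b) , μ , bs ⟩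

  ⇓-⨾ : ∀ {P Q σ τ υ s t} →
    P , σ ⇓[ s ] τ → Q , τ ⇓[ t ] υ → P ⨾ Q , σ ⇓[ s + t ] υ

  ⇓-cond-true : ∀ {e P Q σ τ t} → toℕ (eval e σ) ≢ 0 →
    P , σ ⇓[ t ] τ → cond e P Q , σ ⇓[ suc (cost e + t) ] τ

  ⇓-cond-false : ∀ {e P Q σ τ t} → toℕ (eval e σ) ≡ 0 →
    Q , σ ⇓[ t ] τ → cond e P Q , σ ⇓[ suc (cost e + t) ] τ

  ⇓-while-true : ∀ {e P σ τ υ s t} → toℕ (eval e σ) ≢ 0 →
    P , σ ⇓[ s ] τ → while e P , τ ⇓[ t ] υ →
    while e P , σ ⇓[ suc (cost e + (s + t)) ] υ

  ⇓-while-false : ∀ {e P σ} → toℕ (eval e σ) ≡ 0 →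
    while e P , σ ⇓[ suc (cost e) ] σ

HaltsWithin : ∀ {w r} → ℕ → Prog r → State w r → State w r → Set
HaltsWithin T P σ τ = ∃[ t ] (t ≤ T × P , σ ⇓[ t ] τ)

------------------------------------------------------------------------
-- Input and output of n-pairs shortest paths

pairCode : ∀ {n} → Fin n × Fin n → List ℕ
pairCode (u , v) = toℕ u ∷ toℕ v ∷ []

input : ∀ {n m q} → Graph n m → Vec (Fin n × Fin n) q → List ℕ
input {n} {m} {q} G pairs =
  n ∷ m ∷ q ∷ concatMap pairCode (toList (edges G)) ++ concatMap pairCode (toList pairs)

-- The input occupies memory from address 0 on; all else is zero.
initial : ∀ {n m q} w r → Graph n m → Vec (Fin n × Fin n) q → List Bool → State w r
initial w r G pairs ω =
  ⟨ replicate r (word w 0)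
  , (λ a → word w (fromMaybe 0 (head (drop (toℕ a) (input G pairs)))))
  , ω ⟩

decode : ℕ → ℕ∞
decode zero    = ⊤⁺
decode (suc d) = [ d ]

-- The estimate for the i-th pair (counting from 0) is read from address i.
estimate : ∀ {w r q} → State w r → Fin q → ℕ∞
estimate {w} σ i = decode (toℕ (mem σ (word w (toℕ i))))

------------------------------------------------------------------------
-- Randomness

-- P fails with probability at most 1/N over T independent fair coins.
FailsAtMost1/ : ∀ {T} → ℕ → (Vec Bool T → Set) → Set
FailsAtMost1/ {T} N P =
  ∃[ bad ] (length bad * N ≤ 2 ^ T × (∀ ω → ω ∉ bad → P ω))

{-# OPTIONS --safe #-}

-- Let D be the least integer ≥ 2 with D ^ (k + 1) ≥ m, so that n D ^ k is the
-- time allowed.  Every vertex v stores the first D vertices found by a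
-- breadth-first search from v, with their distances; unless this is the whole
-- component of v, the search ends at some radius r and all vertices closer
-- than r are stored.  A greedy hitting set picks vertices x such that every v
-- with a truncated list has a pick within its radius; a full search from each
-- pick provides the detours s → x → t.  With decreasing thresholds τ, each pick
-- hits at least τ lists while no vertex lies in more than 2 τ of them, so there
-- are at most 2 N / D picks per threshold, where N = min (n, 2 m), and their
-- searches fit into the time allowed.
--
-- Let d = d(s,t) and L = ⌈ d / 2 k ⌉.  If a vertex of a shortest path has a pick
-- within distance L, the detour through it costs at most 2 L extra.  Otherwise
-- every vertex of the path stores its ball of radius L, hence the middle of the
-- path is reached by k hops through stored lists from s as well as from t.  Each
-- end has D ^ k sequences of hops, and all of them are tried.  No coins are
-- tossed, so no coin sequence is bad.

module Submission where

open import Defs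
open import Data.Bool.Base using (Bool; true; false; if_then_else_; T; not; _∧_; _∨_)
open import Data.Empty using (⊥; ⊥-elim)
open import Data.Fin using (#_)
open import Data.Fin.Base using (Fin; toℕ; zero; suc; fromℕ<; _↑ˡ_; _↑ʳ_; splitAt; join; combine)
open import Data.Fin.Properties using (toℕ<n; toℕ-fromℕ<; toℕ-injective; fromℕ<-toℕ; splitAt-↑ˡ; splitAt-↑ʳ; join-splitAt; toℕ-↑ˡ; toℕ-↑ʳ; any?; injective⇒≤; combine-injective) renaming (_≟_ to _≟F_)
open import Data.List.Base using (List; []; _∷_; _++_; concatMap; drop; head; length)
open import Data.List.Properties using (++-identityʳ)
open import Data.Maybe.Base using (fromMaybe; map)
open import Data.Nat.Base
open import Data.Nat.DivMod
open import Data.Nat.Induction using (<-wellFounded; <-rec)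
open import Data.Nat.Logarithm using (⌊log₂_⌋; ⌊log₂⌋-mono-≤; ⌊log₂⌊n/2⌋⌋≡⌊log₂n⌋∸1)
open import Data.Nat.Properties
open import Data.Nat.Tactic.RingSolver using (solve-∀)
open import Data.Product.Base using (Σ-syntax; ∃-syntax; _×_; _,_; proj₁; proj₂; swap)
open import Data.Product.Properties using (≡-dec)
open import Data.Sum.Base using (_⊎_; inj₁; inj₂; [_,_]′)
open import Data.Unit.Base using (⊤; tt)
open import Data.Vec.Base using (Vec; lookup; toList; _[_]≔_)
open import Data.Vec.Functional using (updateAt)
open import Data.Vec.Functional.Properties using (updateAt-updates; updateAt-minimal)
open import Data.Vec.Properties using (lookup∘update; lookup∘update′; lookup-replicate)
open import Function.Base using (_∘_; id; const; case_of_; _$_)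
open import Induction.WellFounded using (Acc; acc)
open import Relation.Binary.Construct.Add.Supremum.NonStrict _≤_ using (_≤⊤⁺) renaming ([_] to [_]≤)
open import Relation.Binary.PropositionalEquality hiding (J)
open import Relation.Nullary using (¬_; Dec; yes; no; contradiction)
open import Relation.Nullary.Construct.Add.Supremum using ([_]; ⊤⁺)
open import Relation.Nullary.Decidable using (map′; _×-dec_; _⊎-dec_)

-- A language with registers and arrays

-- The balance behind `D`: the lists cost `D * D` steps per vertex, which fits into `D ^ k` because
-- `k ≥ 2`; a search from a pick costs `n + 2 m + q`, and no single bound on the number of picks
-- pays for all three terms. Hence the two values of `N`. The value `2 m` needs counters bounded by
-- degrees, which holds since isolated vertices lie in no truncated list.
--
-- A pick hits a list by its distance from `v`, not by membership. All stored vertices pass this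
-- test, so the greedy count stays valid; and what it leaves at a path vertex is a clean
-- alternative: the ball of radius `L` is stored, or `L` is at least the radius of the list.
--
-- Roots of `m` are avoided by comparing powers with exponent `k + 1`; minimality of `D` gives
-- `D ^ (k + 1) ≤ 2 ^ (k + 1) * (1 ⊔ m)`.
--
-- The other obstacle is the machine, whose words may overflow. The program is therefore written in
-- a small language over unbounded numbers. While all stored values are at most `V` and words have
-- room for `V ^ 16`, the compiled code agrees with it. Elapsed time is part of the loop invariants,
-- which makes amortised bounds expressible.

NR NA : ℕ
NR = 32
NA = 12

infix  8 _⟨_⟩
infixl 7 _⊗_ _⊘_ _⊛_
infixl 6 _⊕_ _⊖_
infix  5 _≺_

-- par stands for the literal k.
data Term : Set where
  `_  : ℕ → Term
  par : Term
  $_  : Fin NR → Term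
  _⟨_⟩ : Fin NA → Term → Term
  op  : Op → Term → Term → Term

_⊕_ _⊖_ _⊗_ _⊘_ _⊛_ _≺_ : Term → Term → Term
_⊕_ = op add
_⊖_ = op sub
_⊗_ = op mul
_⊘_ = op div
_⊛_ = op mod
_≺_ = op lt

infix  4 _:=_ _⟨_⟩:=_
infixr 3 _▸_

data Command : Set where
  nop   : Command
  _:=_  : Fin NR → Term → Command
  _⟨_⟩:=_ : Fin NA → Term → Term → Command
  rd    : Fin NR → Term → Command
  wr    : Term → Term → Command
  _▸_   : Command → Command → Command
  iff   : Term → Command → Command → Command
  wh    : Term → Command → Command

-- lw is the memory below address β, which holds the input and in the end the output.
record Store : Set where
  constructor st
  field
    rg : Fin NR → ℕ
    ar : Fin NA → ℕ → ℕ
    lw : ℕ → ℕ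
open Store public

infix 4 _==_
_==_ : ∀ {n} → Fin n → Fin n → Bool
x == y = toℕ x ≡ᵇ toℕ y

setf : (ℕ → ℕ) → ℕ → ℕ → ℕ → ℕ
setf f i v j = if i ≡ᵇ j then v else f j

setR : Fin NR → ℕ → Store → Store
setR x v σ = st (λ y → if x == y then v else rg σ y) (ar σ) (lw σ)

setA : Fin NA → ℕ → ℕ → Store → Store
setA a i v σ = st (rg σ) (λ b → if a == b then setf (ar σ b) i v else ar σ b) (lw σ)

setL : ℕ → ℕ → Store → Store
setL i v σ = st (rg σ) (ar σ) (setf (lw σ) i v)

setf-eq : ∀ f i v → setf f i v i ≡ v
setf-eq f i v with i ≡ᵇ i in e
... | true  = refl
... | false = ⊥-elim (subst T e (≡⇒≡ᵇ i i refl))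

setf-ne : ∀ f i v j → i ≢ j → setf f i v j ≡ f j
setf-ne f i v j i≢j with i ≡ᵇ j in e
... | true  = ⊥-elim (i≢j (≡ᵇ⇒≡ i j (subst T (sym e) tt)))
... | false = refl

writesR : Command → Fin NR → Bool
writesR nop y = false
writesR (x := _) y = x == y
writesR (_ ⟨ _ ⟩:= _) y = false
writesR (rd x _) y = x == y
writesR (wr _ _) y = false
writesR (P ▸ Q) y = writesR P y ∨ writesR Q y
writesR (iff _ P Q) y = writesR P y ∨ writesR Q y
writesR (wh _ P) y = writesR P y

writesA : Command → Fin NA → Bool
writesA nop y = false
writesA (x := _) y = false
writesA (a ⟨ _ ⟩:= _) y = a == y
writesA (rd x _) y = false
writesA (wr _ _) y = false
writesA (P ▸ Q) y = writesA P y ∨ writesA Q y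
writesA (iff _ P Q) y = writesA P y ∨ writesA Q y
writesA (wh _ P) y = writesA P y

writesL : Command → Bool
writesL nop = false
writesL (x := _) = false
writesL (a ⟨ _ ⟩:= _) = false
writesL (rd x _) = false
writesL (wr _ _) = true
writesL (P ▸ Q) = writesL P ∨ writesL Q
writesL (iff _ P Q) = writesL P ∨ writesL Q
writesL (wh _ P) = writesL P

-- The side conditions are Booleans computed from the syntax: for a concrete program and variable
-- they reduce to `⊤` and are filled in by eta, so that using a frame needs no proof.
record Frame (P : Command) (σ τ : Store) : Set where
  field
    fR : ∀ x → {_ : T (not (writesR P x))} → rg τ x ≡ rg σ x
    fA : ∀ a → {_ : T (not (writesA P a))} → ar τ a ≡ ar σ a
    fL : {_ : T (not (writesL P))} → lw τ ≡ lw σ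
open Frame public

-- Serves as the exponent of `V` in a bound on the value. An array read returns at most `V`, yet
-- keeps the size of its index, because the index is itself computed in a word.
esize : Term → ℕ
esize (` _) = 1
esize par = 1
esize ($ _) = 1
esize (_ ⟨ e ⟩) = esize e
esize (op _ e f) = esize e + esize f

litsOK : Term → Bool
litsOK (` x) = x ≤ᵇ 8
litsOK par = true
litsOK ($ _) = true
litsOK (_ ⟨ e ⟩) = litsOK e
litsOK (op _ e f) = litsOK e ∧ litsOK f

-- While all stored values are at most V ≥ 9, such an expression is at most V ^ 16,
-- so that it cannot overflow a word above that.
ok : Term → Bool
ok e = (esize e ≤ᵇ 16) ∧ litsOK e

-- The value cannot exceed a bound on all stored values.
tame : Term → Bool
tame (` _) = true
tame par = true
tame ($ _) = true
tame (_ ⟨ _ ⟩) = true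
tame (op add _ _) = false
tame (op sub e _) = tame e
tame (op mul _ _) = false
tame (op div e _) = tame e
tame (op mod e _) = tame e
tame (op lt _ _) = true
tame (op eq _ _) = true

-- Register 0 holds the length β of the input; above it the arrays are interleaved,
-- cell i of array a having the address β + (a + NA * i).
compE : ℕ → Term → Expr (suc NR)
compE k (` x) = lit x
compE k par = lit k
compE k ($ x) = reg (suc x)
compE k (a ⟨ e ⟩) = load (bin add (reg zero) (bin add (lit (toℕ a)) (bin mul (lit NA) (compE k e))))
compE k (op o e f) = bin o (compE k e) (compE k f)

compC : ℕ → Command → Prog (suc NR)
compC k nop = skip
compC k (x := e) = suc x ≔ compE k e
compC k (a ⟨ e ⟩:= f) = store (bin add (reg zero) (bin add (lit (toℕ a)) (bin mul (lit NA) (compE k e)))) (compE k f)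
compC k (rd x e) = suc x ≔ load (compE k e)
compC k (wr e f) = store (compE k e) (compE k f)
compC k (P ▸ Q) = compC k P ⨾ compC k Q
compC k (iff e P Q) = cond (compE k e) (compC k P) (compC k Q)
compC k (wh e P) = while (compE k e) (compC k P)

evalE : ℕ → Term → Store → ℕ
evalE k (` x) σ = x
evalE k par σ = k
evalE k ($ x) σ = rg σ x
evalE k (a ⟨ e ⟩) σ = ar σ a (evalE k e σ)
evalE k (op o e f) σ = ⟦ o ⟧ (evalE k e σ) (evalE k f σ)
∧-T : ∀ {a b} → T (a ∧ b) → T a × T b
∧-T {true} {true} _ = tt , tt

+≤* : ∀ {x y} → 2 ≤ x → 2 ≤ y → x + y ≤ x * y
+≤* {suc (suc x)} {suc (suc y)} (s≤s (s≤s z≤n)) (s≤s (s≤s z≤n)) = begin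
  suc (suc x) + suc (suc y)             ≤⟨ +-monoʳ-≤ (suc (suc x)) (m≤n+m (suc (suc y)) 0) ⟩
  suc (suc x) + suc (suc y)             ≤⟨ s≤s (s≤s (m≤m+n (x + suc (suc y)) (y + x * suc y))) ⟩
  2 + (x + suc (suc y) + (y + x * suc y)) ≡⟨ lem x y ⟩
  suc (suc x) * suc (suc y) ∎
  where
  open ≤-Reasoning
  open import Data.Nat.Tactic.RingSolver using (solve-∀)
  lem : ∀ x y → 2 + (x + suc (suc y) + (y + x * suc y)) ≡ suc (suc x) * suc (suc y)
  lem = solve-∀

bit≤1 : ∀ b → bit b ≤ 1
bit≤1 true = ≤-refl
bit≤1 false = z≤n

esize≥1 : ∀ e → 1 ≤ esize e
esize≥1 (` x) = ≤-refl
esize≥1 par = ≤-refl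
esize≥1 ($ x) = ≤-refl
esize≥1 (a ⟨ e ⟩) = esize≥1 e
esize≥1 (op o e f) = m≤n⇒m≤n+o (esize f) (esize≥1 e)

-- Sums obey the bound for products because `V ^ a` and `V ^ b` are both at least 2; each of the
-- remaining operations is bounded by its first argument or by 1.
⟦⟧≤ : ∀ o {V x y a b} → 2 ≤ V → 1 ≤ a → 1 ≤ b → x ≤ V ^ a → y ≤ V ^ b → ⟦ o ⟧ x y ≤ V ^ (a + b)
⟦⟧≤ o {V} {x} {y} {a} {b} V≥2 a≥1 b≥1 px py = go o
  where
  open ≤-Reasoning
  nzV : NonZero V
  nzV = >-nonZero (≤-trans (s≤s z≤n) V≥2)
  up : ∀ {c} → 1 ≤ c → 2 ≤ V ^ c
  up {c} c≥1 = begin 2 ≤⟨ V≥2 ⟩ V ≡⟨ ^-identityʳ V ⟨ V ^ 1 ≤⟨ ^-monoʳ-≤ V {{nzV}} c≥1 ⟩ V ^ c ∎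
  x≤ : x ≤ V ^ (a + b)
  x≤ = ≤-trans px (^-monoʳ-≤ V {{nzV}} (m≤m+n a b))
  bit≤ : ∀ c → bit c ≤ V ^ (a + b)
  bit≤ c = ≤-trans (bit≤1 c) (≤-trans (n≤1+n 1) (up (≤-trans a≥1 (m≤m+n a b))))
  mulV : ∀ {z} → z ≤ V ^ a * V ^ b → z ≤ V ^ (a + b)
  mulV {z} h = subst (z ≤_) (sym (^-distribˡ-+-* V a b)) h
  div≤ : ∀ z → ⟦ div ⟧ x z ≤ x
  div≤ zero = z≤n
  div≤ (suc z) = m/n≤m x (suc z)
  mod≤ : ∀ z → ⟦ mod ⟧ x z ≤ x
  mod≤ zero = z≤n
  mod≤ (suc z) = m%n≤m x (suc z)
  go : ∀ o → ⟦ o ⟧ x y ≤ V ^ (a + b)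
  go add = mulV (≤-trans (+-mono-≤ px py) (+≤* (up a≥1) (up b≥1)))
  go sub = ≤-trans (m∸n≤m x y) x≤
  go mul = mulV (*-mono-≤ px py)
  go div = ≤-trans (div≤ y) x≤
  go mod = ≤-trans (mod≤ y) x≤
  go lt = bit≤ _
  go eq = bit≤ _

toℕ-word : ∀ {w x} → x < 2 ^ w → toℕ (word w x) ≡ x
toℕ-word {w} {x} p = trans (toℕ-fromℕ< _) (m<n⇒m%n≡m {{m^n≢0 2 w}} p)

-- The offset modulo `NA` recovers the array, after which the index cancels.
addr-inj : ∀ {β} {a b : Fin NA} {i j} → β + (toℕ a + NA * i) ≡ β + (toℕ b + NA * j) → a ≡ b × i ≡ j
addr-inj {β} {a} {b} {i} {j} p = toℕ-injective ab , *-cancelˡ-≡ i j NA (+-cancelˡ-≡ (toℕ a) _ _ (trans q (cong (_+ NA * j) (sym ab))))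
  where
  q : toℕ a + NA * i ≡ toℕ b + NA * j
  q = +-cancelˡ-≡ β _ _ p
  r : ∀ (c : Fin NA) l → (toℕ c + NA * l) % NA ≡ toℕ c
  r c l = trans (cong (λ z → (toℕ c + z) % NA) (*-comm NA l)) (trans ([m+kn]%n≡m%n (toℕ c) l NA) (m<n⇒m%n≡m (toℕ<n c)))
  ab : toℕ a ≡ toℕ b
  ab = trans (sym (r a i)) (trans (cong (_% NA) q) (r b j))

==-refl : ∀ {n} (x : Fin n) → (x == x) ≡ true
==-refl x with x == x in e
... | true  = refl
... | false = ⊥-elim (subst T e (≡⇒≡ᵇ (toℕ x) (toℕ x) refl))

∨-T : ∀ {a b} → T (not (a ∨ b)) → T (not a) × T (not b)
∨-T {false} {false} _ = tt , tt

straight : Command → Bool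
straight (x := e) = true
straight (a ⟨ e ⟩:= f) = true
straight (P ▸ Q) = straight P ∧ straight Q
straight _ = false

okC : Command → Bool
okC (x := e) = ok e
okC (a ⟨ e ⟩:= f) = ok e ∧ ok f
okC (P ▸ Q) = okC P ∧ okC Q
okC _ = true

for : Fin NR → Term → Command → Command
for x N P = x := ` 0 ▸ wh ($ x ≺ N) (P ▸ x := $ x ⊕ ` 1)

bit-F : ∀ {b} → ¬ T b → bit b ≡ 0
bit-F {true} h = ⊥-elim (h tt)
bit-F {false} h = refl

T-bit : ∀ {b} → bit b ≢ 0 → T b
T-bit {true} _ = tt
T-bit {false} h = h refl

F-bit : ∀ {b} → bit b ≡ 0 → ¬ T b
F-bit {false} _ ()

bit-< : ∀ {x y} → bit (x <ᵇ y) ≢ 0 → x < y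
bit-< {x} {y} h = <ᵇ⇒< x y (T-bit h)

bit-≥ : ∀ {x y} → bit (x <ᵇ y) ≡ 0 → y ≤ x
bit-≥ h = ≮⇒≥ (λ l → F-bit h (<⇒<ᵇ l))

-- Finite sums

sum : (ℕ → ℕ) → ℕ → ℕ
sum f zero = 0
sum f (suc n) = f n + sum f n

sum-mono : ∀ {f g} n → (∀ i → i < n → f i ≤ g i) → sum f n ≤ sum g n
sum-mono zero h = z≤n
sum-mono (suc n) h = +-mono-≤ (h n ≤-refl) (sum-mono n (λ i l → h i (m≤n⇒m≤1+n l)))

sum-cong : ∀ {f g} n → (∀ i → i < n → f i ≡ g i) → sum f n ≡ sum g n
sum-cong zero h = refl
sum-cong (suc n) h = cong₂ _+_ (h n ≤-refl) (sum-cong n (λ i l → h i (m≤n⇒m≤1+n l)))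

sum-+ : ∀ f g n → sum (λ i → f i + g i) n ≡ sum f n + sum g n
sum-+ f g zero = refl
sum-+ f g (suc n) rewrite sum-+ f g n = lem (f n) (g n) (sum f n) (sum g n)
  where
  lem : ∀ a b c d → a + b + (c + d) ≡ a + c + (b + d)
  lem = solve-∀

sum-*ʳ : ∀ f c n → sum (λ i → f i * c) n ≡ sum f n * c
sum-*ʳ f c zero = refl
sum-*ʳ f c (suc n) rewrite sum-*ʳ f c n = sym (*-distribʳ-+ c (f n) (sum f n))

sum-const : ∀ c n → sum (λ _ → c) n ≡ n * c
sum-const c zero = refl
sum-const c (suc n) = cong (c +_) (sum-const c n)

sum-zero : ∀ {f} n → (∀ i → i < n → f i ≡ 0) → sum f n ≡ 0
sum-zero n h = trans (sum-cong n h) (trans (sum-const 0 n) (*-zeroʳ n))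

sum-swap : ∀ (f : ℕ → ℕ → ℕ) n m → sum (λ i → sum (f i) m) n ≡ sum (λ j → sum (λ i → f i j) n) m
sum-swap f zero m = sym (sum-zero m (λ _ _ → refl))
sum-swap f (suc n) m rewrite sum-swap f n m = sym (sum-+ (f n) (λ j → sum (λ i → f i j) n) m)

sum-≥ : ∀ f n i → i < n → f i ≤ sum f n
sum-≥ f (suc n) i (s≤s i≤n) with i ≟ n
... | yes refl = m≤m+n (f n) _
... | no ne = ≤-trans (sum-≥ f n i (≤∧≢⇒< i≤n ne)) (m≤n+m _ (f n))

sum≢0 : ∀ f n → sum f n ≢ 0 → ∃[ i ] (i < n × f i ≢ 0)
sum≢0 f zero h = ⊥-elim (h refl)
sum≢0 f (suc n) h with f n ≟ 0
... | no ne = n , ≤-refl , ne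
... | yes z with sum≢0 f n (λ y → h (cong₂ _+_ z y))
...   | i , l , ne = i , m≤n⇒m≤1+n l , ne

sum≤1 : ∀ f n → (∀ i → i < n → f i ≤ 1) → (∀ i j → i < n → j < n → f i ≢ 0 → f j ≢ 0 → i ≡ j) → sum f n ≤ 1
sum≤1 f zero _ _ = z≤n
sum≤1 f (suc n) h inj with f n ≟ 0
... | yes z rewrite z = sum≤1 f n (λ i l → h i (m≤n⇒m≤1+n l)) (λ i j a b → inj i j (m≤n⇒m≤1+n a) (m≤n⇒m≤1+n b))
... | no nz = ≤-trans (≤-reflexive (trans (cong (f n +_) (sum-zero n rest)) (+-identityʳ _))) (h n ≤-refl)
  where
  rest : ∀ i → i < n → f i ≡ 0
  rest i l with f i ≟ 0
  ... | yes z = z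
  ... | no ne = ⊥-elim (<⇒≢ l (inj i n (m≤n⇒m≤1+n l) ≤-refl ne nz))

δ : ℕ → ℕ → ℕ
δ a b = bit (a ≡ᵇ b)

δ-refl : ∀ a → δ a a ≡ 1
δ-refl a with a ≡ᵇ a in e
... | true  = refl
... | false = ⊥-elim (subst T e (≡⇒≡ᵇ a a refl))

δ-≢ : ∀ {a b} → a ≢ b → δ a b ≡ 0
δ-≢ {a} {b} ne = bit-F (ne ∘ ≡ᵇ⇒≡ a b)

δ≢0 : ∀ {a b} → δ a b ≢ 0 → a ≡ b
δ≢0 {a} {b} h = ≡ᵇ⇒≡ a b (T-bit h)

sum-δ : ∀ (g : ℕ → ℕ) n a → a < n → sum (λ i → δ a i * g i) n ≡ g a
sum-δ g (suc n) a (s≤s a≤n) with a ≟ n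
... | yes refl rewrite δ-refl a = trans (cong₂ _+_ (+-identityʳ (g a)) (sum-zero a (λ i l → cong (_* g i) (δ-≢ (>⇒≢ l))))) (+-identityʳ (g a))
... | no ne rewrite δ-≢ ne = sum-δ g n a (≤∧≢⇒< a≤n ne)

-- Each `g (f h)` is expanded into the sum over `v` of `δ (f h) v * g v`; after exchanging the sums,
-- injectivity leaves every `g v` at most once. The 0-1 weight `P` selects the indices on which `f`
-- has to be injective.
sum-inj : ∀ (P f g : ℕ → ℕ) H n → (∀ h → h < H → P h ≤ 1) → (∀ h → h < H → P h ≢ 0 → f h < n) →
  (∀ h h′ → h < H → h′ < H → P h ≢ 0 → P h′ ≢ 0 → f h ≡ f h′ → h ≡ h′) →
  sum (λ h → P h * g (f h)) H ≤ sum g n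
sum-inj P f g H n P≤1 f< inj = begin
  sum (λ h → P h * g (f h)) H                          ≡⟨ sum-cong H eq₁ ⟩
  sum (λ h → sum (λ v → P h * δ (f h) v * g v) n) H     ≡⟨ sum-swap (λ h v → P h * δ (f h) v * g v) H n ⟩
  sum (λ v → sum (λ h → P h * δ (f h) v * g v) H) n     ≤⟨ sum-mono n bnd ⟩
  sum g n ∎
  where
  open ≤-Reasoning
  eq₁ : ∀ h → h < H → P h * g (f h) ≡ sum (λ v → P h * δ (f h) v * g v) n
  eq₁ h l with P h ≟ 0
  ... | yes z rewrite z = sym (sum-zero n (λ _ _ → refl))
  ... | no nz = trans (cong (P h *_) (sym (sum-δ g n (f h) (f< h l nz))))
      (trans (*-comm (P h) _) (trans (sym (sum-*ʳ (λ v → δ (f h) v * g v) (P h) n))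
        (sum-cong n (λ v _ → trans (*-comm _ (P h)) (sym (*-assoc (P h) (δ (f h) v) (g v)))))))
  bnd : ∀ v → v < n → sum (λ h → P h * δ (f h) v * g v) H ≤ g v
  bnd v l = ≤-trans (≤-reflexive (sum-*ʳ (λ h → P h * δ (f h) v) (g v) H))
    (≤-trans (*-monoˡ-≤ (g v) (sum≤1 (λ h → P h * δ (f h) v) H (λ h lh → *-mono-≤ (P≤1 h lh) (bit≤1 _))
      (λ h h′ a b x y → inj h h′ a b (nzˡ x) (nzˡ y) (trans (δ≢0 (nzʳ {P h} x)) (sym (δ≢0 (nzʳ {P h′} y)))))))
      (≤-reflexive (*-identityˡ (g v))))
    where
    nzˡ : ∀ {a b} → a * b ≢ 0 → a ≢ 0
    nzˡ h refl = h refl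
    nzʳ : ∀ {a b} → a * b ≢ 0 → b ≢ 0
    nzʳ {a} h refl = h (*-zeroʳ a)

-- Breadth-first search

module Graphs (n H : ℕ) (src tgt : ℕ → ℕ) where

  record Simple : Set where
    field
      tgt<   : ∀ h → h < H → tgt h < n
      simple : ∀ h h′ → h < H → h′ < H → src h ≡ src h′ → tgt h ≡ tgt h′ → h ≡ h′
      symm   : ∀ h → h < H → ∃[ h′ ] (h′ < H × src h′ ≡ tgt h × tgt h′ ≡ src h)

  data Wk : ℕ → ℕ → ℕ → Set where
    nil  : ∀ {u} → Wk u u 0
    snoc : ∀ {u v ℓ} h → Wk u v ℓ → h < H → src h ≡ v → Wk u (tgt h) (suc ℓ)

  wk-++ : ∀ {u v x a b} → Wk u v a → Wk v x b → Wk u x (a + b)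
  wk-++ {a = a} p nil = subst (Wk _ _) (sym (+-identityʳ a)) p
  wk-++ {a = a} p (snoc {ℓ = ℓ} h q l e) = subst (Wk _ _) (sym (+-suc a ℓ)) (snoc h (wk-++ p q) l e)

  -- One more than the last arc before h that leaves u, and 0 if there is none: the
  -- links of the adjacency lists.
  prevOcc : ℕ → ℕ → ℕ
  prevOcc u zero = 0
  prevOcc u (suc h) = if src h ≡ᵇ u then suc h else prevOcc u h

  cnt : ℕ → ℕ → ℕ
  cnt u = sum (λ h → δ (src h) u)

  deg : ℕ → ℕ
  deg u = cnt u H

  prevOcc≤ : ∀ u h → prevOcc u h ≤ h
  prevOcc≤ u zero = z≤n
  prevOcc≤ u (suc h) with src h ≡ᵇ u
  ... | true = ≤-refl
  ... | false = m≤n⇒m≤1+n (prevOcc≤ u h)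

  prevOcc-src : ∀ u h → prevOcc u h ≢ 0 → src (prevOcc u h ∸ 1) ≡ u
  prevOcc-src u zero ne = ⊥-elim (ne refl)
  prevOcc-src u (suc h) ne with src h ≡ᵇ u in e
  ... | true = ≡ᵇ⇒≡ (src h) u (subst T (sym e) tt)
  ... | false = prevOcc-src u h ne

  prevOcc-none : ∀ u h h′ → prevOcc u h ≤ h′ → h′ < h → src h′ ≢ u
  prevOcc-none u (suc h) h′ a (s≤s b) with src h ≡ᵇ u in e
  ... | true = ⊥-elim (<-irrefl refl (≤-trans a b))
  ... | false with h′ ≟ h
  ...   | yes refl = λ z → subst T e (≡⇒≡ᵇ _ _ z)
  ...   | no ne = prevOcc-none u h h′ a (≤∧≢⇒< b ne)

  cnt-prevOcc : ∀ u h → cnt u (prevOcc u h) ≡ cnt u h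
  cnt-prevOcc u zero = refl
  cnt-prevOcc u (suc h) with src h ≡ᵇ u in e
  ... | true rewrite e = refl
  ... | false = cnt-prevOcc u h

  cnt-suc : ∀ u h → src h ≡ u → cnt u (suc h) ≡ suc (cnt u h)
  cnt-suc u h refl rewrite δ-refl (src h) = refl

  module _ (gs : Simple) where
    open Simple gs

    wk-rev : ∀ {u v ℓ} → Wk u v ℓ → Wk v u ℓ
    wk-rev nil = nil
    wk-rev (snoc {u} {v} {ℓ} h p l refl) with symm h l
    ... | h′ , l′ , e₁ , e₂ = subst (λ z → Wk (tgt h) u z) refl
            (wk-++ (subst (λ z → Wk (tgt h) z 1) e₂ (snoc h′ (subst (λ z → Wk (tgt h) z 0) (sym e₁) nil) l′ refl)) (wk-rev p))

    sum-deg : sum deg n ≤ H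
    sum-deg = ≤-trans (≤-reflexive (sum-swap (λ u h → δ (src h) u) n H))
      (≤-trans (sum-mono H (λ h l → sum≤1 (λ u → δ (src h) u) n (λ _ _ → bit≤1 _)
        (λ i j _ _ x y → trans (sym (δ≢0 {src h} {i} x)) (δ≢0 y)))) (≤-reflexive (trans (sum-const 1 H) (*-identityʳ H))))

    deg≥1 : ∀ {h} → h < H → 1 ≤ deg (src h)
    deg≥1 {h} l = ≤-trans (≤-reflexive (sym (δ-refl (src h)))) (sum-≥ (λ h′ → δ (src h′) (src h)) H h l)

    deg≢0 : ∀ {u v ℓ} → Wk u v ℓ → u ≢ v → 1 ≤ deg v × 1 ≤ deg u
    deg≢0 nil ne = ⊥-elim (ne refl)
    deg≢0 {u} (snoc {v = v} h p l refl) ne with symm h l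
    ... | h′ , l′ , e₁ , e₂ = subst (λ z → 1 ≤ deg z) e₁ (deg≥1 l′) , du
      where
      du : 1 ≤ deg u
      du with u ≟ v
      ... | yes refl = deg≥1 l
      ... | no ne′ = proj₂ (deg≢0 p ne′)

  module Search (root : ℕ) where

    -- Distances are avoided: minimality of the recorded values is expressed by deriving `InQ` with
    -- bound `ℓ` from every walk of length `ℓ`, while the field `wk` below supplies a walk of the
    -- recorded length.
    InQ : (Q d : ℕ → ℕ) → ℕ → ℕ → ℕ → Set
    InQ Q d s u ℓ = ∃[ j ] (j < s × Q j ≡ u × d j ≤ ℓ)

    record Queue (Q d vis : ℕ → ℕ) (s : ℕ) : Set where
      field
        s≥1  : 1 ≤ s
        Q0   : Q 0 ≡ root
        d0   : d 0 ≡ 0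
        Q<   : ∀ j → j < s → Q j < n
        visQ : ∀ j → j < s → vis (Q j) ≡ suc j
        Qvis : ∀ u → vis u ≡ 0 ⊎ ∃[ j ] (j < s × vis u ≡ suc j × Q j ≡ u)
        wk   : ∀ j → j < s → Wk root (Q j) (d j)
        d≤   : ∀ j → j < s → d j ≤ j
        mono : ∀ i j → i ≤ j → j < s → d i ≤ d j

      Q-inj : ∀ i j → i < s → j < s → Q i ≡ Q j → i ≡ j
      Q-inj i j a b e = suc-injective (trans (sym (visQ i a)) (trans (cong vis e) (visQ j b)))

      s≤n : s ≤ n
      s≤n = subst₂ _≤_ (trans (sum-const 1 s) (*-identityʳ s)) (trans (sum-const 1 n) (*-identityʳ n))
        (sum-inj (λ _ → 1) Q (λ _ → 1) s n (λ _ _ → ≤-refl) (λ j l _ → Q< j l) (λ i j a b _ _ → Q-inj i j a b))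

    -- Adjacency lists run through the arcs downwards, so the arcs from `p` on are those already
    -- scanned when the link is `p`.
    Proc : (Q d : ℕ → ℕ) → ℕ → ℕ → ℕ → Set
    Proc Q d s j p = ∀ h → h < H → src h ≡ Q j → p ≤ h → InQ Q d s (tgt h) (suc (d j))

    record Normal (Q d vis : ℕ → ℕ) (s i : ℕ) : Set where
      field
        que  : Queue Q d vis s
        i≤s  : i ≤ s
        proc : ∀ j → j < i → Proc Q d s j 0
        wide : i < s → ∀ j → j < s → d j ≤ suc (d i)

    record Inner (Q d vis : ℕ → ℕ) (s i p : ℕ) : Set where
      field
        que   : Queue Q d vis s
        i<s   : i < s
        proc  : ∀ j → j < i → Proc Q d s j 0
        wide  : ∀ j → j < s → d j ≤ suc (d i)
        procᵢ : Proc Q d s i p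

    Ball : (Q d : ℕ → ℕ) → ℕ → ℕ → Set
    Ball Q d s r = ∀ {u ℓ} → Wk root u ℓ → ℓ ≤ r → InQ Q d s u ℓ

    enter : ∀ {Q d vis s i} → Normal Q d vis s i → i < s → Inner Q d vis s i (prevOcc (Q i) H)
    enter {Q} {i = i} N l = record { que = que ; i<s = l ; proc = proc ; wide = wide l
      ; procᵢ = λ h h<H e p≤h → ⊥-elim (prevOcc-none (Q i) H h p≤h h<H e) }
      where open Normal N

    leave : ∀ {Q d vis s i} → Inner Q d vis s i 0 → Normal Q d vis s (suc i)
    leave {Q} {d} {vis} {s} {i} N = record { que = que ; i≤s = i<s ; proc = pr
      ; wide = λ l j j<s → ≤-trans (wide j j<s) (s≤s (Queue.mono que i (suc i) (n≤1+n i) l)) }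
      where
      open Inner N
      pr : ∀ j → j < suc i → Proc Q d s j 0
      pr j (s≤s j≤i) with j ≟ i
      ... | yes refl = procᵢ
      ... | no ne = proc j (≤∧≢⇒< j≤i ne)

    complete : ∀ {Q d vis s i} → Normal Q d vis s i → s ≤ i → ∀ {u ℓ} → Wk root u ℓ → InQ Q d s u ℓ
    complete {Q} {d} {vis} {s} {i} N s≤i = go
      where
      open Normal N
      open Queue que
      go : ∀ {u ℓ} → Wk root u ℓ → InQ Q d s u ℓ
      go nil = 0 , s≥1 , Q0 , ≤-reflexive d0
      go (snoc h p l e) with go p
      ... | j , j<s , qj , dj with proc j (<-≤-trans j<s s≤i) h l (trans e (sym qj)) z≤n
      ...   | j′ , a , b , c = j′ , a , b , ≤-trans c (s≤s dj)

    -- The predecessor of the end of such a walk has a recorded value below `d i`. As `d` is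
    -- monotone along the queue, it stands before `i` and has been scanned completely, even if `i`
    -- has not.
    truncated : ∀ {Q d vis s i p} → Inner Q d vis s i p → Ball Q d s (d i)
    truncated {Q} {d} {vis} {s} {i} N = go
      where
      open Inner N
      open Queue que
      go : ∀ {u ℓ} → Wk root u ℓ → ℓ ≤ d i → InQ Q d s u ℓ
      go nil _ = 0 , s≥1 , Q0 , ≤-reflexive d0
      go (snoc h p l e) le with go p (≤-trans (n≤1+n _) le)
      ... | j , j<s , qj , dj with proc j (≰⇒> (λ i≤j → <-irrefl refl (≤-trans le (≤-trans (mono i j i≤j j<s) dj)))) h l (trans e (sym qj)) z≤n
      ...   | j′ , a , b , c = j′ , a , b , ≤-trans c (s≤s dj)

    record Pushed (Q d vis : ℕ → ℕ) (s x y : ℕ) (Q′ d′ vis′ : ℕ → ℕ) : Set where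
      field
        Q-old : ∀ j → j < s → Q′ j ≡ Q j
        Q-new : Q′ s ≡ x
        d-old : ∀ j → j < s → d′ j ≡ d j
        d-new : d′ s ≡ y
        v-old : ∀ u → u ≢ x → vis′ u ≡ vis u
        v-new : vis′ x ≡ suc s

    start : ∀ {Q d vis} → root < n → Q 0 ≡ root → d 0 ≡ 0 → vis root ≡ 1 → (∀ u → u ≢ root → vis u ≡ 0) → Normal Q d vis 1 0
    start {Q} {d} {vis} r<n Q0 d0 v1 v0 = record
      { que = record { s≥1 = ≤-refl ; Q0 = Q0 ; d0 = d0 ; Q< = λ { zero _ → subst (_< n) (sym Q0) r<n ; (suc j) (s≤s ()) }
        ; visQ = λ { zero _ → trans (cong vis Q0) v1 ; (suc j) (s≤s ()) }
        ; Qvis = λ u → case u ≟ root of λ { (yes refl) → inj₂ (0 , ≤-refl , v1 , Q0) ; (no ne) → inj₁ (v0 u ne) }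
        ; wk = λ { zero _ → subst₂ (Wk root) (sym Q0) (sym d0) nil ; (suc j) (s≤s ()) }
        ; d≤ = λ { zero _ → ≤-reflexive d0 ; (suc j) (s≤s ()) }
        ; mono = λ { zero zero _ _ → ≤-refl ; _ (suc j) _ (s≤s ()) } }
      ; i≤s = z≤n ; proc = λ _ () ; wide = λ { _ zero _ → n≤1+n _ ; _ (suc j) (s≤s ()) } }

    -- `wide` is what keeps `d` monotone: no queued value exceeds `suc (d i)`, the value of the new
    -- entry.
    push : ∀ {Q d vis s i h Q′ d′ vis′} → Simple → Inner Q d vis s i (suc h) → h < H → src h ≡ Q i →
      vis (tgt h) ≡ 0 → Pushed Q d vis s (tgt h) (suc (d i)) Q′ d′ vis′ → Inner Q′ d′ vis′ (suc s) i (suc h)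
    push {Q} {d} {vis} {s} {i} {h} {Q′} {d′} {vis′} gs I h<H sh vx P = record
      { que = record { s≥1 = s≤s z≤n ; Q0 = trans (Q-old 0 s≥1) Q0 ; d0 = trans (d-old 0 s≥1) d0
        ; Q< = λ j l → byC (λ j → Q′ j < n) (λ j l → subst (_< n) (sym (Q-old j l)) (Q< j l)) (subst (_< n) (sym Q-new) (Simple.tgt< gs h h<H)) j l
        ; visQ = byC (λ j → vis′ (Q′ j) ≡ suc j) (λ j l → trans (cong vis′ (Q-old j l)) (trans (v-old _ (neQ j l)) (visQ j l)))
                   (trans (cong vis′ Q-new) v-new)
        ; Qvis = qv
        ; wk = byC (λ j → Wk root (Q′ j) (d′ j)) (λ j l → subst₂ (Wk root) (sym (Q-old j l)) (sym (d-old j l)) (wk j l))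
                 (subst₂ (Wk root) (sym Q-new) (sym d-new) (snoc h (wk i i<s) h<H sh))
        ; d≤ = byC (λ j → d′ j ≤ j) (λ j l → subst (_≤ j) (sym (d-old j l)) (d≤ j l)) (subst (_≤ s) (sym d-new) (≤-trans (s≤s (d≤ i i<s)) i<s))
        ; mono = mo }
      ; i<s = m≤n⇒m≤1+n i<s
      ; proc = λ j j<i → lift j (<-trans j<i i<s) (proc j j<i)
      ; wide = byC (λ j → d′ j ≤ suc (d′ i)) (λ j l → subst₂ (λ a b → a ≤ suc b) (sym (d-old j l)) (sym (d-old i i<s)) (wide j l))
                 (≤-reflexive (trans d-new (cong suc (sym (d-old i i<s)))))
      ; procᵢ = lift i i<s procᵢ }
      where
      open Inner I
      open Queue que
      open Pushed P
      byC : ∀ (X : ℕ → Set) → (∀ j → j < s → X j) → X s → ∀ j → j < suc s → X j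
      byC X f x j (s≤s j≤s) with j ≟ s
      ... | yes refl = x
      ... | no ne = f j (≤∧≢⇒< j≤s ne)
      neQ : ∀ j → j < s → Q j ≢ tgt h
      neQ j l e = contradiction (trans (sym (visQ j l)) (trans (cong vis e) vx)) λ ()
      qv : ∀ u → vis′ u ≡ 0 ⊎ ∃[ j ] (j < suc s × vis′ u ≡ suc j × Q′ j ≡ u)
      qv u with u ≟ tgt h
      ... | yes refl = inj₂ (s , ≤-refl , v-new , Q-new)
      ... | no ne with Qvis u
      ...   | inj₁ z = inj₁ (trans (v-old u ne) z)
      ...   | inj₂ (j , a , b , c) = inj₂ (j , m≤n⇒m≤1+n a , trans (v-old u ne) b , trans (Q-old j a) c)
      mo : ∀ a b → a ≤ b → b < suc s → d′ a ≤ d′ b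
      mo a b a≤b (s≤s b≤s) with b ≟ s
      ... | no ne = subst₂ _≤_ (sym (d-old a (≤-<-trans a≤b b<s))) (sym (d-old b b<s)) (mono a b a≤b b<s)
        where b<s = ≤∧≢⇒< b≤s ne
      ... | yes refl with a ≟ s
      ...   | yes refl = ≤-refl
      ...   | no ne = subst₂ _≤_ (sym (d-old a a<s)) (sym d-new) (wide a a<s)
        where a<s = ≤∧≢⇒< a≤b ne
      lift : ∀ {p} j → j < s → Proc Q d s j p → Proc Q′ d′ (suc s) j p
      lift j l pr h₁ h₁<H e p≤ with pr h₁ h₁<H (trans e (Q-old j l)) p≤
      ... | j′ , a , b , c = j′ , m≤n⇒m≤1+n a , trans (Q-old j′ a) b , subst₂ (λ x y → x ≤ suc y) (sym (d-old j′ a)) (sym (d-old j l)) c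

    scanned : ∀ {Q d vis s i h} → Inner Q d vis s i (suc h) → src h ≡ Q i → InQ Q d s (tgt h) (suc (d i)) →
      Inner Q d vis s i (prevOcc (Q i) h)
    scanned {Q} {d} {vis} {s} {i} {h} I sh inq = record { que = que ; i<s = i<s ; proc = proc ; wide = wide ; procᵢ = go }
      where
      open Inner I
      go : Proc Q d s i (prevOcc (Q i) h)
      go h₁ l e p≤ with h₁ <? h
      ... | yes lt₁ = ⊥-elim (prevOcc-none (Q i) h h₁ p≤ lt₁ e)
      ... | no nl with h₁ ≟ h
      ...   | yes refl = inq
      ...   | no ne = procᵢ h₁ l e (≤∧≢⇒< (≮⇒≥ nl) (≢-sym ne))

    -- Simplicity of the graph turns scanned arcs into distinct queue entries.
    arcs≤ : ∀ {Q d vis s i p c} → Simple → Inner Q d vis s i p → p ≤ H → c + cnt (Q i) p ≡ deg (Q i) → c ≤ s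
    arcs≤ {Q} {d} {vis} {s} {i} {p} {c} gs I p≤H e = begin
      c                                       ≡⟨ sym (m+n∸n≡m c (cnt (Q i) p)) ⟩
      c + cnt (Q i) p ∸ cnt (Q i) p           ≡⟨ cong (_∸ cnt (Q i) p) e ⟩
      deg (Q i) ∸ cnt (Q i) p                 ≤⟨ ∸-monoˡ-≤ (cnt (Q i) p) split ⟩
      sum P H + cnt (Q i) p ∸ cnt (Q i) p     ≡⟨ m+n∸n≡m (sum P H) (cnt (Q i) p) ⟩
      sum P H                                 ≡⟨ sum-cong H (λ h _ → sym (*-identityʳ (P h))) ⟩
      sum (λ h → P h * 1) H                   ≤⟨ sum-inj P pos (λ _ → 1) H s (λ h _ → *-mono-≤ (bit≤1 (p ≤ᵇ h)) (bit≤1 (src h ≡ᵇ Q i))) pos< inj ⟩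
      sum (λ _ → 1) s                         ≡⟨ trans (sum-const 1 s) (*-identityʳ s) ⟩
      s ∎
      where
      open ≤-Reasoning
      open Inner I
      open Queue que
      P : ℕ → ℕ
      P h = bit (p ≤ᵇ h) * δ (src h) (Q i)
      pos : ℕ → ℕ
      pos h = vis (tgt h) ∸ 1
      P≢ : ∀ h → P h ≢ 0 → p ≤ h × src h ≡ Q i
      P≢ h ne with p ≤ᵇ h in e
      ... | true = ≤ᵇ⇒≤ p h (subst T (sym e) tt) , δ≢0 (λ z → ne (cong (_+ 0) z))
      ... | false = ⊥-elim (ne refl)
      at : ∀ h → h < H → P h ≢ 0 → ∃[ j ] (j < s × pos h ≡ j × Q j ≡ tgt h)
      at h l ne with P≢ h ne
      ... | a , b with procᵢ h l b a
      ...   | j , j<s , qj , _ = j , j<s , cong (_∸ 1) (trans (cong vis (sym qj)) (visQ j j<s)) , qj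
      pos< : ∀ h → h < H → P h ≢ 0 → pos h < s
      pos< h l ne with at h l ne
      ... | j , j<s , e , _ = subst (_< s) (sym e) j<s
      inj : ∀ h h′ → h < H → h′ < H → P h ≢ 0 → P h′ ≢ 0 → pos h ≡ pos h′ → h ≡ h′
      inj h h′ l l′ ne ne′ e with at h l ne | at h′ l′ ne′
      ... | j , _ , e₁ , q₁ | j′ , _ , e₂ , q₂ = Simple.simple gs h h′ l l′ (trans (proj₂ (P≢ h ne)) (sym (proj₂ (P≢ h′ ne′))))
            (trans (sym q₁) (trans (cong Q (trans (sym e₁) (trans e e₂))) q₂))
      split : deg (Q i) ≤ sum P H + cnt (Q i) p
      split = go H p≤H
        where
        go : ∀ K → p ≤ K → cnt (Q i) K ≤ sum P K + cnt (Q i) p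
        go K p≤K with p ≟ K
        ... | yes refl = m≤n+m _ (sum P p)
        go zero z≤n | no ne = ⊥-elim (ne refl)
        go (suc K) p≤K | no ne = ≤-trans (+-mono-≤ (≤-reflexive step′) (go K p≤K′)) (≤-reflexive (sym (+-assoc (P K) (sum P K) _)))
          where
          p≤K′ : p ≤ K
          p≤K′ = s≤s⁻¹ (≤∧≢⇒< p≤K ne)
          step′ : δ (src K) (Q i) ≡ P K
          step′ with p ≤ᵇ K in e
          ... | true = sym (+-identityʳ _)
          ... | false = ⊥-elim (subst T e (≤⇒≤ᵇ p≤K′))

-- The program

-- rP: D ^ k.  rB, rL, rS, rZ, rI: base, size limit, root, size and position of the
-- queue.  rp: link to the next arc.  rT: threshold.  rW: remaining digits of a hop
-- sequence, which rc counts in base D.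
rN rM rQ rD rP rB rL rS rZ rI rp ru rd′ rx rv rj rc rs rt re rT rX rW : Fin NR
rN = # 0
rM = # 1
rQ = # 2
rD = # 3
rP = # 4
rB = # 5
rL = # 6
rS = # 7
rZ = # 8
rI = # 9
rp = # 10
ru = # 11
rd′ = # 12
rx = # 13
rv = # 14
rj = # 15
rc = # 16
rs = # 17
rt = # 18
re = # 19
rT = # 20
rX = # 21
rW = # 23

-- HD, NX, TG: heads, links and targets of the adjacency lists.
-- QU, QD: queues and distances; row v (from v * D on) is the list stored at v, and
-- the searches from picks use the cells from n * D on.
-- VI: one more than the position in the queue, 0 for unvisited vertices.
-- CN, RA: length of the list stored at v, and its radius if truncated.
-- UN, CO: 1 if the list of v is still to be hit; number of such lists through x.
-- ES, AA: distance estimates plus 1, with 0 for ∞.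
HD NX TG QU QD VI CN RA UN CO ES AA : Fin NA
HD = # 0
NX = # 1
TG = # 2
QU = # 3
QD = # 4
VI = # 5
CN = # 6
RA = # 7
UN = # 8
CO = # 9
ES = # 10
AA = # 11

-- The inner loop tests the size limit as well: scanning all arcs of a vertex of large degree would
-- break the bound `D * D` on a truncated search.
bfs-init bfs-head bfs-next bfs-push bfs-scan bfs-inner bfs-body bfs : Command
bfs-init = QU ⟨ $ rB ⟩:= $ rS ▸ QD ⟨ $ rB ⟩:= ` 0 ▸ VI ⟨ $ rS ⟩:= ` 1 ▸ rZ := ` 1 ▸ rI := ` 0
bfs-head = ru := QU ⟨ $ rB ⊕ $ rI ⟩ ▸ rd′ := QD ⟨ $ rB ⊕ $ rI ⟩ ⊕ ` 1 ▸ rp := HD ⟨ $ ru ⟩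
bfs-next = rx := TG ⟨ $ rp ⊖ ` 1 ⟩ ▸ rp := NX ⟨ $ rp ⊖ ` 1 ⟩
bfs-push = QU ⟨ $ rB ⊕ $ rZ ⟩:= $ rx ▸ QD ⟨ $ rB ⊕ $ rZ ⟩:= $ rd′ ▸ VI ⟨ $ rx ⟩:= $ rZ ⊕ ` 1 ▸ rZ := $ rZ ⊕ ` 1
bfs-scan = bfs-next ▸ iff (VI ⟨ $ rx ⟩) nop bfs-push
bfs-inner = wh ((` 0 ≺ $ rp) ⊗ ($ rZ ≺ $ rL)) bfs-scan
bfs-body = bfs-head ▸ bfs-inner ▸ rI := $ rI ⊕ ` 1
bfs = bfs-init ▸ wh (($ rI ≺ $ rZ) ⊗ ($ rZ ≺ $ rL)) bfs-body

setf-at : ∀ f {i j v} → i ≡ j → setf f i v j ≡ v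
setf-at f {i} {v = v} refl = setf-eq f i v

pair-bit : ∀ {a b} → bit a * bit b ≢ 0 → T a × T b
pair-bit {true} {true} _ = tt , tt
pair-bit {true} {false} h = ⊥-elim (h refl)
pair-bit {false} h = ⊥-elim (h refl)

pair-bit₀ : ∀ {a b} → bit a * bit b ≡ 0 → ¬ T a ⊎ ¬ T b
pair-bit₀ {true} {true} ()
pair-bit₀ {true} {false} h = inj₂ id
pair-bit₀ {false} h = inj₁ id

tick : ∀ a {t t′ x} K → a + t′ ≤ K → t ≤ x → a + (t + t′) ≤ K + x
tick a {t} {t′} K h l = ≤-trans (≤-reflexive (lem a t t′)) (+-mono-≤ h l)
  where
  lem : ∀ a t t′ → a + (t + t′) ≡ a + t′ + t
  lem = solve-∀

num : ∀ {a b} → {_ : T (a ≤ᵇ b)} → a ≤ b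
num {a} {b} {h} = ≤ᵇ⇒≤ a b h

-- `clear` erases only the marks of queued vertices; resetting all `n` cells of `VI` could cost far
-- more than a truncated search.
clear bump drop-all : Command
clear = for rj ($ rZ) (ru := QU ⟨ $ rB ⊕ $ rj ⟩ ▸ VI ⟨ $ ru ⟩:= ` 0)
bump = for rj ($ rD) (ru := QU ⟨ $ rB ⊕ $ rj ⟩ ▸ CO ⟨ $ ru ⟩:= CO ⟨ $ ru ⟩ ⊕ ` 1)
drop-all = for rj ($ rD) (ru := QU ⟨ $ rv ⊗ $ rD ⊕ $ rj ⟩ ▸ CO ⟨ $ ru ⟩:= CO ⟨ $ ru ⟩ ⊖ ` 1)

-- A minimum in which a stored 0 stands for ∞, hence the outer test.
relax : Fin NA → Fin NR → Command
relax a i = iff (a ⟨ $ i ⟩) (iff ($ re ≺ a ⟨ $ i ⟩) (a ⟨ $ i ⟩:= $ re) nop) (a ⟨ $ i ⟩:= $ re)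

record Relaxed (f : ℕ → ℕ) (i e : ℕ) (f′ : ℕ → ℕ) : Set where
  field
    other : ∀ j → j ≢ i → f′ j ≡ f j
    here≢ : f′ i ≢ 0
    here≤ : f′ i ≤ e
    mono≤ : f i ≢ 0 → f′ i ≤ f i
    which : f′ i ≡ f i ⊎ f′ i ≡ e

setf-cases : ∀ f i v j → (i ≡ j × setf f i v j ≡ v) ⊎ (i ≢ j × setf f i v j ≡ f j)
setf-cases f i v j with i ≟ j
... | yes refl = inj₁ (refl , setf-eq f i v)
... | no ne = inj₂ (ne , setf-ne f i v j ne)

sum-upd : ∀ f f′ n a → a < n → (∀ i → i ≢ a → f′ i ≡ f i) → sum f′ n + f a ≡ sum f n + f′ a
sum-upd f f′ (suc n) a (s≤s a≤n) h with a ≟ n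
... | yes refl rewrite sum-cong {f′} {f} a (λ i l → h i (<⇒≢ l)) = lem (f′ a) (sum f a) (f a)
  where
  lem : ∀ x y z → x + y + z ≡ z + y + x
  lem = solve-∀
... | no ne rewrite h n (λ e → ne (sym e)) = trans (+-assoc (f n) _ _) (trans (cong (f n +_) (sum-upd f f′ n a (≤∧≢⇒< a≤n ne) h)) (sym (+-assoc (f n) _ _)))

-- When the list has filled up, `rd′` still holds one more than the distance of the vertex whose
-- arcs were being scanned. This becomes the radius.
mark row table : Command
mark = UN ⟨ $ rv ⟩:= ` 1 ▸ RA ⟨ $ rv ⟩:= $ rd′ ▸ bump
row = rB := $ rv ⊗ $ rD ▸ rS := $ rv ▸ bfs ▸ CN ⟨ $ rv ⟩:= $ rZ ▸ iff ($ rZ ≺ $ rD) nop mark ▸ clear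
table = rL := $ rD ▸ for rv ($ rN) row

addB : ∀ X {x y c d} → x ≤ c * X → y ≤ d * X → x + y ≤ (c + d) * X
addB X {c = c} {d} h g = ≤-trans (+-mono-≤ h g) (≤-reflexive (sym (*-distribʳ-+ X c d)))

constB : ∀ X {c x} → x ≤ c → 1 ≤ X → x ≤ c * X
constB X {c} h l = ≤-trans h (≤-trans (≤-reflexive (sym (*-identityʳ c))) (*-monoʳ-≤ c l))

<-slot : ∀ {v i j D} → v < i → j < D → v * D + j < i * D
<-slot {v} {i} {j} {D} v<i j<D = ≤-trans (≤-reflexive (sym (+-suc (v * D) j))) (≤-trans (+-monoʳ-≤ (v * D) j<D) (≤-trans (≤-reflexive (+-comm (v * D) D)) (*-monoˡ-≤ D v<i)))

unhit hit-body hit pair-at upd-body upd pick : Command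
unhit = UN ⟨ $ rv ⟩:= ` 0 ▸ drop-all
hit-body = iff (UN ⟨ $ rv ⟩) (iff (VI ⟨ $ rv ⟩) (iff (RA ⟨ $ rv ⟩ ≺ QD ⟨ $ rB ⊕ (VI ⟨ $ rv ⟩ ⊖ ` 1) ⟩) nop unhit) nop) nop
hit = for rv ($ rN) hit-body
pair-at = rd rs (` 3 ⊕ ` 2 ⊗ $ rM ⊕ ` 2 ⊗ $ rv) ▸ rd rt (` 4 ⊕ ` 2 ⊗ $ rM ⊕ ` 2 ⊗ $ rv)
upd-body = pair-at ▸ iff (VI ⟨ $ rs ⟩) (iff (VI ⟨ $ rt ⟩)
  (re := QD ⟨ $ rB ⊕ (VI ⟨ $ rs ⟩ ⊖ ` 1) ⟩ ⊕ QD ⟨ $ rB ⊕ (VI ⟨ $ rt ⟩ ⊖ ` 1) ⟩ ⊕ ` 1 ▸ relax ES rv) nop) nop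
upd = for rv ($ rQ) upd-body
pick = rS := $ rX ▸ bfs ▸ hit ▸ upd ▸ clear

below-suc : ∀ (X : ℕ → Set) {i} → (∀ j → j < i → X j) → X i → ∀ j → j < suc i → X j
below-suc X {i} f x j (s≤s j≤i) with j ≟ i
... | yes refl = x
... | no ne = f j (≤∧≢⇒< j≤i ne)

-- No queue reaches the limit `n + 1`, so the searches from picks are never truncated.
phase hitting-loop hitting : Command
phase = for rX ($ rN) (iff (CO ⟨ $ rX ⟩ ≺ $ rT) nop pick)
hitting-loop = wh ($ rT) (phase ▸ rT := $ rT ⊘ ` 2)
hitting = rL := $ rN ⊕ ` 1 ▸ rB := $ rN ⊗ $ rD ▸ rT := $ rN ▸ hitting-loop

half : ∀ n → n / 2 ≡ ⌊ n /2⌋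
half zero = refl
half (suc zero) = refl
half (suc (suc n)) = trans (m/n≡1+[m∸n]/n {suc (suc n)} {2} (s≤s (s≤s z≤n))) (cong suc (half n))

-- Counts the rounds of `hitting-loop` from a given threshold; the loop stops at threshold 0, where
-- this differs from `lg`.
halvings : ℕ → ℕ
halvings zero = 0
halvings (suc n) = lg (suc n)

halvings-half : ∀ t → t ≢ 0 → suc (halvings (t / 2)) ≤ halvings t
halvings-half zero h = ⊥-elim (h refl)
halvings-half (suc zero) h = ≤-refl
halvings-half (suc (suc t)) h rewrite half (suc (suc t)) | ⌊log₂⌊n/2⌋⌋≡⌊log₂n⌋∸1 (suc (suc t)) =
  s≤s (≤-reflexive (lem ⌊log₂ suc (suc t) ⌋ (⌊log₂⌋-mono-≤ {2} {suc (suc t)} (s≤s (s≤s z≤n)))))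
  where
  lem : ∀ a → 1 ≤ a → suc (a ∸ 1) ≡ a
  lem (suc a) _ = refl

-- The least digit of `rW` in base `D` selects the entry. The second reduction, modulo the length of
-- the list, makes every digit valid at short lists too, so no sequence has to be skipped.
hop : Command
hop = rx := $ ru ⊗ $ rD ⊕ ($ rW ⊛ $ rD ⊛ CN ⟨ $ ru ⟩) ▸ re := $ re ⊕ QD ⟨ $ rx ⟩ ▸ ru := QU ⟨ $ rx ⟩ ▸ rW := $ rW ⊘ $ rD

walk : Fin NR → Command
walk from = ru := $ from ▸ re := ` 0 ▸ rW := $ rc ▸ for rj par hop

-- `wipe` repeats the walks of `gather` to find the cells of `AA` to be reset: clearing all `n`
-- cells for every pair could exceed the time allowed.
gather meet wipe query : Command
gather = for rc ($ rP) (walk rs ▸ re := $ re ⊕ ` 1 ▸ relax AA ru)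
meet = for rc ($ rP) (walk rt ▸ iff (AA ⟨ $ ru ⟩) (re := $ re ⊕ AA ⟨ $ ru ⟩ ▸ relax ES rv) nop)
wipe = for rc ($ rP) (walk rs ▸ AA ⟨ $ ru ⟩:= ` 0)
query = for rv ($ rQ) (pair-at ▸ gather ▸ meet ▸ wipe)

power : Term → Command
power N = rx := ` 1 ▸ for rj N (rx := $ rx ⊗ $ rD)

search-body search build-body build output : Command
search-body = power (par ⊕ ` 1) ▸ iff ($ rx ≺ $ rM) (rD := $ rD ⊕ ` 1) nop
search = rD := ` 2 ▸ for rv ($ rN) search-body
build-body = rd ru ($ rs ⊕ ` 2 ⊗ $ rv) ▸ rd rx ($ rt ⊕ ` 2 ⊗ $ rv) ▸
  (rI := $ rS ⊕ $ rv ▸ NX ⟨ $ rI ⟩:= HD ⟨ $ ru ⟩ ▸ TG ⟨ $ rI ⟩:= $ rx ▸ HD ⟨ $ ru ⟩:= $ rI ⊕ ` 1)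
build = for rv ($ rM) build-body
output = for rv ($ rQ) (wr ($ rv) (ES ⟨ $ rv ⟩))

-- Lets a path of length `d` be divided at a middle vertex into two halves of at most `k` pieces,
-- each piece no longer than the ceiling.
⌈÷⌉-spec : ∀ d k → 1 ≤ k → d ≤ k * ⌈ d ÷ 2 * k ⌉ + k * ⌈ d ÷ 2 * k ⌉
⌈÷⌉-spec d (suc k) _ = ≤-trans cover (≤-reflexive (lem ⌈ d ÷ suc y ⌉ (suc k)))
  where
  y = k + suc (k + 0)
  lem : ∀ L k → L * (2 * k) ≡ k * L + k * L
  lem = solve-∀
  cover : d ≤ (d + y) / suc y * suc y
  cover = +-cancelʳ-≤ y d _ (≤-trans (≤-reflexive (m≡m%n+[m/n]*n (d + y) (suc y))) (≤-trans (+-monoˡ-≤ ((d + y) / suc y * suc y) (s≤s⁻¹ (m%n<n (d + y) (suc y)))) (≤-reflexive (+-comm y _))))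

prep main : Command
prep = power par ▸ rP := $ rx ▸ rs := ` 3 ▸ rt := ` 4 ▸ rS := ` 0 ▸ build ▸ rs := ` 4 ▸ rt := ` 3 ▸ rS := $ rM ▸ build
main = rd rN (` 0) ▸ rd rM (` 1) ▸ rd rQ (` 2) ▸ search ▸ prep ▸ table ▸ hitting ▸ query ▸ output

^-distribʳ-* : ∀ o a b → (a * b) ^ o ≡ a ^ o * b ^ o
^-distribʳ-* zero a b = refl
^-distribʳ-* (suc o) a b = trans (cong (a * b *_) (^-distribʳ-* o a b)) (lem a b (a ^ o) (b ^ o))
  where
  lem : ∀ a b c d → a * b * (c * d) ≡ a * c * (b * d)
  lem = solve-∀

halvings≤ : ∀ n → halvings n ≤ lg n
halvings≤ zero = z≤n
halvings≤ (suc n) = ≤-refl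

-- The time budget

queryK fixedK : ℕ → ℕ → ℕ
queryK k a = (54 + 3 * (100 * suc k + 308)) * a
fixedK k a = (60 + 2000 * (8 + 4 * a)) + 400

-- Opaque, lest conversion checking expand these constants in unary.
abstract
  costK : ℕ → ℕ → ℕ
  costK k a = 200 * (k + 2) + ((38 * k + 100) + (1200 + (3000 + ((20 + fixedK k a) + ((queryK k a + 8) + (200 + 200 * a))))))

  costK-def : ∀ k a → costK k a ≡ 200 * (k + 2) + ((38 * k + 100) + (1200 + (3000 + ((20 + fixedK k a) + ((queryK k a + 8) + (200 + 200 * a))))))
  costK-def k a = refl

sum-bound : ∀ Z {t₁ t₂ t₃ t₄ t₅ t₆ c₁ c₂ c₃ c₄ c₅ c₆} → t₁ ≤ c₁ * Z → t₂ ≤ c₂ * Z → t₃ ≤ c₃ * Z → t₄ ≤ c₄ * Z → t₅ ≤ c₅ * Z → t₆ ≤ c₆ * Z →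
  t₁ + (t₂ + (t₃ + (t₄ + (t₅ + t₆)))) ≤ (c₁ + (c₂ + (c₃ + (c₄ + (c₅ + c₆))))) * Z
sum-bound Z {c₁ = c₁} {c₂} {c₃} {c₄} {c₅} {c₆} h₁ h₂ h₃ h₄ h₅ h₆ = addB Z {c = c₁} {c₂ + (c₃ + (c₄ + (c₅ + c₆)))} h₁
  (addB Z {c = c₂} {c₃ + (c₄ + (c₅ + c₆))} h₂ (addB Z {c = c₃} {c₄ + (c₅ + c₆)} h₃ (addB Z {c = c₄} {c₅ + c₆} h₄ (addB Z {c = c₅} {c₆} h₅ h₆))))

module Budget (k n m q a D : ℕ) (k≥2 : 2 ≤ k) (D≥2 : 2 ≤ D) (D≤ : D ≤ 2 + n) (big : m ≤ D ^ suc k) (q≤ : q ≤ a * n) where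

  -- `suc n` in place of `n` keeps `G` positive, so that it absorbs constants. `Z` adds the
  -- logarithm for the thresholds, and `Y` bounds the picks of one threshold times the size of the
  -- instance.
  PW G Z Y : ℕ
  PW = D ^ k
  G = suc n * PW
  Z = lg n * G
  Y = (8 + 4 * a) * G

  D≥1 : 1 ≤ D
  D≥1 = ≤-trans (n≤1+n 1) D≥2

  PW≥1 : 1 ≤ PW
  PW≥1 = m^n>0 D {{>-nonZero D≥1}} k

  -- Here `k ≥ 2` enters: a truncated search takes a multiple of `D * D` steps.
  DD≤PW : D * D ≤ PW
  DD≤PW = ≤-trans (≤-reflexive (cong (D *_) (sym (*-identityʳ D)))) (^-monoʳ-≤ D {{>-nonZero D≥1}} k≥2)

  D≤PW : D ≤ PW
  D≤PW = ≤-trans (≤-trans (≤-reflexive (sym (*-identityʳ D))) (*-monoʳ-≤ D D≥1)) DD≤PW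

  sn≤G : suc n ≤ G
  sn≤G = ≤-trans (≤-reflexive (sym (*-identityʳ (suc n)))) (*-monoʳ-≤ (suc n) PW≥1)

  G≥1 : 1 ≤ G
  G≥1 = ≤-trans (s≤s z≤n) sn≤G

  G≤Z : G ≤ Z
  G≤Z = m≤n*m G (lg n)

  nPW≤G : n * PW ≤ G
  nPW≤G = *-monoˡ-≤ PW (n≤1+n n)

  -- Pays for the adjacency lists: since `D ≤ 2 + n`, one factor of `D ^ suc k` can be traded for
  -- `2 * suc n`.
  m≤2G : m ≤ 2 * G
  m≤2G = ≤-trans big (≤-trans (*-monoˡ-≤ PW (≤-trans D≤ (≤-trans (m≤m+n (2 + n) n) (≤-reflexive (lem n))))) (≤-reflexive (*-assoc 2 (suc n) PW)))
    where
    lem : ∀ n → 2 + n + n ≡ 2 * suc n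
    lem = solve-∀

  qPW≤ : q * PW ≤ a * G
  qPW≤ = ≤-trans (*-monoˡ-≤ PW q≤) (≤-trans (≤-reflexive (*-assoc a n PW)) (*-monoʳ-≤ a nPW≤G))

  q≤aG : q ≤ a * G
  q≤aG = ≤-trans (≤-trans (≤-reflexive (sym (*-identityʳ q))) (*-monoʳ-≤ q PW≥1)) qPW≤

  -- From `p * D ≤ 4 m` follows `p ≤ 4 * PW`, which pays for the terms with `n` and `q`. The arcs
  -- are paid for by `p * D ≤ 2 n`, as `m` contains at most one more factor `D` than `PW`.
  picks≤ : ∀ p → p * D ≤ 2 * n → p * D ≤ 2 * (m + m) → p * (1 + n + (m + m) + q) ≤ Y
  picks≤ p h₁ h₂ = ≤-trans (≤-reflexive (lem₁ p n (m + m) q)) (≤-trans (+-mono-≤ (+-mono-≤ a₁ a₂) a₃) (≤-reflexive (lem₂ a G)))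
    where
    lem₁ : ∀ p n H q → p * (1 + n + H + q) ≡ p * suc n + p * H + p * q
    lem₁ = solve-∀
    lem₂ : ∀ a G → 4 * G + 4 * G + 4 * (a * G) ≡ (8 + 4 * a) * G
    lem₂ = solve-∀
    p≤ : p ≤ 4 * PW
    p≤ = *-cancelʳ-≤ p (4 * PW) D {{>-nonZero D≥1}} (≤-trans h₂ (≤-trans (*-monoʳ-≤ 2 (+-mono-≤ big big)) (≤-reflexive (lem D PW))))
      where
      lem : ∀ D P → 2 * (D * P + D * P) ≡ 4 * P * D
      lem = solve-∀
    a₁ : p * suc n ≤ 4 * G
    a₁ = ≤-trans (*-monoˡ-≤ (suc n) p≤) (≤-reflexive (trans (*-assoc 4 PW (suc n)) (cong (4 *_) (*-comm PW (suc n)))))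
    a₂ : p * (m + m) ≤ 4 * G
    a₂ = ≤-trans (*-monoʳ-≤ p (+-mono-≤ big big)) (≤-trans (≤-reflexive (lem p D PW)) (≤-trans (*-monoˡ-≤ (2 * PW) h₁) (≤-trans (≤-reflexive (lem′ n PW)) (*-monoʳ-≤ 4 nPW≤G))))
      where
      lem : ∀ p D P → p * (D * P + D * P) ≡ p * D * (2 * P)
      lem = solve-∀
      lem′ : ∀ n P → 2 * n * (2 * P) ≡ 4 * (n * P)
      lem′ = solve-∀
    a₃ : p * q ≤ 4 * (a * G)
    a₃ = ≤-trans (*-monoˡ-≤ q p≤) (≤-trans (≤-reflexive (trans (*-assoc 4 PW q) (cong (4 *_) (*-comm PW q)))) (*-monoʳ-≤ 4 qPW≤))

  -- In order: the search for `D`, the power `D ^ k`, the adjacency lists, the stored lists, the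
  -- hitting set, and the queries with the output.
  T₁ T₂ T₃ T₄ T₅ T₆ : ℕ
  T₁ = 200 * (k + 2) * suc n
  T₂ = k * 38 + 100
  T₃ = 400 * suc m
  T₄ = 3000 * (suc n * (D * D))
  T₅ = 20 + (halvings n * (60 * suc n + 2000 * Y) + (200 * suc D) * n)
  T₆ = q * (22 + 3 * (PW * (100 * suc k + 300 + 8) + 8) + 8) + 8 + 200 * suc q

  total : T₁ + (T₂ + (T₃ + (T₄ + (T₅ + T₆)))) ≤ costK k a * Z
  total = subst (λ c → T₁ + (T₂ + (T₃ + (T₄ + (T₅ + T₆)))) ≤ c * Z) (sym (costK-def k a)) $ sum-bound Z {T₁} {T₂} {T₃} {T₄} {T₅} {T₆} {200 * (k + 2)} {38 * k + 100} {1200} {3000} {20 + fixedK k a} {(queryK k a + 8) + (200 + 200 * a)}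
      (*-monoʳ-≤ (200 * (k + 2)) sn≤Z) (constB Z (≤-reflexive (cong (_+ 100) (*-comm k 38))) Z≥1) b₁ (*-monoʳ-≤ 3000 (≤-trans (*-monoʳ-≤ (suc n) DD≤PW) G≤Z))
      (addB Z {20} {_} {20} {fixedK k a} (constB Z {20} ≤-refl Z≥1) (addB Z {halvings n * (60 * suc n + 2000 * Y)} {(200 * suc D) * n} {60 + 2000 * (8 + 4 * a)} {400} b₂ b₃))
      (addB Z {q * (22 + 3 * (PW * (100 * suc k + 300 + 8) + 8) + 8) + 8} {200 * suc q} {queryK k a + 8} {200 + 200 * a}
        (addB Z {q * (22 + 3 * (PW * (100 * suc k + 300 + 8) + 8) + 8)} {8} {queryK k a} {8} b₄ (constB Z {8} ≤-refl Z≥1)) b₅)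
    where
    cQ : ℕ
    cQ = 54 + 3 * (100 * suc k + 308)
    sn≤Z : suc n ≤ Z
    sn≤Z = ≤-trans sn≤G G≤Z
    Z≥1 : 1 ≤ Z
    Z≥1 = ≤-trans G≥1 G≤Z
    b₁ : 400 * suc m ≤ 1200 * Z
    b₁ = ≤-trans (*-monoʳ-≤ 400 (≤-trans (+-mono-≤ G≥1 m≤2G) (*-monoʳ-≤ 3 G≤Z))) (≤-reflexive (sym (*-assoc 400 3 Z)))
    b₂ : halvings n * (60 * suc n + 2000 * Y) ≤ (60 + 2000 * (8 + 4 * a)) * Z
    b₂ = ≤-trans (*-mono-≤ (halvings≤ n) (addB G {60 * suc n} {2000 * Y} {60} {2000 * (8 + 4 * a)} (*-monoʳ-≤ 60 sn≤G) (≤-reflexive (sym (*-assoc 2000 (8 + 4 * a) G))))) (≤-reflexive (lem (lg n) (60 + 2000 * (8 + 4 * a)) G))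
      where
      lem : ∀ l c G → l * (c * G) ≡ c * (l * G)
      lem = solve-∀
    b₃ : (200 * suc D) * n ≤ 400 * Z
    b₃ = ≤-trans (≤-reflexive (*-assoc 200 (suc D) n)) (≤-trans (*-monoʳ-≤ 200 (≤-trans (*-monoˡ-≤ n (≤-trans (+-monoˡ-≤ D D≥1) (≤-reflexive (lem₀ D)))) (≤-trans (≤-reflexive (*-assoc 2 D n)) (*-monoʳ-≤ 2
        (≤-trans (≤-trans (*-monoˡ-≤ n D≤PW) (≤-reflexive (*-comm PW n))) (≤-trans nPW≤G G≤Z)))))) (≤-reflexive (sym (*-assoc 200 2 Z))))
      where
      lem₀ : ∀ D → D + D ≡ 2 * D
      lem₀ = solve-∀
    b₄ : q * (22 + 3 * (PW * (100 * suc k + 300 + 8) + 8) + 8) ≤ (cQ * a) * Z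
    b₄ = ≤-trans (*-monoʳ-≤ q inner) (≤-trans (≤-reflexive (lem₁ q cQ PW)) (≤-trans (*-monoʳ-≤ cQ (≤-trans qPW≤ (*-monoʳ-≤ a G≤Z))) (≤-reflexive (sym (*-assoc cQ a Z)))))
      where
      lem₁ : ∀ q c P → q * (c * P) ≡ c * (q * P)
      lem₁ = solve-∀
      lem₂ : ∀ P c → 22 + 3 * (P * c + 8) + 8 ≡ 54 + 3 * c * P
      lem₂ = solve-∀
      inner : 22 + 3 * (PW * (100 * suc k + 300 + 8) + 8) + 8 ≤ cQ * PW
      inner = ≤-trans (≤-reflexive (trans (lem₂ PW (100 * suc k + 300 + 8)) (cong (λ z → 54 + 3 * z * PW) {100 * suc k + 300 + 8} {100 * suc k + 308} (+-assoc (100 * suc k) 300 8))))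
        (addB PW {54} {3 * (100 * suc k + 308) * PW} {54} {3 * (100 * suc k + 308)} (constB PW {54} ≤-refl PW≥1) ≤-refl)
    b₅ : 200 * suc q ≤ (200 + 200 * a) * Z
    b₅ = ≤-trans (≤-reflexive (*-suc 200 q)) (addB Z {200} {200 * q} {200} {200 * a} (constB Z {200} ≤-refl Z≥1) (≤-trans (*-monoʳ-≤ 200 (≤-trans q≤aG (*-monoʳ-≤ a G≤Z))) (≤-reflexive (sym (*-assoc 200 a Z)))))

-- Input and graphs

-- The theorem speaks of every final state, whereas the construction provides one; determinism
-- identifies them.
det : ∀ {w r} {P : Prog r} {σ τ υ : State w r} {s t} → P , σ ⇓[ s ] τ → P , σ ⇓[ t ] υ → τ ≡ υ
det ⇓-skip ⇓-skip = refl
det ⇓-≔ ⇓-≔ = refl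
det ⇓-store ⇓-store = refl
det ⇓-flip ⇓-flip = refl
det (⇓-⨾ p q) (⇓-⨾ p′ q′) with refl ← det p p′ = det q q′
det (⇓-cond-true _ p) (⇓-cond-true _ q) = det p q
det (⇓-cond-true n _) (⇓-cond-false z _) = contradiction z n
det (⇓-cond-false z _) (⇓-cond-true n _) = contradiction z n
det (⇓-cond-false _ p) (⇓-cond-false _ q) = det p q
det (⇓-while-true _ p q) (⇓-while-true _ p′ q′) with refl ← det p p′ = det q q′
det (⇓-while-true n _ _) (⇓-while-false z) = contradiction z n
det (⇓-while-false z) (⇓-while-true n _ _) = contradiction z n
det (⇓-while-false _) (⇓-while-false _) = refl

nth : List ℕ → ℕ → ℕ
nth xs i = fromMaybe 0 (head (drop i xs))

nth-[] : ∀ i → nth [] i ≡ 0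
nth-[] zero = refl
nth-[] (suc i) = refl

codes : ∀ {n l} → Vec (Fin n × Fin n) l → List ℕ
codes v = concatMap pairCode (toList v)

module _ {n : ℕ} where
  nth-code₁ : ∀ {l} (v : Vec (Fin n × Fin n) l) ys i → nth (codes v ++ ys) (2 * toℕ i) ≡ toℕ (proj₁ (lookup v i))
  nth-code₁ (x Vec.∷ v) ys zero = refl
  nth-code₁ (x Vec.∷ v) ys (suc i) = trans (cong (nth (codes (x Vec.∷ v) ++ ys)) (*-suc 2 (toℕ i))) (nth-code₁ v ys i)

  nth-code₂ : ∀ {l} (v : Vec (Fin n × Fin n) l) ys i → nth (codes v ++ ys) (suc (2 * toℕ i)) ≡ toℕ (proj₂ (lookup v i))
  nth-code₂ (x Vec.∷ v) ys zero = refl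
  nth-code₂ (x Vec.∷ v) ys (suc i) = trans (cong (nth (codes (x Vec.∷ v) ++ ys) ∘ suc) (*-suc 2 (toℕ i))) (nth-code₂ v ys i)

  nth-skip : ∀ {l} (v : Vec (Fin n × Fin n) l) ys j → nth (codes v ++ ys) (2 * l + j) ≡ nth ys j
  nth-skip Vec.[] ys j = refl
  nth-skip {suc l} (x Vec.∷ v) ys j = trans (cong (λ z → nth (codes (x Vec.∷ v) ++ ys) (z + j)) (*-suc 2 l)) (nth-skip v ys j)

  nth-code≤ : ∀ {l V} (v : Vec (Fin n × Fin n) l) ys → n ≤ V → (∀ i → nth ys i ≤ V) → ∀ i → nth (codes v ++ ys) i ≤ V
  nth-code≤ Vec.[] ys n≤ h i = h i
  nth-code≤ (x Vec.∷ v) ys n≤ h zero = ≤-trans (<⇒≤ (toℕ<n (proj₁ x))) n≤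
  nth-code≤ (x Vec.∷ v) ys n≤ h (suc zero) = ≤-trans (<⇒≤ (toℕ<n (proj₂ x))) n≤
  nth-code≤ (x Vec.∷ v) ys n≤ h (suc (suc i)) = nth-code≤ v ys n≤ h i

extend : ∀ {l} → (Fin l → ℕ) → ℕ → ℕ
extend {l} f h with h <? l
... | yes p = f (fromℕ< p)
... | no _  = 0

extend-at : ∀ {l} (f : Fin l → ℕ) i → extend f (toℕ i) ≡ f i
extend-at {l} f i with toℕ i <? l
... | yes p = cong f (fromℕ<-toℕ i p)
... | no np = ⊥-elim (np (toℕ<n i))

index : ∀ {l h} → h < l → ∃[ i ] (toℕ {l} i ≡ h)
index p = fromℕ< p , toℕ-fromℕ< p

module Arcs {n m : ℕ} (G : Graph n m) where

  arc : Fin (m + m) → Fin n × Fin n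
  arc h = [ lookup (edges G) , swap ∘ lookup (edges G) ]′ (splitAt m h)

  arc-fwd : ∀ e → arc (e ↑ˡ m) ≡ lookup (edges G) e
  arc-fwd e = cong [ lookup (edges G) , swap ∘ lookup (edges G) ]′ (splitAt-↑ˡ m e m)

  arc-bwd : ∀ e → arc (m ↑ʳ e) ≡ swap (lookup (edges G) e)
  arc-bwd e = cong [ lookup (edges G) , swap ∘ lookup (edges G) ]′ (splitAt-↑ʳ m m e)

  data View : Fin (m + m) → Set where
    fwd : ∀ e → View (e ↑ˡ m)
    bwd : ∀ e → View (m ↑ʳ e)

  view : ∀ h → View h
  view h with splitAt m h in eqq
  ... | inj₁ e = subst View (trans (cong (join m m) (sym eqq)) (join-splitAt m m h)) (fwd e)
  ... | inj₂ e = subst View (trans (cong (join m m) (sym eqq)) (join-splitAt m m h)) (bwd e)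

  -- `distinct` first forces `e` and `f` to coincide; an edge equal to its own reversal would be a
  -- loop.
  no-loop : ∀ e f → lookup (edges G) e ≢ swap (lookup (edges G) f)
  no-loop e f p with distinct G e f (inj₂ p)
  ... | refl = loopless G e (cong proj₁ p)

  arc-inj : ∀ h h′ → arc h ≡ arc h′ → h ≡ h′
  arc-inj h h′ p with view h | view h′
  ... | fwd e | fwd f = cong (_↑ˡ m) (distinct G e f (inj₁ (trans (sym (arc-fwd e)) (trans p (arc-fwd f)))))
  ... | fwd e | bwd f = ⊥-elim (no-loop e f (trans (sym (arc-fwd e)) (trans p (arc-bwd f))))
  ... | bwd e | fwd f = ⊥-elim (no-loop f e (trans (sym (arc-fwd f)) (trans (sym p) (arc-bwd e))))
  ... | bwd e | bwd f = cong (m ↑ʳ_) (distinct G e f (inj₁ (cong swap (trans (sym (arc-bwd e)) (trans p (arc-bwd f))))))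

  arc-symm : ∀ h → ∃[ h′ ] (arc h′ ≡ swap (arc h))
  arc-symm h with view h
  ... | fwd e = m ↑ʳ e , trans (arc-bwd e) (cong swap (sym (arc-fwd e)))
  ... | bwd e = e ↑ˡ m , trans (arc-fwd e) (cong swap (sym (arc-bwd e)))

  arc-adj : ∀ h → Adj G (proj₁ (arc h)) (proj₂ (arc h))
  arc-adj h with view h
  ... | fwd e = e , inj₁ (sym (arc-fwd e))
  ... | bwd e = e , inj₂ (sym (cong swap (arc-bwd e)))

  adj-arc : ∀ {u v} → Adj G u v → ∃[ h ] (arc h ≡ (u , v))
  adj-arc (e , inj₁ p) = e ↑ˡ m , trans (arc-fwd e) p
  adj-arc (e , inj₂ p) = m ↑ʳ e , trans (arc-bwd e) (cong swap p)

  edges≤ : m ≤ n * n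
  edges≤ = injective⇒≤ {f = λ e → combine (proj₁ (lookup (edges G) e)) (proj₂ (lookup (edges G) e))}
    λ {e} {f} p → let a , b = combine-injective _ _ _ _ p in distinct G e f (inj₁ (cong₂ _,_ a b))

  src tgt : ℕ → ℕ
  src = extend (toℕ ∘ proj₁ ∘ arc)
  tgt = extend (toℕ ∘ proj₂ ∘ arc)

  src-at : ∀ h → src (toℕ h) ≡ toℕ (proj₁ (arc h))
  src-at = extend-at (toℕ ∘ proj₁ ∘ arc)

  tgt-at : ∀ h → tgt (toℕ h) ≡ toℕ (proj₂ (arc h))
  tgt-at = extend-at (toℕ ∘ proj₂ ∘ arc)

  open Graphs n (m + m) src tgt using (Simple; Wk; nil; snoc; wk-++)

  simple : Simple
  simple = record
    { tgt< = λ h l → case index l of λ { (i , refl) → subst (_< n) (sym (tgt-at i)) (toℕ<n (proj₂ (arc i))) }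
    ; simple = λ h h′ l l′ → inj (index l) (index l′)
    ; symm = λ h l → rev (index l) }
    where
    inj : ∀ {h h′} → ∃[ i ] (toℕ {m + m} i ≡ h) → ∃[ j ] (toℕ {m + m} j ≡ h′) → src h ≡ src h′ → tgt h ≡ tgt h′ → h ≡ h′
    inj (i , refl) (j , refl) p q = cong toℕ (arc-inj i j (cong₂ _,_ (toℕ-injective (trans (sym (src-at i)) (trans p (src-at j))))
      (toℕ-injective (trans (sym (tgt-at i)) (trans q (tgt-at j))))))
    rev : ∀ {h} → ∃[ i ] (toℕ {m + m} i ≡ h) → ∃[ h′ ] (h′ < m + m × src h′ ≡ tgt h × tgt h′ ≡ src h)
    rev (i , refl) with arc-symm i
    ... | j , e = toℕ j , toℕ<n j , trans (src-at j) (trans (cong (toℕ ∘ proj₁) e) (sym (tgt-at i))) , trans (tgt-at j) (trans (cong (toℕ ∘ proj₂) e) (sym (src-at i)))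

  srcᵐ : ∀ e → e < m → src (m + e) ≡ tgt e
  srcᵐ e l with index l
  ... | i , refl = trans (cong src (sym (toℕ-↑ʳ m i))) (trans (src-at (m ↑ʳ i)) (trans (cong toℕ (trans (cong proj₁ (arc-bwd i)) (cong proj₂ (sym (arc-fwd i)))))
      (trans (sym (tgt-at (i ↑ˡ m))) (cong tgt (toℕ-↑ˡ i m)))))

  tgtᵐ : ∀ e → e < m → tgt (m + e) ≡ src e
  tgtᵐ e l with index l
  ... | i , refl = trans (cong tgt (sym (toℕ-↑ʳ m i))) (trans (tgt-at (m ↑ʳ i)) (trans (cong toℕ (trans (cong proj₂ (arc-bwd i)) (cong proj₁ (sym (arc-fwd i)))))
      (trans (sym (src-at (i ↑ˡ m))) (cong src (toℕ-↑ˡ i m)))))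

  src-edge : ∀ e → src (toℕ e) ≡ toℕ (proj₁ (lookup (edges G) e))
  src-edge e = trans (cong src (sym (toℕ-↑ˡ e m))) (trans (src-at (e ↑ˡ m)) (cong (toℕ ∘ proj₁) (arc-fwd e)))

  tgt-edge : ∀ e → tgt (toℕ e) ≡ toℕ (proj₂ (lookup (edges G) e))
  tgt-edge e = trans (cong tgt (sym (toℕ-↑ˡ e m))) (trans (tgt-at (e ↑ˡ m)) (cong (toℕ ∘ proj₂) (arc-fwd e)))

  to-wk : ∀ {u v ℓ} → Walk G u v ℓ → Wk (toℕ u) (toℕ v) ℓ
  to-wk here = nil
  to-wk (step a p) with adj-arc a
  ... | h , e = wk-++ (subst (λ z → Wk _ z 1) (trans (tgt-at h) (cong (toℕ ∘ proj₂) e))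
      (snoc (toℕ h) nil (toℕ<n h) (trans (src-at h) (cong (toℕ ∘ proj₁) e)))) (to-wk p)

  walk-snoc : ∀ {u v x ℓ} → Walk G u v ℓ → Adj G v x → Walk G u x (suc ℓ)
  walk-snoc here a = step a here
  walk-snoc (step b p) a = step b (walk-snoc p a)

  of-wk : ∀ {u x ℓ} → Wk (toℕ u) x ℓ → ∃[ v ] (toℕ v ≡ x × Walk G u v ℓ)
  of-wk nil = _ , refl , here
  of-wk (snoc h p l e) with index l | of-wk p
  ... | i , refl | v , ev , r = proj₂ (arc i) , sym (tgt-at i) ,
      walk-snoc r (subst (λ z → Adj G z (proj₂ (arc i))) (toℕ-injective (trans (sym (src-at i)) (trans e (sym ev)))) (arc-adj i))

  from-wk : ∀ {u v ℓ} → Wk (toℕ u) (toℕ v) ℓ → Walk G u v ℓ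
  from-wk p with of-wk p
  ... | v , e , r = subst (λ z → Walk G _ z _) (toℕ-injective e) r

  adj? : ∀ u v → Dec (Adj G u v)
  adj? u v = any? λ e → ≡-dec _≟F_ _≟F_ (lookup (edges G) e) (u , v) ⊎-dec ≡-dec _≟F_ _≟F_ (lookup (edges G) e) (v , u)

  walk? : ∀ u v ℓ → Dec (Walk G u v ℓ)
  walk? u v zero = map′ (λ { refl → here }) (λ { here → refl }) (u ≟F v)
  walk? u v (suc ℓ) = map′ (λ { (x , a , p) → step a p }) (λ { (step a p) → _ , a , p }) (any? λ x → adj? u x ×-dec walk? x v ℓ)

  -- A minimum has to be found constructively: walks of a given length are decidable, so the lengths
  -- from 0 up to the known `ℓ` are tried.
  shortest : ∀ {u v} ℓ → Walk G u v ℓ → ∃[ d ] (Distance G u v [ d ] × d ≤ ℓ)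
  shortest {u} {v} ℓ p = go 0 ℓ refl (λ _ ())
    where
    go : ∀ i j → i + j ≡ ℓ → (∀ x → x < i → ¬ Walk G u v x) → ∃[ d ] (Distance G u v [ d ] × d ≤ ℓ)
    go i zero e none = i , (subst (Walk G u v) (sym (trans (sym (+-identityʳ i)) e)) p , λ x q → ≮⇒≥ (λ l → none x l q)) , ≤-reflexive (trans (sym (+-identityʳ i)) e)
    go i (suc j) e none with walk? u v i
    ... | yes q = i , (q , λ x r → ≮⇒≥ (λ l → none x l r)) , ≤-trans (m≤m+n i (suc j)) (≤-reflexive e)
    ... | no nq = go (suc i) j (trans (sym (+-suc i j)) e) λ x l q → case x ≟ i of λ { (yes refl) → nq q ; (no ne) → none x (≤∧≢⇒< (s≤s⁻¹ l) ne) q }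

-- Correctness and running time of the program

-- `V` bounds everything stored and `V ^ 16` everything computed. By `room` each index up to
-- `V ^ 16` has an address below `2 ^ w`, so array accesses need no separate check of their indices.
record Mach : Set where
  field
    k w β V : ℕ
    V≥   : 9 ≤ V
    k≤V  : k ≤ V
    room : β + (NA + NA * V ^ 16) ≤ 2 ^ w

-- Simulation of the language by the word RAM

module OnMachine (Mc : Mach) where
  open Mach Mc

  V≥2 : 2 ≤ V
  V≥2 = ≤-trans (s≤s (s≤s z≤n)) V≥

  ⟪_⟫ : Term → Store → ℕ
  ⟪ e ⟫ σ = evalE k e σ

  adr : Fin NA → ℕ → ℕ
  adr a i = β + (toℕ a + NA * i)

  record Bd (σ : Store) : Set where
    field
      bR : ∀ x → rg σ x ≤ V
      bA : ∀ a i → ar σ a i ≤ V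
      bL : ∀ i → i < β → lw σ i ≤ V
  open Bd public

  infix 4 _~_
  record _~_ (c : State w (suc NR)) (σ : Store) : Set where
    field
      ~β : toℕ (lookup (regs c) zero) ≡ β
      ~R : ∀ x → toℕ (lookup (regs c) (suc x)) ≡ rg σ x
      ~A : ∀ a i → adr a i < 2 ^ w → toℕ (mem c (word w (adr a i))) ≡ ar σ a i
      ~L : ∀ i → i < β → toℕ (mem c (word w i)) ≡ lw σ i
      ~B : Bd σ
  open _~_ public

  eval≤ : ∀ e {σ} → T (litsOK e) → Bd σ → ⟪ e ⟫ σ ≤ V ^ esize e
  eval≤ (` x) l B = ≤-trans (≤-trans (≤ᵇ⇒≤ x 8 l) (≤-trans (n≤1+n 8) V≥)) (≤-reflexive (sym (^-identityʳ V)))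
  eval≤ par l B = ≤-trans k≤V (≤-reflexive (sym (^-identityʳ V)))
  eval≤ ($ x) l B = ≤-trans (bR B x) (≤-reflexive (sym (^-identityʳ V)))
  eval≤ (a ⟨ e ⟩) l B = ≤-trans (bA B a _) (≤-trans (≤-reflexive (sym (^-identityʳ V)))
    (^-monoʳ-≤ V {{>-nonZero (≤-trans (s≤s z≤n) V≥2)}} (esize≥1 e)))
  eval≤ (op o e f) l B = ⟦⟧≤ o {a = esize e} {b = esize f} V≥2 (esize≥1 e) (esize≥1 f)
    (eval≤ e (proj₁ (∧-T l)) B) (eval≤ f (proj₂ (∧-T l)) B)

  V^≤ : ∀ {s} → s ≤ 16 → V ^ s ≤ V ^ 16
  V^≤ = ^-monoʳ-≤ V {{>-nonZero (≤-trans (s≤s z≤n) V≥2)}}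

  adr<′ : ∀ (a : Fin NA) {i} → i ≤ V ^ 16 → adr a i < 2 ^ w
  adr<′ a h = ≤-trans (+-monoʳ-< β (+-mono-<-≤ (toℕ<n a) (*-monoʳ-≤ NA h))) room

  V16< : V ^ 16 < 2 ^ w
  V16< = ≤-trans (s≤s (≤-trans (m≤n+m (V ^ 16) 0) (≤-trans (m≤n*m (V ^ 16) NA) (m≤n+m _ 11))))
    (≤-trans (m≤n+m _ β) room)

  small< : ∀ {x} → x ≤ V ^ 16 → x < 2 ^ w
  small< h = ≤-<-trans h V16<

  lit< : ∀ {x} → x ≤ V → x < 2 ^ w
  lit< h = small< (≤-trans h (≤-trans (≤-reflexive (sym (^-identityʳ V))) (V^≤ (s≤s z≤n))))

  w-lit : ∀ {x} → x ≤ V → toℕ (word w x) ≡ x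
  w-lit h = toℕ-word {w} (lit< h)

  A< : NA < 2 ^ w
  A< = ≤-trans (≤-trans (s≤s (m≤m*n NA (V ^ 16) {{m^n≢0 V 16 {{>-nonZero (≤-trans (s≤s z≤n) V≥2)}}}})) (m≤n+m _ 11)) (≤-trans (m≤n+m _ β) room)

  addr-sim : ∀ a {i} {c : State w (suc NR)} {e′ : Expr (suc NR)} → toℕ (lookup (regs c) zero) ≡ β → i ≤ V ^ 16 → toℕ (eval e′ c) ≡ i →
    eval (bin add (reg zero) (bin add (lit (toℕ a)) (bin mul (lit NA) e′))) c ≡ word w (adr a i)
  addr-sim a {i} {c} {e′} hβ hi he = cong (word w) (cong₂ _+_ hβ
    (trans (toℕ-word {w} bound₂) (cong₂ _+_ (toℕ-word {w} (≤-<-trans (<⇒≤ (toℕ<n a)) A<)) eqm)))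
    where
    mulB : NA * i < 2 ^ w
    mulB = ≤-trans (s≤s (*-monoʳ-≤ NA hi)) (≤-trans (m≤n+m _ 11) (≤-trans (m≤n+m _ β) room))
    eqm : toℕ (word w (toℕ (word w NA) * toℕ (eval e′ c))) ≡ NA * i
    eqm = trans (cong (λ z → toℕ (word w z)) (cong₂ _*_ (toℕ-word {w} A<) he)) (toℕ-word {w} mulB)
    bound₂ : toℕ (word w (toℕ a)) + toℕ (word w (toℕ (word w NA) * toℕ (eval e′ c))) < 2 ^ w
    bound₂ = subst (_< 2 ^ w) (sym (cong₂ _+_ (toℕ-word {w} (≤-<-trans (<⇒≤ (toℕ<n a)) A<)) eqm))
      (≤-trans (m≤n+m _ β) (subst (_≤ 2 ^ w) (sym (+-suc β _)) (adr<′ a hi)))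

  eval~′ : ∀ e {c σ} → esize e ≤ 16 → T (litsOK e) → c ~ σ → toℕ (eval (compE k e) c) ≡ ⟪ e ⟫ σ
  eval~′ (` x) s l c~σ = w-lit (≤-trans (≤ᵇ⇒≤ x 8 l) (≤-trans (n≤1+n 8) V≥))
  eval~′ par s l c~σ = w-lit k≤V
  eval~′ ($ x) s l c~σ = ~R c~σ x
  eval~′ (a ⟨ e ⟩) {c} {σ} s l c~σ = trans (cong (toℕ ∘ mem c) (addr-sim a {c = c} {e′ = compE k e} (~β c~σ) hi (eval~′ e s l c~σ)))
      (~A c~σ a (⟪ e ⟫ σ) (adr<′ a hi))
    where
    hi : ⟪ e ⟫ σ ≤ V ^ 16
    hi = ≤-trans (eval≤ e l (~B c~σ)) (V^≤ s)
  eval~′ (op o e f) {c} {σ} s l c~σ = trans (cong (λ z → toℕ (word w z)) (cong₂ ⟦ o ⟧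
      (eval~′ e (≤-trans (m≤m+n _ _) s) (proj₁ (∧-T l)) c~σ) (eval~′ f (≤-trans (m≤n+m _ _) s) (proj₂ (∧-T {litsOK e} l)) c~σ)))
      (toℕ-word {w} (small< (≤-trans (eval≤ (op o e f) l (~B c~σ)) (V^≤ s))))

  eval~ : ∀ e {c σ} → T (ok e) → c ~ σ → toℕ (eval (compE k e) c) ≡ ⟪ e ⟫ σ
  eval~ e h = eval~′ e (≤ᵇ⇒≤ _ 16 (proj₁ (∧-T h))) (proj₂ (∧-T {esize e ≤ᵇ 16} h))

  ev≤16 : ∀ e {σ} → T (ok e) → Bd σ → ⟪ e ⟫ σ ≤ V ^ 16
  ev≤16 e h B = ≤-trans (eval≤ e (proj₂ (∧-T {esize e ≤ᵇ 16} h)) B) (V^≤ {esize e} (≤ᵇ⇒≤ _ 16 (proj₁ (∧-T {esize e ≤ᵇ 16} h))))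

  tame≤ : ∀ e {σ} → T (litsOK e) → T (tame e) → Bd σ → ⟪ e ⟫ σ ≤ V
  tame≤ (` x) l t B = ≤-trans (≤ᵇ⇒≤ x 8 l) (≤-trans (n≤1+n 8) V≥)
  tame≤ par l t B = k≤V
  tame≤ ($ x) l t B = bR B x
  tame≤ (a ⟨ e ⟩) l t B = bA B a _
  tame≤ (op sub e f) {σ} l t B = ≤-trans (m∸n≤m (⟪ e ⟫ σ) (⟪ f ⟫ σ)) (tame≤ e (proj₁ (∧-T l)) t B)
  tame≤ (op div e f) {σ} l t B with ⟪ f ⟫ σ
  ... | zero = z≤n
  ... | suc z = ≤-trans (m/n≤m _ (suc z)) (tame≤ e (proj₁ (∧-T l)) t B)
  tame≤ (op mod e f) {σ} l t B with ⟪ f ⟫ σ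
  ... | zero = z≤n
  ... | suc z = ≤-trans (m%n≤m _ (suc z)) (tame≤ e (proj₁ (∧-T l)) t B)
  tame≤ (op lt e f) l t B = ≤-trans (bit≤1 _) (≤-trans (s≤s z≤n) V≥2)
  tame≤ (op eq e f) l t B = ≤-trans (bit≤1 _) (≤-trans (s≤s z≤n) V≥2)

  -- An obligation only where a sum or product might exceed `V`; for tame expressions it reduces to
  -- `⊤`.
  Fits : Term → Store → Set
  Fits e σ = if tame e then ⊤ else (⟪ e ⟫ σ ≤ V)

  fits≤ : ∀ e {σ} → T (ok e) → Fits e σ → Bd σ → ⟪ e ⟫ σ ≤ V
  fits≤ e h f B with tame e in eqq
  ... | true  = tame≤ e (proj₂ (∧-T {esize e ≤ᵇ 16} h)) (subst T (sym eqq) tt) B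
  ... | false = f

  record Does (P : Command) (σ : Store) (t : ℕ) (τ : Store) : Set where
    field
      run   : ∀ {c} → c ~ σ → ∃[ c′ ] ∃[ t′ ] (t′ ≤ t × compC k P , c ⇓[ t′ ] c′ × c′ ~ τ)
      frame : Frame P σ τ
  open Does public

  cst : Term → ℕ
  cst e = cost (compE k e)

  frame-refl : ∀ {P σ} → Frame P σ σ
  frame-refl = record { fR = λ _ → refl ; fA = λ _ → refl ; fL = refl }

  setR-frame : ∀ {P x v σ} → T (writesR P x) → Frame P σ (setR x v σ)
  setR-frame {P} {x} {v} {σ} wx = record { fR = λ y {h} → go y h ; fA = λ _ → refl ; fL = refl }
    where
    T-not : ∀ {b} → T b → T (not b) → ⊥
    T-not {true} _ ()
    go : ∀ y → T (not (writesR P y)) → rg (setR x v σ) y ≡ rg σ y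
    go y h with x == y in e
    ... | false = refl
    ... | true  = ⊥-elim (T-not wx (subst (λ z → T (not (writesR P z))) (sym (toℕ-injective (≡ᵇ⇒≡ (toℕ x) (toℕ y) (subst T (sym e) tt)))) h))

  setR~ : ∀ {c σ x v v′} → c ~ σ → toℕ v′ ≡ v → v ≤ V →
    ⟨ regs c [ suc x ]≔ v′ , mem c , coins c ⟩ ~ setR x v σ
  setR~ {c} {σ} {x} {v} {v′} c~σ e h = record
    { ~β = trans (cong toℕ (lookup∘update′ {i = zero} {j = suc x} (λ ()) (regs c) v′)) (~β c~σ)
    ; ~R = go ; ~A = ~A c~σ ; ~L = ~L c~σ
    ; ~B = record { bR = gb ; bA = bA (~B c~σ) ; bL = bL (~B c~σ) } }
    where
    go : ∀ y → toℕ (lookup (regs c [ suc x ]≔ v′) (suc y)) ≡ rg (setR x v σ) y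
    go y with x == y in eqq
    ... | true  rewrite sym (toℕ-injective {i = x} {j = y} (≡ᵇ⇒≡ (toℕ x) (toℕ y) (subst T (sym eqq) tt))) =
          trans (cong toℕ (lookup∘update (suc x) (regs c) v′)) e
    ... | false = trans (cong toℕ (lookup∘update′ {i = suc y} {j = suc x} ne (regs c) v′)) (~R c~σ y)
      where
      ne : Fin.suc y ≢ suc x
      ne refl = contradiction (trans (sym eqq) (==-refl y)) λ ()
    gb : ∀ y → rg (setR x v σ) y ≤ V
    gb y with x == y
    ... | true  = h
    ... | false = bR (~B c~σ) y

  do-:= : ∀ x e {σ} → {_ : T (ok e)} → Fits e σ → Does (x := e) σ (suc (cst e)) (setR x (⟪ e ⟫ σ) σ)
  do-:= x e {σ} {h} f = record
    { run = λ {c} c~σ → _ , _ , ≤-refl , ⇓-≔ , setR~ c~σ (eval~ e h c~σ) (fits≤ e h f (~B c~σ))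
    ; frame = setR-frame {P = x := e} (subst T (sym (==-refl x)) tt) }

  do-rd : ∀ x e {σ} → {_ : T (ok e)} → ⟪ e ⟫ σ < β → Does (rd x e) σ (suc (suc (cst e))) (setR x (lw σ (⟪ e ⟫ σ)) σ)
  do-rd x e {σ} {h} i<β = record
    { run = λ {c} c~σ → _ , _ , ≤-refl , ⇓-≔ , setR~ c~σ (rdeq c~σ) (bL (~B c~σ) _ i<β)
    ; frame = setR-frame {P = rd x e} (subst T (sym (==-refl x)) tt) }
    where
    β< : β < 2 ^ w
    β< = ≤-trans (subst (_≤ β + (NA + NA * V ^ 16)) (+-comm β 1) (+-monoʳ-≤ β (s≤s z≤n))) room
    rdeq : ∀ {c} → c ~ σ → toℕ (mem c (eval (compE k e) c)) ≡ lw σ (⟪ e ⟫ σ)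
    rdeq {c} c~σ = trans (cong (toℕ ∘ mem c) (toℕ-injective (trans (eval~ e h c~σ) (sym (toℕ-word {w} (<-trans i<β β<))))))
      (~L c~σ _ i<β)

  β<2^w : β < 2 ^ w
  β<2^w = ≤-trans (subst (_≤ β + (NA + NA * V ^ 16)) (+-comm β 1) (+-monoʳ-≤ β (s≤s z≤n))) room

  word-≢ : ∀ {x y} → x < 2 ^ w → y < 2 ^ w → x ≢ y → word w x ≢ word w y
  word-≢ hx hy ne eqq = ne (trans (sym (toℕ-word {w} hx)) (trans (cong toℕ eqq) (toℕ-word {w} hy)))

  setA~ : ∀ {c σ a i v v′} → c ~ σ → i ≤ V ^ 16 → toℕ v′ ≡ v → v ≤ V →
    ⟨ regs c , updateAt (mem c) (word w (adr a i)) (const v′) , coins c ⟩ ~ setA a i v σ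
  setA~ {c} {σ} {a} {i} {v} {v′} c~σ hi e h = record
    { ~β = ~β c~σ ; ~R = ~R c~σ ; ~A = go
    ; ~L = λ j j<β → trans (cong toℕ (updateAt-minimal _ _ (mem c) (word-≢ (<-trans j<β β<2^w) (adr<′ a hi) (<⇒≢ (<-≤-trans j<β (m≤m+n β _)))))) (~L c~σ j j<β)
    ; ~B = record { bR = bR (~B c~σ) ; bA = gb ; bL = bL (~B c~σ) } }
    where
    M = updateAt (mem c) (word w (adr a i)) (const v′)
    go : ∀ b j → adr b j < 2 ^ w → toℕ (M (word w (adr b j))) ≡ ar (setA a i v σ) b j
    go b j ltt with a == b in eqq
    ... | false = trans (cong toℕ (updateAt-minimal _ _ (mem c) (word-≢ ltt (adr<′ a hi) ne))) (~A c~σ b j ltt)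
      where
      ne : adr b j ≢ adr a i
      ne p = contradiction (trans (sym eqq) (subst (λ z → (a == z) ≡ true) (sym (proj₁ (addr-inj {β} {b} {a} {j} {i} p))) (==-refl a))) λ ()
    ... | true with i ≡ᵇ j in eq′
    ...   | true  = trans (cong (toℕ ∘ M ∘ word w) (cong₂ adr (sym ab) (sym ij))) (trans (cong toℕ (updateAt-updates (word w (adr a i)) (mem c))) e)
      where
      ab : a ≡ b
      ab = toℕ-injective (≡ᵇ⇒≡ (toℕ a) (toℕ b) (subst T (sym eqq) tt))
      ij : i ≡ j
      ij = ≡ᵇ⇒≡ i j (subst T (sym eq′) tt)
    ...   | false = trans (cong toℕ (updateAt-minimal _ _ (mem c) (word-≢ ltt (adr<′ a hi) ne))) (~A c~σ b j ltt)
      where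
      ne : adr b j ≢ adr a i
      ne p = subst T eq′ (≡⇒≡ᵇ i j (sym (proj₂ (addr-inj {β} {b} {a} {j} {i} p))))
    gb : ∀ b j → ar (setA a i v σ) b j ≤ V
    gb b j with a == b
    ... | false = bA (~B c~σ) b j
    ... | true with i ≡ᵇ j
    ...   | true = h
    ...   | false = bA (~B c~σ) b j

  setA-frame : ∀ a e f {i v σ} → Frame (a ⟨ e ⟩:= f) σ (setA a i v σ)
  setA-frame a e f {i} {v} {σ} = record { fR = λ _ → refl ; fA = λ b {h} → go b h ; fL = refl }
    where
    go : ∀ b → T (not (a == b)) → ar (setA a i v σ) b ≡ ar σ b
    go b h with a == b
    ... | false = refl

  scostA : Term → Term → ℕ
  scostA e f = suc (suc (suc (suc (suc (suc (suc (cst e))))))) + cst f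

  do-A : ∀ a e f {σ} → {_ : T (ok e)} → {_ : T (ok f)} → Fits f σ →
    Does (a ⟨ e ⟩:= f) σ (scostA e f) (setA a (⟪ e ⟫ σ) (⟪ f ⟫ σ) σ)
  do-A a e f {σ} {he} {hf} fit = record
    { run = λ {c} c~σ → _ , _ , ≤-refl , ⇓-store ,
        subst (λ z → ⟨ regs c , updateAt (mem c) z (const (eval (compE k f) c)) , coins c ⟩ ~ setA a (⟪ e ⟫ σ) (⟪ f ⟫ σ) σ)
          (sym (addr-sim a {c = c} {e′ = compE k e} (~β c~σ) (ev≤16 e he (~B c~σ)) (eval~ e he c~σ)))
          (setA~ {a = a} c~σ (ev≤16 e he (~B c~σ)) (eval~ f hf c~σ) (fits≤ f hf fit (~B c~σ)))
    ; frame = setA-frame a e f {⟪ e ⟫ σ} {⟪ f ⟫ σ} }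

  setL~ : ∀ {c σ i v v′} → c ~ σ → i < β → toℕ v′ ≡ v → v ≤ V →
    ⟨ regs c , updateAt (mem c) (word w i) (const v′) , coins c ⟩ ~ setL i v σ
  setL~ {c} {σ} {i} {v} {v′} c~σ hi e h = record
    { ~β = ~β c~σ ; ~R = ~R c~σ
    ; ~A = λ b j ltt → trans (cong toℕ (updateAt-minimal _ _ (mem c) (word-≢ ltt (<-trans hi β<2^w) (≢-sym (<⇒≢ (<-≤-trans hi (m≤m+n β _))))))) (~A c~σ b j ltt)
    ; ~L = go
    ; ~B = record { bR = bR (~B c~σ) ; bA = bA (~B c~σ) ; bL = gb } }
    where
    M = updateAt (mem c) (word w i) (const v′)
    go : ∀ j → j < β → toℕ (M (word w j)) ≡ setf (lw σ) i v j
    go j ltt with i ≡ᵇ j in eq′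
    ... | true  = trans (cong (toℕ ∘ M ∘ word w) (sym (≡ᵇ⇒≡ i j (subst T (sym eq′) tt)))) (trans (cong toℕ (updateAt-updates (word w i) (mem c))) e)
    ... | false = trans (cong toℕ (updateAt-minimal _ _ (mem c) (word-≢ (<-trans ltt β<2^w) (<-trans hi β<2^w) (λ p → subst T eq′ (≡⇒≡ᵇ i j (sym p)))))) (~L c~σ j ltt)
    gb : ∀ j → j < β → setf (lw σ) i v j ≤ V
    gb j ltt with i ≡ᵇ j
    ... | true = h
    ... | false = bL (~B c~σ) j ltt

  do-wr : ∀ e f {σ} → {_ : T (ok e)} → {_ : T (ok f)} → ⟪ e ⟫ σ < β → Fits f σ →
    Does (wr e f) σ (suc (cst e + cst f)) (setL (⟪ e ⟫ σ) (⟪ f ⟫ σ) σ)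
  do-wr e f {σ} {he} {hf} i<β fit = record
    { run = λ {c} c~σ → _ , _ , ≤-refl , ⇓-store ,
        subst (λ z → ⟨ regs c , updateAt (mem c) z (const (eval (compE k f) c)) , coins c ⟩ ~ setL (⟪ e ⟫ σ) (⟪ f ⟫ σ) σ)
          (toℕ-injective (trans (toℕ-word {w} (<-trans i<β β<2^w)) (sym (eval~ e he c~σ))))
          (setL~ c~σ i<β (eval~ f hf c~σ) (fits≤ f hf fit (~B c~σ)))
    ; frame = record { fR = λ _ → refl ; fA = λ _ → refl ; fL = λ {} } }

  -- Rules for composition, branching and loops

  Runs : Command → Store → (ℕ → Store → Set) → Set
  Runs P σ Q = ∃[ t ] ∃[ τ ] (Does P σ t τ × Q t τ)

  frame-▸ : ∀ {P Q σ τ υ} → Frame P σ τ → Frame Q τ υ → Frame (P ▸ Q) σ υ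
  frame-▸ {P} {Q} f g = record
    { fR = λ x {h} → trans (fR g x {proj₂ (∨-T {writesR P x} h)}) (fR f x {proj₁ (∨-T {writesR P x} h)})
    ; fA = λ a {h} → trans (fA g a {proj₂ (∨-T {writesA P a} h)}) (fA f a {proj₁ (∨-T {writesA P a} h)})
    ; fL = λ {h} → trans (fL g {proj₂ (∨-T {writesL P} h)}) (fL f {proj₁ (∨-T {writesL P} h)}) }

  does-▸ : ∀ {P Q σ τ υ s t} → Does P σ s τ → Does Q τ t υ → Does (P ▸ Q) σ (s + t) υ
  does-▸ p q = record
    { run = λ c~σ → let c₁ , t₁ , l₁ , r₁ , s₁ = run p c~σ ; c₂ , t₂ , l₂ , r₂ , s₂ = run q s₁
                    in c₂ , t₁ + t₂ , +-mono-≤ l₁ l₂ , ⇓-⨾ r₁ r₂ , s₂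
    ; frame = frame-▸ (frame p) (frame q) }

  runs-▸ : ∀ {P Q σ Z} → Runs P σ (λ s τ → Runs Q τ (λ t υ → Z (s + t) υ)) → Runs (P ▸ Q) σ Z
  runs-▸ (s , τ , p , t , υ , q , z) = s + t , υ , does-▸ p q , z

  infixr 3 _⨟_
  _⨟_ : ∀ {P Q σ Y Z} → Runs P σ Y → (∀ {s τ} → Frame P σ τ → Y s τ → Runs Q τ (λ t υ → Z (s + t) υ)) → Runs (P ▸ Q) σ Z
  (s , τ , p , y) ⨟ f with f (frame p) y
  ... | t , υ , q , z = s + t , υ , does-▸ p q , z

  post : ∀ {P σ Y Z} → Runs P σ Y → (∀ {t τ} → Frame P σ τ → Y t τ → Z t τ) → Runs P σ Z
  post (t , τ , p , y) f = t , τ , p , f (frame p) y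

  does-nop : ∀ {σ} → Does nop σ 1 σ
  does-nop = record { run = λ c~σ → _ , _ , ≤-refl , ⇓-skip , c~σ ; frame = frame-refl }

  runs-nop : ∀ {σ Z} → Z 1 σ → Runs nop σ Z
  runs-nop z = _ , _ , does-nop , z

  does-iff₁ : ∀ {e P Q σ t τ} → {_ : T (ok e)} → ⟪ e ⟫ σ ≢ 0 → Does P σ t τ → Does (iff e P Q) σ (suc (cst e + t)) τ
  does-iff₁ {e} {P} {Q} {σ} {_} {τ} {h} ne p = record
    { run = λ c~σ → let c₁ , t₁ , l₁ , r₁ , s₁ = run p c~σ in
        c₁ , _ , s≤s (+-monoʳ-≤ (cst e) l₁) , ⇓-cond-true (subst (_≢ 0) (sym (eval~ e h c~σ)) ne) r₁ , s₁
    ; frame = record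
      { fR = λ x {h} → fR (frame p) x {proj₁ (∨-T {writesR P x} h)}
      ; fA = λ x {h} → fA (frame p) x {proj₁ (∨-T {writesA P x} h)}
      ; fL = λ {h} → fL (frame p) {proj₁ (∨-T {writesL P} h)} } }

  does-iff₀ : ∀ {e P Q σ t τ} → {_ : T (ok e)} → ⟪ e ⟫ σ ≡ 0 → Does Q σ t τ → Does (iff e P Q) σ (suc (cst e + t)) τ
  does-iff₀ {e} {P} {Q} {σ} {_} {τ} {h} ne p = record
    { run = λ c~σ → let c₁ , t₁ , l₁ , r₁ , s₁ = run p c~σ in
        c₁ , _ , s≤s (+-monoʳ-≤ (cst e) l₁) , ⇓-cond-false (trans (eval~ e h c~σ) ne) r₁ , s₁
    ; frame = record
      { fR = λ x {h} → fR (frame p) x {proj₂ (∨-T {writesR P x} h)}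
      ; fA = λ x {h} → fA (frame p) x {proj₂ (∨-T {writesA P x} h)}
      ; fL = λ {h} → fL (frame p) {proj₂ (∨-T {writesL P} h)} } }

  runs-iff : ∀ {e P Q σ Z} → {_ : T (ok e)} →
    (⟪ e ⟫ σ ≢ 0 → Runs P σ (λ t → Z (suc (cst e + t)))) →
    (⟪ e ⟫ σ ≡ 0 → Runs Q σ (λ t → Z (suc (cst e + t)))) → Runs (iff e P Q) σ Z
  runs-iff {e} {σ = σ} {_} {h} f g with ⟪ e ⟫ σ ≟ 0
  ... | yes z = let t , τ , q , y = g z in _ , τ , does-iff₀ {e} {_} {_} {_} {_} {_} {h} z q , y
  ... | no nz = let t , τ , q , y = f nz in _ , τ , does-iff₁ {e} {_} {_} {_} {_} {_} {h} nz q , y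

  -- Straight-line code is executed symbolically: its final store and its time are found by
  -- conversion, and only the bounds collected in `Safe` remain to be proved.
  exec : Command → Store → Store
  exec (x := e) σ = setR x (⟪ e ⟫ σ) σ
  exec (a ⟨ e ⟩:= f) σ = setA a (⟪ e ⟫ σ) (⟪ f ⟫ σ) σ
  exec (P ▸ Q) σ = exec Q (exec P σ)
  exec _ σ = σ

  Safe : Command → Store → Set
  Safe (x := e) σ = Fits e σ
  Safe (a ⟨ e ⟩:= f) σ = Fits f σ
  Safe (P ▸ Q) σ = Safe P σ × Safe Q (exec P σ)
  Safe _ σ = ⊤

  scost : Command → ℕ
  scost (x := e) = suc (cst e)
  scost (a ⟨ e ⟩:= f) = scostA e f
  scost (P ▸ Q) = scost P + scost Q
  scost _ = 0

  does-block : ∀ P {σ} → T (straight P) → T (okC P) → Safe P σ → Does P σ (scost P) (exec P σ)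
  does-block (x := e) s o f = do-:= x e {_} {o} f
  does-block (a ⟨ e ⟩:= g) s o f = do-A a e g {_} {proj₁ (∧-T {ok e} o)} {proj₂ (∧-T {ok e} o)} f
  does-block (P ▸ Q) s o (f , g) = does-▸ (does-block P (proj₁ (∧-T {straight P} s)) (proj₁ (∧-T {okC P} o)) f)
    (does-block Q (proj₂ (∧-T {straight P} s)) (proj₂ (∧-T {okC P} o)) g)

  block : ∀ P {σ Z} → {_ : T (straight P)} → {_ : T (okC P)} → Safe P σ → Z (scost P) (exec P σ) → Runs P σ Z
  block P {_} {_} {s} {o} f z = _ , _ , does-block P s o f , z

  frame-wh : ∀ {e P σ τ υ} → Frame P σ τ → Frame (wh e P) τ υ → Frame (wh e P) σ υ
  frame-wh f g = record
    { fR = λ x {h} → trans (fR g x {h}) (fR f x {h})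
    ; fA = λ x {h} → trans (fA g x {h}) (fA f x {h})
    ; fL = λ {h} → trans (fL g {h}) (fL f {h}) }

  frame-wh′ : ∀ {e P σ τ υ} → Frame (wh e P) σ τ → Frame P τ υ → Frame (wh e P) σ υ
  frame-wh′ f g = record
    { fR = λ x {h} → trans (fR g x {h}) (fR f x {h})
    ; fA = λ x {h} → trans (fA g x {h}) (fA f x {h})
    ; fL = λ {h} → trans (fL g {h}) (fL f {h}) }

  -- The invariant sees the time spent so far, so amortised bounds can be part of it; its first
  -- argument is the variant.
  runs-wh : ∀ e P {σ v} (I : ℕ → ℕ → Store → Set) → {_ : T (ok e)} →
    (∀ {v t τ} → Frame (wh e P) σ τ → I v t τ → ⟪ e ⟫ τ ≢ 0 →
       Runs P τ (λ t′ υ → ∃[ v′ ] (v′ < v × I v′ (suc (cst e) + (t + t′)) υ))) →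
    I v 0 σ → Runs (wh e P) σ (λ t τ → ∃[ v ] ∃[ t₀ ] (I v t₀ τ × ⟪ e ⟫ τ ≡ 0 × t ≡ t₀ + suc (cst e)))
  runs-wh e P {σ} {v} I {h} stp = go (<-wellFounded v) frame-refl
    where
    ar₁ : ∀ a b c d → a + suc (b + (c + d)) ≡ suc b + (a + c) + d
    ar₁ = solve-∀
    go : ∀ {v t₀ τ} → Acc _<_ v → Frame (wh e P) σ τ → I v t₀ τ →
      Runs (wh e P) τ (λ t υ → ∃[ v ] ∃[ t₁ ] (I v t₁ υ × ⟪ e ⟫ υ ≡ 0 × t₀ + t ≡ t₁ + suc (cst e)))
    go {v} {t₀} {τ} (acc rs) fr i with ⟪ e ⟫ τ ≟ 0
    ... | yes z = _ , τ , record
            { run = λ c~σ → _ , _ , ≤-refl , ⇓-while-false (trans (eval~ e h c~σ) z) , c~σ ; frame = frame-refl }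
          , v , t₀ , i , z , refl
    ... | no nz with stp fr i nz
    ...   | s , υ , p , v′ , v′<v , i′ with go {v′} (rs v′<v) (frame-wh′ {e} {P} fr (frame p)) i′
    ...     | t , ζ , q , v″ , t₁ , i″ , z , eqt = suc (cst e + (s + t)) , ζ , record
              { run = λ c~σ → let c₁ , _ , l₁ , r₁ , s₁ = run p c~σ ; c₂ , _ , l₂ , r₂ , s₂ = run q s₁ in
                  c₂ , _ , s≤s (+-monoʳ-≤ (cst e) (+-mono-≤ l₁ l₂)) , ⇓-while-true (subst (_≢ 0) (sym (eval~ e h c~σ)) nz) r₁ r₂ , s₂
              ; frame = frame-wh {e} {P} (frame p) (frame q) }
            , v″ , t₁ , i″ , z , trans (ar₁ t₀ (cst e) s t) eqt

  -- The overhead of one round. One more `fc` covers the initial assignment and the last, failing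
  -- test.
  fc : Fin NR → Term → ℕ
  fc x N = suc (cst ($ x ≺ N)) + suc (cst ($ x ⊕ ` 1))

  runs-for : ∀ x N P {σ Nv} (I : ℕ → ℕ → Store → Set) → {_ : T (ok ($ x ≺ N))} → {_ : T (not (writesR P x))} →
    Nv ≤ V → (∀ {τ} → Frame (for x N P) σ τ → ⟪ N ⟫ τ ≡ Nv) →
    I 0 0 (setR x 0 σ) →
    (∀ {i t τ} → i < Nv → Frame (for x N P) σ τ → rg τ x ≡ i → I i t τ →
       Runs P τ (λ t′ υ → I (suc i) (t + t′ + fc x N) (setR x (suc i) υ))) →
    Runs (for x N P) σ (λ t τ → ∃[ t₀ ] (I Nv t₀ τ × t ≤ t₀ + fc x N))
  runs-for x N P {σ} {Nv} I {oke} {nw} Nv≤V hN i₀ stp = post core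
    λ { _ (fr , v , t₀ , (i , i≤N , xi , veq , inv) , z , refl) →
        t₀ , subst (λ j → I j t₀ _) (≤-antisym i≤N (subst₂ _≤_ (hN fr) xi (bit-≥ z))) inv
           , ≤-trans (≤-reflexive (+-comm 2 (t₀ + suc (cst ($ x ≺ N)))))
               (≤-trans (≤-reflexive (+-assoc t₀ _ 2)) (+-monoʳ-≤ t₀ (+-monoʳ-≤ (suc (cst ($ x ≺ N))) (s≤s (s≤s z≤n))))) }
    where
    Jn : ℕ → ℕ → Store → Set
    Jn v t τ = ∃[ i ] (i ≤ Nv × rg τ x ≡ i × v ≡ Nv ∸ i × I i t τ)
    Exit : ℕ → Store → Set
    Exit t τ = ∃[ v ] ∃[ t₀ ] (Jn v t₀ τ × ⟪ $ x ≺ N ⟫ τ ≡ 0 × t ≡ t₀ + suc (cst ($ x ≺ N)))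
    ar₂ : ∀ a t t′ b → a + (t + (t′ + b)) ≡ t + t′ + (a + b)
    ar₂ = solve-∀
    body : ∀ {σ′} → Frame (x := ` 0) σ σ′ → ∀ {v t τ} → Frame (wh ($ x ≺ N) (P ▸ x := $ x ⊕ ` 1)) σ′ τ → Jn v t τ → ⟪ $ x ≺ N ⟫ τ ≢ 0 →
      Runs (P ▸ x := $ x ⊕ ` 1) τ (λ t′ υ → ∃[ v′ ] (v′ < v × Jn v′ (suc (cst ($ x ≺ N)) + (t + t′)) υ))
    body {σ′} fr₀ {v} {t} {τ} fr (i , i≤N , xi , refl , inv) nz = stp i<N fr₁ xi inv
      ⨟ λ {s} {υ} frP inv′ → block (x := $ x ⊕ ` 1) {_} {_} {_} {_} (subst (_≤ V) (sym (up frP)) (≤-trans i<N Nv≤V))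
          (Nv ∸ suc i , ∸-monoʳ-< (n<1+n i) i<N , suc i , i<N
          , trans (cong (λ b → if b then rg υ x + 1 else rg υ x) (==-refl x)) (up frP) , refl
          , subst₂ (λ a b → I (suc i) a (setR x b υ)) (sym (ar₂ (suc (cst ($ x ≺ N))) t s _)) (sym (up frP)) inv′)
      where
      fr₁ : Frame (for x N P) σ τ
      fr₁ = frame-▸ {x := ` 0} {wh ($ x ≺ N) (P ▸ x := $ x ⊕ ` 1)} fr₀ fr
      i<N : i < Nv
      i<N = subst₂ _<_ xi (hN fr₁) (bit-< nz)
      up : ∀ {υ} → Frame P τ υ → rg υ x + 1 ≡ suc i
      up f = trans (+-comm _ 1) (cong suc (trans (fR f x {nw}) xi))
    core : Runs (for x N P) σ (λ t τ → Frame (for x N P) σ τ × ∃[ v ] ∃[ t₀ ] (Jn v t₀ τ × ⟪ $ x ≺ N ⟫ τ ≡ 0 × t ≡ 2 + (t₀ + suc (cst ($ x ≺ N)))))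
    core = block (x := ` 0) {Z = λ t τ → t ≡ 2 × τ ≡ setR x 0 σ} tt (refl , refl)
      ⨟ λ { {_} fr (refl , refl) → post {Y = Exit} (runs-wh ($ x ≺ N) (P ▸ x := $ x ⊕ ` 1) {v = Nv} Jn {oke} (body fr)
              (0 , z≤n , cong (λ b → if b then 0 else rg σ x) (==-refl x) , refl , i₀))
            (λ { fr′ (v , t₀ , j , z , e) → frame-▸ {x := ` 0} {wh ($ x ≺ N) (P ▸ x := $ x ⊕ ` 1)} fr fr′ , v , t₀ , j , z , cong (2 +_) e }) }

  runs-for′ : ∀ x N P {σ Nv c} (I : ℕ → Store → Set) → {_ : T (ok ($ x ≺ N))} → {_ : T (not (writesR P x))} →
    Nv ≤ V → (∀ {τ} → Frame (for x N P) σ τ → ⟪ N ⟫ τ ≡ Nv) →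
    I 0 (setR x 0 σ) →
    (∀ {i τ} → i < Nv → Frame (for x N P) σ τ → rg τ x ≡ i → I i τ →
       Runs P τ (λ t υ → t ≤ c × I (suc i) (setR x (suc i) υ))) →
    Runs (for x N P) σ (λ t τ → t ≤ Nv * (c + fc x N) + fc x N × I Nv τ)
  runs-for′ x N P {c = c} I {a} {b} h₁ h₂ i₀ stp =
    post (runs-for x N P (λ i t τ → t ≤ i * (c + fc x N) × I i τ) {a} {b} h₁ h₂ (z≤n , i₀)
      (λ {i} {t} i<N fr xi (tl , inv) → post (stp i<N fr xi inv)
        λ { {s} _ (sl , inv′) → ≤-trans (≤-reflexive (ar₃ t s (fc x N)))
             (+-mono-≤ (+-monoˡ-≤ (fc x N) sl) tl) , inv′ }))
    (λ { _ (t₀ , (tl , inv) , l) → ≤-trans l (+-monoˡ-≤ (fc x N) tl) , inv })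
    where
    ar₃ : ∀ t s f → t + s + f ≡ s + f + t
    ar₃ = solve-∀

  -- Powers and the search for `D`

  power-ok : ∀ N {σ D Nv} → {_ : T (ok ($ rj ≺ N))} → rg σ rD ≡ D → 1 ≤ D → (∀ {τ} → ⟪ N ⟫ τ ≡ Nv) → Nv ≤ V → D ^ Nv ≤ V →
    Runs (power N) σ (λ t τ → t ≤ Nv * (30 + fc rj N) + fc rj N + 2 × rg τ rx ≡ D ^ Nv)
  power-ok N {σ} {D} {Nv} {o} eD D≥1 eN N≤V DN≤V = blk▸′ (post (runs-for′ rj N (rx := $ rx ⊗ $ rD) {setR rx 1 σ} {Nv} {30}
      (λ i τ → rg τ rx ≡ D ^ i) {o} {_} N≤V (λ _ → eN) refl
      (λ {i} {τ} i<N f ei h → let e = trans (cong₂ _*_ h (trans (fR f rD) eD)) (*-comm (D ^ i) D) in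
        block (rx := $ rx ⊗ $ rD) (≤-trans (≤-reflexive e) (≤-trans (^-monoʳ-≤ D {{>-nonZero D≥1}} i<N) DN≤V)) (≤ᵇ⇒≤ 4 30 tt , e)))
    λ { {t} _ (t≤ , h) → ≤-trans (≤-reflexive (+-comm 2 t)) (+-monoˡ-≤ 2 t≤) , h })
    where
    blk▸′ : ∀ {Z} → Runs (for rj N (rx := $ rx ⊗ $ rD)) (setR rx 1 σ) (λ t τ → Z (2 + t) τ) → Runs (power N) σ Z
    blk▸′ r = runs-▸ (block (rx := ` 1) tt r)

  module _ (n m : ℕ) (mn : m ≤ n * n) (n≤V : n ≤ V) (n2≤V : 2 + n ≤ V) (k1≤V : k + 1 ≤ V) (pw≤V : (2 + n) ^ (k + 1) ≤ V) (k≥1 : 1 ≤ k) where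

    record Sized (D : ℕ) : Set where
      field
        D≥2   : 2 ≤ D
        D≤    : D ≤ 2 + n
        big   : m ≤ D ^ (k + 1)
        tight : D ≡ 2 ⊎ (∃[ E ] (D ≡ suc E × 2 ≤ E × E ^ (k + 1) < m))

    -- While `D` is too small it grows in every round, hence the alternative in `big`. After `n`
    -- rounds it would be `2 + n`, whose square already exceeds `n * n` and thus `m`.
    record Searching (i : ℕ) (τ : Store) : Set where
      field
        D≥2   : 2 ≤ rg τ rD
        D≤    : rg τ rD ≤ 2 + i
        big   : m ≤ rg τ rD ^ (k + 1) ⊎ rg τ rD ≡ 2 + i
        tight : rg τ rD ≡ 2 ⊎ (∃[ E ] (rg τ rD ≡ suc E × 2 ≤ E × E ^ (k + 1) < m))

    search-ok : ∀ {σ} → rg σ rN ≡ n → rg σ rM ≡ m → Runs search σ (λ t τ → t ≤ 200 * (k + 2) * suc n × Sized (rg τ rD))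
    search-ok {σ} eN eM = runs-▸ (block (rD := ` 2) tt (post (runs-for′ rv ($ rN) search-body {setR rD 2 σ} {n} {C} Searching n≤V (λ f → trans (fR f rN) eN)
        (record { D≥2 = ≤-refl ; D≤ = ≤-refl ; big = inj₂ refl ; tight = inj₁ refl })
        (λ {i} {τ} i<n f ei h → body {i} {τ} i<n (trans (fR f rM) eM) h))
      λ { {t} {τ} _ (t≤ , h) → time t t≤ , record { D≥2 = Searching.D≥2 h ; D≤ = Searching.D≤ h ; big = large h ; tight = Searching.tight h } }))
      where
      C : ℕ
      C = (k + 1) * (30 + fc rj (par ⊕ ` 1)) + fc rj (par ⊕ ` 1) + 2 + 20
      time : ∀ t → t ≤ n * (C + 8) + 8 → 2 + t ≤ 200 * (k + 2) * suc n
      time t h = ≤-trans (+-monoʳ-≤ 2 h) (≤-trans (≤-trans (+-mono-≤ {2} {2} {n * (C + 8) + 8} ≤-refl (+-mono-≤ {n * (C + 8)} {n * (200 * (k + 2))} {8} {8} (*-monoʳ-≤ n c≤) ≤-refl))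
          (≤-trans (≤-reflexive (lem₁ n (200 * (k + 2)))) (+-monoˡ-≤ (n * (200 * (k + 2))) (≤-trans (≤-trans (≤ᵇ⇒≤ 10 200 tt) (≤-reflexive (sym (*-identityʳ 200)))) (*-monoʳ-≤ 200 {1} {k + 2} (≤-trans (s≤s z≤n) (m≤n+m 2 k)))))))
          (≤-reflexive (*-comm (suc n) (200 * (k + 2)))))
        where
        lem₁ : ∀ n C → 2 + (n * C + 8) ≡ 10 + n * C
        lem₁ = solve-∀
        lem₂ : ∀ k → (k + 1) * 40 + 10 + 2 + 20 + 8 ≡ 40 * (k + 2)
        lem₂ = solve-∀
        c≤ : C + 8 ≤ 200 * (k + 2)
        c≤ = ≤-trans (≤-reflexive (lem₂ k)) (*-monoˡ-≤ (k + 2) (≤ᵇ⇒≤ 40 200 tt))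
      large : ∀ {τ} → Searching n τ → m ≤ rg τ rD ^ (k + 1)
      large {τ} h with Searching.big h
      ... | inj₁ l = l
      ... | inj₂ e = subst (λ D → m ≤ D ^ (k + 1)) (sym e) (≤-trans mn (≤-trans (*-mono-≤ (m≤n+m n 2) (m≤n+m n 2))
          (≤-trans (≤-reflexive (cong ((2 + n) *_) (sym (*-identityʳ (2 + n))))) (^-monoʳ-≤ (2 + n) {2} {k + 1} (≤-trans (≤-reflexive refl) (+-monoˡ-≤ 1 k≥1))))))
      body : ∀ {i τ} → i < n → rg τ rM ≡ m → Searching i τ → Runs search-body τ (λ t υ → t ≤ C × Searching (suc i) (setR rv (suc i) υ))
      body {i} {τ} i<n em h = power-ok (par ⊕ ` 1) {τ} {rg τ rD} {k + 1} refl (≤-trans (s≤s z≤n) D≥2) refl k1≤V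
            (≤-trans (^-monoˡ-≤ (k + 1) (≤-trans D≤ (+-monoʳ-≤ 2 (<⇒≤ i<n)))) pw≤V) ⨟ λ {t₁} {τ₁} f (t₁≤ , e) →
          runs-iff {Z = λ t υ → t₁ + t ≤ C × Searching (suc i) (setR rv (suc i) υ)}
            (λ l → block (rD := $ rD ⊕ ` 1) (≤-trans (≤-reflexive (+-comm _ 1)) (≤-trans (s≤s (≤-trans (≤-reflexive (fR f rD)) D≤)) (≤-trans (+-monoʳ-≤ 2 i<n) n2≤V)))
               (+-mono-≤ t₁≤ (≤ᵇ⇒≤ 8 20 tt) , grow {τ₁} (fR f rD) (subst₂ _<_ e (trans (fR f rM) em) (bit-< l))))
            (λ l → runs-nop (+-mono-≤ t₁≤ (≤ᵇ⇒≤ 5 20 tt) , stay {τ₁} (fR f rD) (subst₂ _≤_ (trans (fR f rM) em) e (bit-≥ l))))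
        where
        open Searching h
        grow : ∀ {τ₁} → rg τ₁ rD ≡ rg τ rD → rg τ rD ^ (k + 1) < m → Searching (suc i) (setR rv (suc i) (setR rD (rg τ₁ rD + 1) τ₁))
        grow {τ₁} eD l = record
          { D≥2 = subst (2 ≤_) (sym e) (≤-trans D≥2 (n≤1+n _)) ; D≤ = subst (_≤ 3 + i) (sym e) (s≤s D≤)
          ; big = inj₂ (trans e (cong suc D≡)) ; tight = inj₂ (rg τ rD , e , D≥2 , l) }
          where
          e : rg τ₁ rD + 1 ≡ suc (rg τ rD)
          e = trans (+-comm _ 1) (cong suc eD)
          D≡ : rg τ rD ≡ 2 + i
          D≡ with big
          ... | inj₂ z = z
          ... | inj₁ z = ⊥-elim (<⇒≱ l z)
        stay : ∀ {τ₁} → rg τ₁ rD ≡ rg τ rD → m ≤ rg τ rD ^ (k + 1) → Searching (suc i) (setR rv (suc i) τ₁)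
        stay {τ₁} eD l = record
          { D≥2 = subst (2 ≤_) (sym eD) D≥2 ; D≤ = subst (_≤ 3 + i) (sym eD) (m≤n⇒m≤1+n D≤)
          ; big = inj₁ (subst (λ D → m ≤ D ^ (k + 1)) (sym eD) l)
          ; tight = subst (λ D → D ≡ 2 ⊎ (∃[ E ] (D ≡ suc E × 2 ≤ E × E ^ (k + 1) < m))) (sym eD) tight }

  -- Adjacency lists and output

  module Adjacency (n m H : ℕ) (src tgt : ℕ → ℕ) (m≤V : m ≤ V) (H<V : H < V) where
    open Graphs n H src tgt

    record Listed (h : ℕ) (τ : Store) : Set where
      field
        hd : ∀ u → ar τ HD u ≡ prevOcc u h
        nx : ∀ h′ → h′ < h → ar τ NX h′ ≡ prevOcc (src h′) h′
        tg : ∀ h′ → h′ < h → ar τ TG h′ ≡ tgt h′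

    build-ok : ∀ {σ o₁ o₂ off} → rg σ rM ≡ m → rg σ rs ≡ o₁ → rg σ rt ≡ o₂ → rg σ rS ≡ off → off + m ≤ H →
      (∀ e → e < m → o₁ + 2 * e < β) → (∀ e → e < m → o₂ + 2 * e < β) →
      (∀ e → e < m → lw σ (o₁ + 2 * e) ≡ src (off + e)) → (∀ e → e < m → lw σ (o₂ + 2 * e) ≡ tgt (off + e)) →
      Listed off σ → Runs build σ (λ t τ → t ≤ 200 * suc m × Listed (off + m) τ)
    build-ok {σ} {o₁} {o₂} {off} eM e₁ e₂ eS offm b₁ b₂ l₁ l₂ L = post (runs-for′ rv ($ rM) build-body {σ} {m} {100} (λ i τ → Listed (off + i) τ) m≤V
        (λ f → trans (fR f rM) eM)
        (record { hd = λ u → trans (Listed.hd L u) (cong (prevOcc u) (sym (+-identityʳ off)))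
                ; nx = λ h l → Listed.nx L h (subst (h <_) (+-identityʳ off) l) ; tg = λ h l → Listed.tg L h (subst (h <_) (+-identityʳ off) l) })
        (λ {i} {τ} i<m f ei J → body {i} {τ} i<m f ei J))
      λ { {t} _ (t≤ , J) → ≤-trans t≤ (≤-trans (≤-reflexive (lem m)) (≤-trans (+-mono-≤ (≤ᵇ⇒≤ 8 200 tt) (*-monoˡ-≤ m (≤ᵇ⇒≤ 108 200 tt))) (≤-reflexive (sym (*-suc 200 m))))) , J }
      where
      lem : ∀ m → m * 108 + 8 ≡ 8 + 108 * m
      lem = solve-∀
      tail-body : Command
      tail-body = rI := $ rS ⊕ $ rv ▸ NX ⟨ $ rI ⟩:= HD ⟨ $ ru ⟩ ▸ TG ⟨ $ rI ⟩:= $ rx ▸ HD ⟨ $ ru ⟩:= $ rI ⊕ ` 1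
      body : ∀ {i τ} → i < m → Frame build σ τ → rg τ rv ≡ i → Listed (off + i) τ →
        Runs build-body τ (λ t υ → t ≤ 100 × Listed (off + suc i) (setR rv (suc i) υ))
      body {i} {τ} i<m f refl J = _ , _ , does-▸ (do-rd ru ($ rs ⊕ ` 2 ⊗ $ rv) r₁) (does-▸ (do-rd rx ($ rt ⊕ ` 2 ⊗ $ rv) r₂)
          (does-block tail-body tt tt (fit₁ , tt , tt , fit₂))) , ≤ᵇ⇒≤ _ 100 tt , record { hd = hd′ ; nx = nx′ ; tg = tg′ }
        where
        s₁ = trans (fR f rs) e₁
        s₂ = trans (fR f rt) e₂
        h = off + i
        h<H : h < H
        h<H = <-≤-trans (+-monoʳ-< off i<m) offm
        r₁ : rg τ rs + 2 * i < β
        r₁ = subst (λ z → z + 2 * i < β) (sym s₁) (b₁ i i<m)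
        r₂ : rg τ rt + 2 * i < β
        r₂ = subst (λ z → z + 2 * i < β) (sym s₂) (b₂ i i<m)
        hI : rg τ rS + i ≡ h
        hI = cong (_+ i) (trans (fR f rS) eS)
        fit₁ : rg τ rS + i ≤ V
        fit₁ = ≤-trans (≤-reflexive hI) (≤-trans (<⇒≤ h<H) (<⇒≤ H<V))
        fit₂ : rg τ rS + i + 1 ≤ V
        fit₂ = ≤-trans (≤-reflexive (trans (+-comm _ 1) (cong suc hI))) (≤-trans h<H (<⇒≤ H<V))
        uS : lw τ (rg τ rs + 2 * i) ≡ src h
        uS = trans (cong₂ (λ g z → g (z + 2 * i)) (fL f) s₁) (l₁ i i<m)
        xT : lw τ (rg τ rt + 2 * i) ≡ tgt h
        xT = trans (cong₂ (λ g z → g (z + 2 * i)) (fL f) s₂) (l₂ i i<m)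
        υ = exec tail-body (setR rx (lw τ (rg τ rt + 2 * i)) (setR ru (lw τ (rg τ rs + 2 * i)) τ))
        step≡ : off + suc i ≡ suc h
        step≡ = +-suc off i
        hd′ : ∀ u → ar υ HD u ≡ prevOcc u (off + suc i)
        hd′ u = trans (go (setf-cases (ar τ HD) (lw τ (rg τ rs + 2 * i)) (rg τ rS + i + 1) u)) (cong (prevOcc u) (sym step≡))
          where
          go : (lw τ (rg τ rs + 2 * i) ≡ u × ar υ HD u ≡ rg τ rS + i + 1) ⊎ (lw τ (rg τ rs + 2 * i) ≢ u × ar υ HD u ≡ ar τ HD u) → ar υ HD u ≡ prevOcc u (suc h)
          go (inj₁ (e , v)) with src h ≡ᵇ u in eb
          ... | true = trans v (trans (+-comm _ 1) (cong suc hI))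
          ... | false = ⊥-elim (subst T eb (≡⇒≡ᵇ (src h) u (trans (sym uS) e)))
          go (inj₂ (ne , v)) with src h ≡ᵇ u in eb
          ... | true = ⊥-elim (ne (trans uS (≡ᵇ⇒≡ (src h) u (subst T (sym eb) tt))))
          ... | false = trans v (Listed.hd J u)
        nx′ : ∀ h′ → h′ < off + suc i → ar υ NX h′ ≡ prevOcc (src h′) h′
        nx′ h′ l with setf-cases (ar τ NX) (rg τ rS + i) (ar τ HD (lw τ (rg τ rs + 2 * i))) h′
        ... | inj₁ (e , v) = trans v (trans (Listed.hd J _) (cong₂ prevOcc (trans uS (cong src (trans (sym hI) e))) (trans (sym hI) e)))
        ... | inj₂ (ne , v) = trans v (Listed.nx J h′ (≤∧≢⇒< (s≤s⁻¹ (subst (h′ <_) step≡ l)) (λ e → ne (trans hI (sym e)))))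
        tg′ : ∀ h′ → h′ < off + suc i → ar υ TG h′ ≡ tgt h′
        tg′ h′ l with setf-cases (ar τ TG) (rg τ rS + i) (lw τ (rg τ rt + 2 * i)) h′
        ... | inj₁ (e , v) = trans v (trans xT (cong tgt (trans (sym hI) e)))
        ... | inj₂ (ne , v) = trans v (Listed.tg J h′ (≤∧≢⇒< (s≤s⁻¹ (subst (h′ <_) step≡ l)) (λ e → ne (trans hI (sym e)))))

  output-ok : ∀ {σ q} → rg σ rQ ≡ q → q ≤ β → q ≤ V → Runs output σ (λ t τ → t ≤ 200 * suc q × (∀ i → i < q → lw τ i ≡ ar σ ES i))
  output-ok {σ} {q} eQ q≤β q≤V = post (runs-for′ rv ($ rQ) (wr ($ rv) (ES ⟨ $ rv ⟩)) {σ} {q} {30} (λ i τ → ∀ j → j < i → lw τ j ≡ ar σ ES j) q≤V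
      (λ f → trans (fR f rQ) eQ) (λ _ ())
      (λ {i} {τ} i<q f ei J → _ , _ , do-wr ($ rv) (ES ⟨ $ rv ⟩) (subst (_< β) (sym ei) (<-≤-trans i<q q≤β)) tt , ≤ᵇ⇒≤ _ 30 tt , stp′ {i} {τ} f ei J))
    λ { {t} _ (t≤ , J) → ≤-trans t≤ (≤-trans (≤-reflexive (lem q)) (≤-trans (+-mono-≤ (≤ᵇ⇒≤ 8 200 tt) (*-monoˡ-≤ q (≤ᵇ⇒≤ 38 200 tt))) (≤-reflexive (sym (*-suc 200 q))))) , J }
    where
    lem : ∀ m → m * 38 + 8 ≡ 8 + 38 * m
    lem = solve-∀
    stp′ : ∀ {i τ} → Frame output σ τ → rg τ rv ≡ i → (∀ j → j < i → lw τ j ≡ ar σ ES j) → ∀ j → j < suc i → setf (lw τ) (rg τ rv) (ar τ ES (rg τ rv)) j ≡ ar σ ES j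
    stp′ {i} {τ} f refl J = below-suc _ (λ j l → trans (setf-ne (lw τ) i _ j (>⇒≢ l)) (J j l)) (trans (setf-eq (lw τ) i _) (cong (λ g → g i) (fA f ES)))

  -- Truncated and full searches

  record Env : Set where
    field
      n H : ℕ
      src tgt : ℕ → ℕ
      gs   : Graphs.Simple n H src tgt
      n<V  : n < V
      D    : ℕ
      D≥2  : 2 ≤ D
      D≤V  : D ≤ V
      nD≤V : n * D ≤ V
      m q  : ℕ
      sp tp : ℕ → ℕ
      sp<  : ∀ i → i < q → sp i < n
      tp<  : ∀ i → i < q → tp i < n
      q≤V  : q ≤ V
      nn≤V : suc (n + n) ≤ V
      β≡   : β ≡ 3 + 2 * m + 2 * q
      Y    : ℕ
      picks≤ : ∀ p → p * D ≤ 2 * n → p * D ≤ 2 * H → p * (1 + n + H + q) ≤ Y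
      kn≤V : suc (k * n + k * n) ≤ V
      pw≤V : D ^ k ≤ V
      k≥1  : 1 ≤ k

  module OnEnv (E : Env) where
    open Env E
    open Graphs n H src tgt

    record Lists (σ : Store) : Set where
      field
        hd : ∀ u → ar σ HD u ≡ prevOcc u H
        nx : ∀ h → h < H → ar σ NX h ≡ prevOcc (src h) h
        tg : ∀ h → h < H → ar σ TG h ≡ tgt h

    lists-frame : ∀ P {σ τ} → {_ : T (not (writesA P HD))} → {_ : T (not (writesA P NX))} → {_ : T (not (writesA P TG))} →
      Frame P σ τ → Lists σ → Lists τ
    lists-frame P {σ} {τ} {a} {b} {c} f L = record
      { hd = λ u → trans (cong (λ g → g u) (fA f HD {a})) (Lists.hd L u)
      ; nx = λ h l → trans (cong (λ g → g h) (fA f NX {b})) (Lists.nx L h l)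
      ; tg = λ h l → trans (cong (λ g → g h) (fA f TG {c})) (Lists.tg L h l) }

    -- Used twice: the list of vertex `i` has base `i * D` and limit `D`, a search from a pick has
    -- base `n * D` and limit `suc n`.
    module At (b lim root : ℕ) (lim≥2 : 2 ≤ lim) (root<n : root < n) where
      open Search root public

      Qf df : Store → ℕ → ℕ
      Qf σ j = ar σ QU (b + j)
      df σ j = ar σ QD (b + j)

      -- A frame condition inside an array: searches share `QU` and `QD` with the lists stored
      -- before, and write only from their base `b` on.
      record Below (σ τ : Store) : Set where
        field
          bQ : ∀ a → a < b → ar τ QU a ≡ ar σ QU a
          bD : ∀ a → a < b → ar τ QD a ≡ ar σ QD a
      open Below public

      below-trans : ∀ {σ τ υ} → Below σ τ → Below τ υ → Below σ υ
      below-trans f g = record { bQ = λ a l → trans (bQ g a l) (bQ f a l) ; bD = λ a l → trans (bD g a l) (bD f a l) }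

      InnerT NormalT : Store → ℕ → Set
      InnerT τ p = Inner (Qf τ) (df τ) (ar τ VI) (rg τ rZ) (rg τ rI) p
      NormalT τ i = Normal (Qf τ) (df τ) (ar τ VI) (rg τ rZ) i

      κ : ℕ
      κ = 200

      record Regs (τ : Store) : Set where
        field
          eB : rg τ rB ≡ b
          eL : rg τ rL ≡ lim
          eS : rg τ rS ≡ root
          ls : Lists τ

      -- `c` counts scanned arcs. `cc` bounds it by `deg u`, while `arcs≤` bounds it by the length
      -- of the queue and hence by `lim`; the cost of a head vertex is governed by the smaller of
      -- the two.
      record Scan (σ : Store) (u i p t : ℕ) (τ : Store) : Set where
        field
          c    : ℕ
          ep   : rg τ rp ≡ p
          p≤H  : p ≤ H
          psrc : p ≢ 0 → src (p ∸ 1) ≡ u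
          inn  : InnerT τ p
          eu   : Qf τ i ≡ u
          old  : ∀ j → j ≤ i → Qf τ j ≡ Qf σ j
          cc   : c + cnt u p ≡ deg u
          tc   : t ≤ c * κ
          s≤   : rg τ rZ ≤ lim
          edu  : rg τ rd′ ≡ suc (df τ i)
          bel  : Below σ τ

      scan-ok : ∀ {σ u i p t τ} → Regs τ → rg τ rI ≡ i → Scan σ u i p t τ → ⟪ (` 0 ≺ $ rp) ⊗ ($ rZ ≺ $ rL) ⟫ τ ≢ 0 →
        Runs bfs-scan τ (λ t′ υ → ∃[ p′ ] (p′ < p × Scan σ u i p′ (8 + (t + t′)) υ))
      scan-ok {p = zero} R eI I nz rewrite Scan.ep I = ⊥-elim (nz refl)
      scan-ok {σ} {u} {i} {suc h} {t} {τ} R refl I nz =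
        block bfs-next {Z = λ t υ → t ≡ 22 × υ ≡ τ₁} (tt , tt) (refl , refl)
        ⨟ λ { _ (refl , refl) → runs-iff {Z = λ t′ υ → ∃[ p′ ] (p′ < suc h × Scan σ u i p′ (8 + (t + (22 + t′))) υ)}
            (λ vis≢ → runs-nop (seen vis≢)) (λ vis≡ → block bfs-push (tt , tt , subst (λ s → s + 1 ≤ V) refl s+1≤V , s+1≤V) (fresh vis≡)) }
        where
        open Scan I
        open Regs R
        open Lists ls
        Q = Qf τ
        d = df τ
        s = rg τ rZ
        h<H : h < H
        h<H = p≤H
        sh : src h ≡ u
        sh = psrc λ ()
        hT : ar τ TG (rg τ rp ∸ 1) ≡ tgt h
        hT = trans (cong (λ z → ar τ TG (z ∸ 1)) ep) (tg h h<H)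
        hN : ar τ NX (rg τ rp ∸ 1) ≡ prevOcc u h
        hN = trans (cong (λ z → ar τ NX (z ∸ 1)) ep) (trans (nx h h<H) (cong (λ z → prevOcc z h) sh))
        τ₁ = exec bfs-next τ
        s<lim : s < lim
        s<lim = subst (s <_) eL (<ᵇ⇒< _ _ (proj₂ (pair-bit {0 <ᵇ rg τ rp} nz)))
        s+1≤V : s + 1 ≤ V
        s+1≤V = ≤-trans (≤-reflexive (+-comm s 1)) (≤-trans (s≤s (Queue.s≤n (Inner.que inn))) n<V)
        p′ = prevOcc u h
        p′<p : p′ < suc h
        p′<p = s≤s (prevOcc≤ u h)
        psrc′ : p′ ≢ 0 → src (p′ ∸ 1) ≡ u
        psrc′ = prevOcc-src u h
        shQ : src h ≡ Q i
        shQ = trans sh (sym eu)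
        cc′ : suc c + cnt u p′ ≡ deg u
        cc′ = trans (trans (cong (suc c +_) (cnt-prevOcc u h)) (trans (sym (+-suc c _)) (cong (c +_) (sym (cnt-suc u h sh))))) cc
        seen : ar τ₁ VI (rg τ₁ rx) ≢ 0 → ∃[ p′ ] (p′ < suc h × Scan σ u i p′ (8 + (t + (22 + suc (cst (VI ⟨ $ rx ⟩) + 1)))) τ₁)
        seen vis≢ = p′ , p′<p , record
          { c = suc c ; ep = hN ; p≤H = ≤-trans (≤-pred p′<p) (<⇒≤ h<H) ; psrc = psrc′
          ; inn = subst (InnerT τ) (cong (λ z → prevOcc z h) eu) (scanned inn shQ inq)
          ; eu = eu ; old = old ; cc = cc′ ; tc = tick 8 κ num tc ; s≤ = s≤ ; edu = edu ; bel = record { bQ = bQ bel ; bD = bD bel } }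
          where
          inq : InQ Q d s (tgt h) (suc (d i))
          inq with Queue.Qvis (Inner.que inn) (tgt h)
          ... | inj₁ z = ⊥-elim (vis≢ (trans (cong (ar τ VI) hT) z))
          ... | inj₂ (j , j<s , _ , qj) = j , j<s , qj , Inner.wide inn j j<s
        fresh : ar τ₁ VI (rg τ₁ rx) ≡ 0 → ∃[ p′ ] (p′ < suc h × Scan σ u i p′ (8 + (t + (22 + suc (cst (VI ⟨ $ rx ⟩) + scost bfs-push)))) (exec bfs-push τ₁))
        fresh vis≡ = p′ , p′<p , record
          { c = suc c ; ep = hN ; p≤H = ≤-trans (≤-pred p′<p) (<⇒≤ h<H) ; psrc = psrc′
          ; inn = subst₂ (λ z y → Inner (Qf τ₂) (df τ₂) (ar τ₂ VI) z i y) (+-comm 1 s) (cong (λ z → prevOcc z h) (trans (Pushed.Q-old pd i (Inner.i<s inn)) eu))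
              (scanned ip (trans shQ (sym (Pushed.Q-old pd i (Inner.i<s inn))))
                (s , ≤-refl , Pushed.Q-new pd , ≤-reflexive (trans (Pushed.d-new pd) (cong suc (sym (Pushed.d-old pd i (Inner.i<s inn)))))))
          ; eu = trans (Pushed.Q-old pd i (Inner.i<s inn)) eu
          ; old = λ j l → trans (Pushed.Q-old pd j (≤-<-trans l (Inner.i<s inn))) (old j l) ; cc = cc′ ; tc = tick 8 κ num tc
          ; s≤ = subst (_≤ lim) (+-comm 1 s) s<lim
          ; edu = trans edu (cong suc (sym (Pushed.d-old pd i (Inner.i<s inn))))
          ; bel = below-trans bel (record { bQ = λ a l → setf-ne (ar τ QU) _ _ a (ne a l) ; bD = λ a l → setf-ne (ar τ QD) _ _ a (ne a l) }) }
          where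
          τ₂ = exec bfs-push τ₁
          ne : ∀ a → a < b → rg τ rB + s ≢ a
          ne a l e = <⇒≢ (<-≤-trans l (m≤m+n b s)) (trans (sym e) (cong (_+ s) eB))
          pos : rg τ rB + s ≡ b + s
          pos = cong (_+ s) eB
          pd : Pushed Q d (ar τ VI) s (tgt h) (suc (d i)) (Qf τ₂) (df τ₂) (ar τ₂ VI)
          pd = record
            { Q-old = λ j l → setf-ne (ar τ QU) _ _ _ (λ e → <⇒≢ l (+-cancelˡ-≡ b j s (sym (trans (sym pos) e))))
            ; Q-new = trans (setf-at (ar τ QU) pos) hT
            ; d-old = λ j l → setf-ne (ar τ QD) _ _ _ (λ e → <⇒≢ l (+-cancelˡ-≡ b j s (sym (trans (sym pos) e))))
            ; d-new = trans (setf-at (ar τ QD) pos) edu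
            ; v-old = λ u ne → setf-ne (ar τ VI) _ _ u (λ e → ne (trans (sym e) hT))
            ; v-new = trans (setf-at (ar τ VI) hT) (+-comm s 1) }
          ip : Inner (Qf τ₂) (df τ₂) (ar τ₂ VI) (suc s) i (suc h)
          ip = push gs inn h<H shQ (trans (cong (ar τ VI) (sym hT)) vis≡) pd

      regs-frame : ∀ P {σ τ} → {_ : T (not (writesA P HD))} → {_ : T (not (writesA P NX))} → {_ : T (not (writesA P TG))} →
        {_ : T (not (writesR P rB))} → {_ : T (not (writesR P rL))} → {_ : T (not (writesR P rS))} → Frame P σ τ → Regs σ → Regs τ
      regs-frame P {_} {_} {x} {y} {z} {u} {v} {w} f r = record
        { eB = trans (fR f rB {u}) (Regs.eB r) ; eL = trans (fR f rL {v}) (Regs.eL r) ; eS = trans (fR f rS {w}) (Regs.eS r)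
        ; ls = lists-frame P {_} {_} {x} {y} {z} f (Regs.ls r) }

      -- The radius is `suc r`, where `r` is the recorded distance of the head being scanned when
      -- the limit was reached: everything up to distance `r` is stored, and no recorded distance
      -- exceeds `suc r`.
      Trunc : Store → Set
      Trunc τ = rg τ rZ ≡ lim × ∃[ r ] (rg τ rd′ ≡ suc r × Ball (Qf τ) (df τ) (rg τ rZ) r × (∀ j → j < rg τ rZ → df τ j ≤ suc r))

      QueueT : Store → Set
      QueueT τ = Queue (Qf τ) (df τ) (ar τ VI) (rg τ rZ)

      -- Both terms of the minimum are used: summed over the queue, `lim` gives the quadratic bound
      -- on truncated searches and `deg` the linear bound on full ones.
      head-time : Store → ℕ → ℕ
      head-time τ j = κ * suc (deg (Qf τ j) ⊓ lim)

      record Outer (σ : Store) (v t : ℕ) (τ : Store) : Set where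
        field
          i≤s  : rg τ rI ≤ rg τ rZ
          vi   : v ≡ n ∸ rg τ rI
          quo  : QueueT τ
          res  : (NormalT τ (rg τ rI) × rg τ rZ < lim) ⊎ Trunc τ
          so≤  : rg τ rZ ≤ lim
          to   : t ≤ sum (head-time τ) (rg τ rI)
          belo : Below σ τ

      outer-ok : ∀ {σ v t τ} → Regs σ → Frame (wh (($ rI ≺ $ rZ) ⊗ ($ rZ ≺ $ rL)) bfs-body) σ τ → Outer σ v t τ →
        ⟪ ($ rI ≺ $ rZ) ⊗ ($ rZ ≺ $ rL) ⟫ τ ≢ 0 →
        Runs bfs-body τ (λ t′ υ → ∃[ v′ ] (v′ < v × Outer σ v′ (8 + (t + t′)) υ))
      outer-ok {σ} {v} {t} {τ} R₀ fr O nz = block bfs-head {Z = λ t υ → t ≡ 33 × υ ≡ τ₁} (tt , d+1≤V , tt) (refl , refl)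
        ⨟ λ { frh (refl , refl) →
          runs-wh _ bfs-scan {v = rg τ₁ rp} (Scan τ₁ u i)
              (λ {p} {t} {ζ} f sc g → scan-ok (regs-frame bfs-inner f (regs-frame bfs-head frh R)) (fR f rI) sc g)
              (record { c = 0 ; ep = refl ; p≤H = subst (_≤ H) (sym ep) (prevOcc≤ u H)
                ; psrc = λ z → subst (λ y → src (y ∸ 1) ≡ u) (sym ep) (prevOcc-src u H (λ y → z (trans ep y)))
                ; inn = subst (InnerT τ) (sym ep) (enter nor i<s) ; eu = refl ; old = λ _ _ → refl
                ; cc = trans (cong (cnt u) ep) (cnt-prevOcc u H)
                ; tc = z≤n ; s≤ = so≤
                ; edu = trans (cong (λ z → ar τ QD (z + i) + 1) eB) (+-comm _ 1)
                ; bel = record { bQ = λ _ _ → refl ; bD = λ _ _ → refl } })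
          ⨟ λ { {t₁} {υ} fri (p , t₀ , sc , gz , te) → block (rI := $ rI ⊕ ` 1)
                (subst (λ z → z + 1 ≤ V) (sym (fR fri rI)) (subst (_≤ V) (+-comm 1 i) (<⇒≤ (≤-<-trans i<n n<V))))
                (n ∸ suc i , subst (n ∸ suc i <_) (sym vi) (∸-monoʳ-< ≤-refl i<n) , finish fri sc gz te) } }
        where
        open Outer O
        R : Regs τ
        R = regs-frame (wh (($ rI ≺ $ rZ) ⊗ ($ rZ ≺ $ rL)) bfs-body) fr R₀
        open Regs R
        i = rg τ rI
        gd = pair-bit {rg τ rI <ᵇ rg τ rZ} nz
        i<s : i < rg τ rZ
        i<s = <ᵇ⇒< _ _ (proj₁ gd)
        s<lim : rg τ rZ < lim
        s<lim = subst (rg τ rZ <_) eL (<ᵇ⇒< _ _ (proj₂ gd))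
        i<n : i < n
        i<n = <-≤-trans i<s (Queue.s≤n quo)
        nor : NormalT τ i
        nor with res
        ... | inj₁ (N , _) = N
        ... | inj₂ (e , _) = ⊥-elim (<⇒≢ s<lim e)
        u = Qf τ i
        τ₁ = exec bfs-head τ
        ep : rg τ₁ rp ≡ prevOcc u H
        ep = trans (Lists.hd ls _) (cong (λ z → prevOcc (ar τ QU (z + i)) H) eB)
        d+1≤V : ar τ QD (rg τ rB + i) + 1 ≤ V
        d+1≤V = subst (λ z → ar τ QD (z + i) + 1 ≤ V) (sym eB) (≤-trans (≤-reflexive (+-comm _ 1))
          (≤-trans (s≤s (Queue.d≤ quo i i<s)) (<⇒≤ (≤-<-trans i<n n<V))))
        finish : ∀ {p t₀ t₁ υ} → Frame bfs-inner τ₁ υ → Scan τ₁ u i p t₀ υ → ⟪ (` 0 ≺ $ rp) ⊗ ($ rZ ≺ $ rL) ⟫ υ ≡ 0 → t₁ ≡ t₀ + 8 →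
          Outer σ (n ∸ suc i) (8 + (t + (33 + (t₁ + 4)))) (exec (rI := $ rI ⊕ ` 1) υ)
        finish {p} {t₀} {t₁} {υ} fri sc gz refl = record
          { i≤s = subst (_≤ rg υ rZ) (sym si) (Inner.i<s inn′)
          ; vi = cong (n ∸_) (sym si)
          ; quo = Inner.que inn
          ; res = subst (λ z → (NormalT υ z × rg υ rZ < lim) ⊎ Trunc υ) (sym si) fin
          ; so≤ = s≤
          ; to = ≤-trans (≤-trans (≤-reflexive (lem t t₀)) (+-mono-≤ tb to)) (≤-reflexive
              (trans (cong₂ _+_ (cong (λ z → κ * suc (deg z ⊓ lim)) (sym eu)) (sym (sum-cong i (λ j l → cong (λ z → κ * suc (deg z ⊓ lim)) (old j (<⇒≤ l))))))
                (cong (sum (head-time υ)) (sym si))))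
          ; belo = below-trans belo (record { bQ = bQ bel ; bD = bD bel }) }
          where
          open Scan sc
          iυ : rg υ rI ≡ i
          iυ = fR fri rI
          Rυ : Regs υ
          Rυ = regs-frame bfs-inner fri (regs-frame bfs-head {τ} {τ₁} (frame (does-block bfs-head {τ} tt tt (tt , d+1≤V , tt))) R)
          inn′ : Inner (Qf υ) (df υ) (ar υ VI) (rg υ rZ) i p
          inn′ = subst (λ z → Inner (Qf υ) (df υ) (ar υ VI) (rg υ rZ) z p) iυ inn
          si : rg υ rI + 1 ≡ suc i
          si = trans (+-comm _ 1) (cong suc iυ)
          lem : ∀ t t₀ → 8 + (t + (33 + (t₀ + 8 + 4))) ≡ (53 + t₀) + t
          lem = solve-∀
          fin : (NormalT υ (suc i) × rg υ rZ < lim) ⊎ Trunc υ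
          fin with rg υ rZ <? lim
          ... | no nl = inj₂ (≤-antisym s≤ (≮⇒≥ nl) , df υ i , edu , truncated inn′ , Inner.wide inn′)
          ... | yes l with pair-bit₀ {0 <ᵇ rg υ rp} gz
          ...   | inj₂ z = ⊥-elim (z (<⇒<ᵇ (subst (rg υ rZ <_) (sym (Regs.eL Rυ)) l)))
          ...   | inj₁ z = inj₁ (leave (subst (Inner (Qf υ) (df υ) (ar υ VI) (rg υ rZ) i) (trans (sym (Scan.ep sc)) p0) inn′) , l)
            where
            p0 : rg υ rp ≡ 0
            p0 = n≤0⇒n≡0 (≮⇒≥ (λ y → z (<⇒<ᵇ y)))
          c≤ : c ≤ deg u ⊓ lim
          c≤ = ⊓-glb (≤-trans (m≤m+n c _) (≤-reflexive cc))
            (≤-trans (arcs≤ gs inn′ p≤H (trans (cong (λ z → c + cnt z p) eu) (trans cc (cong deg (sym eu))))) s≤)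
          tb : 53 + t₀ ≤ κ * suc (deg u ⊓ lim)
          tb = ≤-trans (+-mono-≤ (num {53} {κ}) (≤-trans tc (≤-trans (*-monoˡ-≤ κ c≤) (≤-reflexive (*-comm (deg u ⊓ lim) κ)))))
            (≤-reflexive (sym (*-suc κ (deg u ⊓ lim))))

      record Explored (σ : Store) (t : ℕ) (τ : Store) : Set where
        field
          queue   : QueueT τ
          size≤   : rg τ rZ ≤ lim
          outcome : ((∀ {u ℓ} → Wk root u ℓ → InQ (Qf τ) (df τ) (rg τ rZ) u ℓ) × rg τ rZ < lim) ⊎ Trunc τ
          below   : Below σ τ
          time-trunc : t ≤ κ + lim * (κ * suc lim)
          time-full  : t ≤ κ + κ * (n + H)

      bfs-ok : ∀ {σ} → Regs σ → (∀ u → ar σ VI u ≡ 0) → Runs bfs σ (Explored σ)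
      bfs-ok {σ} R v0 = block bfs-init {Z = λ t υ → t ≡ scost bfs-init × υ ≡ σ₁} (tt , tt , tt , tt , tt) (refl , refl)
        ⨟ λ { fr₀ (refl , refl) → post (runs-wh _ bfs-body {v = n} (Outer σ₁) (λ f O g → outer-ok (regs-frame bfs-init fr₀ R) f O g)
            (record { i≤s = z≤n ; vi = refl ; quo = Normal.que st₀ ; res = inj₁ (st₀ , lim≥2) ; so≤ = <⇒≤ lim≥2
                    ; to = z≤n ; belo = record { bQ = λ _ _ → refl ; bD = λ _ _ → refl } }))
          λ { {_} {τ} f (v , t₀ , O , gz , refl) → let open Outer O in record
            { queue = quo ; size≤ = so≤ ; outcome = out f O gz
            ; below = below-trans (record { bQ = λ a l → setf-ne (ar σ QU) _ _ a (ne a l) ; bD = λ a l → setf-ne (ar σ QD) _ _ a (ne a l) }) belo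
            ; time-trunc = ≤-trans (≤-reflexive (lem (scost bfs-init) t₀ 8)) (+-mono-≤ (num {scost bfs-init + 8} {κ}) (≤-trans to (trunc-time O)))
            ; time-full = ≤-trans (≤-reflexive (lem (scost bfs-init) t₀ 8)) (+-mono-≤ (num {scost bfs-init + 8} {κ}) (≤-trans to (full-time O))) } } }
        where
        open Regs R
        σ₁ = exec bfs-init σ
        lem : ∀ a t b → a + (t + b) ≡ (a + b) + t
        lem = solve-∀
        ne : ∀ a → a < b → rg σ rB ≢ a
        ne a l e = <⇒≢ l (trans (sym e) eB)
        st₀ : NormalT σ₁ 0
        st₀ = start root<n (trans (setf-at (ar σ QU) (trans eB (sym (+-identityʳ b)))) eS)
          (setf-at (ar σ QD) (trans eB (sym (+-identityʳ b)))) (setf-at (ar σ VI) eS)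
          (λ u ne → trans (setf-ne (ar σ VI) _ _ u (λ e → ne (trans (sym e) eS))) (v0 u))
        out : ∀ {τ v t₀} → Frame (wh (($ rI ≺ $ rZ) ⊗ ($ rZ ≺ $ rL)) bfs-body) σ₁ τ → Outer σ₁ v t₀ τ → ⟪ ($ rI ≺ $ rZ) ⊗ ($ rZ ≺ $ rL) ⟫ τ ≡ 0 →
          ((∀ {u ℓ} → Wk root u ℓ → InQ (Qf τ) (df τ) (rg τ rZ) u ℓ) × rg τ rZ < lim) ⊎ Trunc τ
        out {τ} f O gz with Outer.res O
        ... | inj₂ t = inj₂ t
        ... | inj₁ (N , s<lim) with pair-bit₀ {rg τ rI <ᵇ rg τ rZ} gz
        ...   | inj₁ z = inj₁ (complete N (≮⇒≥ (λ l → z (<⇒<ᵇ l))) , s<lim)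
        ...   | inj₂ z = ⊥-elim (z (<⇒<ᵇ (subst (rg τ rZ <_) (sym (trans (fR f rL) eL)) s<lim)))
        trunc-time : ∀ {v t₀ τ} → Outer σ₁ v t₀ τ → sum (head-time τ) (rg τ rI) ≤ lim * (κ * suc lim)
        trunc-time {τ = τ} O = ≤-trans (sum-mono (rg τ rI) (λ j _ → *-monoʳ-≤ κ (s≤s (m⊓n≤n (deg (Qf τ j)) lim))))
          (≤-trans (≤-reflexive (sum-const _ (rg τ rI))) (*-monoˡ-≤ (κ * suc lim) (≤-trans (Outer.i≤s O) (Outer.so≤ O))))
        full-time : ∀ {v t₀ τ} → Outer σ₁ v t₀ τ → sum (head-time τ) (rg τ rI) ≤ κ * (n + H)
        -- The heads are distinct, so the sum over the queue is at most the sum over all vertices,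
        -- and the degrees add up to at most `H`.
        full-time {τ = τ} O = ≤-trans (sum-mono i (λ j _ → ≤-trans (*-monoʳ-≤ κ (s≤s (m⊓n≤m (deg (Qf τ j)) lim))) (≤-reflexive (trans (*-comm κ (suc (deg (Qf τ j)))) (sym (+-identityʳ (suc (deg (Qf τ j)) * κ)))))))
          (≤-trans (sum-inj (λ _ → 1) (Qf τ) (λ u → suc (deg u) * κ) i n (λ _ _ → ≤-refl) (λ j l _ → Q< j (<-≤-trans l i≤s))
              (λ j j′ a c _ _ → Q-inj j j′ (<-≤-trans a i≤s) (<-≤-trans c i≤s)))
          (≤-trans (≤-reflexive (sum-*ʳ (λ u → suc (deg u)) κ n)) (≤-trans (≤-reflexive (*-comm (sum (λ u → suc (deg u)) n) κ)) (*-monoʳ-≤ κ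
            (≤-trans (≤-reflexive (sum-+ (λ _ → 1) deg n)) (+-mono-≤ (≤-reflexive (trans (sum-const 1 n) (*-identityʳ n))) (sum-deg gs)))))))
          where
          open Outer O
          open Queue quo
          i = rg τ rI

    -- Marks and counters

    K : ℕ
    K = 200

    clear-ok : ∀ {σ b} → (∀ u → ar σ VI u ≡ 0 ⊎ ∃[ j ] (j < rg σ rZ × ar σ VI u ≡ suc j × ar σ QU (b + j) ≡ u)) →
      rg σ rZ ≤ V → rg σ rB ≡ b →
      Runs clear σ (λ t τ → t ≤ K * suc (rg σ rZ) × (∀ u → ar τ VI u ≡ 0))
    clear-ok {σ} {b} v s≤V eB = post (runs-for′ rj ($ rZ) (ru := QU ⟨ $ rB ⊕ $ rj ⟩ ▸ VI ⟨ $ ru ⟩:= ` 0) {c = 60} Iv s≤V (λ f → fR f rZ)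
        (λ u → case v u of λ { (inj₁ z) → inj₁ z ; (inj₂ (j , x)) → inj₂ (j , z≤n , x) })
        (λ {i} {τ} i<s fr xi inv → block (ru := QU ⟨ $ rB ⊕ $ rj ⟩ ▸ VI ⟨ $ ru ⟩:= ` 0) (tt , tt) (num , stp′ i<s fr xi inv)))
      λ { fr (t≤ , inv) → ≤-trans t≤ (tm (rg σ rZ)) , λ u → case inv u of λ { (inj₁ z) → z ; (inj₂ (j , a , b , _)) → ⊥-elim (<⇒≱ b a) } }
      where
      Iv : ℕ → Store → Set
      Iv i τ = ∀ u → ar τ VI u ≡ 0 ⊎ ∃[ j ] (i ≤ j × j < rg σ rZ × ar τ VI u ≡ suc j × ar σ QU (b + j) ≡ u)
      tm : ∀ s → s * (60 + fc rj ($ rZ)) + fc rj ($ rZ) ≤ K * suc s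
      tm s = ≤-trans (+-mono-≤ (*-monoʳ-≤ s (num {60 + fc rj ($ rZ)} {K})) (num {fc rj ($ rZ)} {K})) (≤-reflexive (lem s K))
        where
        lem : ∀ s K → s * K + K ≡ K * suc s
        lem = solve-∀
      stp′ : ∀ {i τ} → i < rg σ rZ → Frame clear σ τ → rg τ rj ≡ i → Iv i τ → Iv (suc i) (setR rj (suc i) (exec (ru := QU ⟨ $ rB ⊕ $ rj ⟩ ▸ VI ⟨ $ ru ⟩:= ` 0) τ))
      stp′ {i} {τ} i<s fr xi inv u with setf-cases (ar τ VI) (ar τ QU (rg τ rB + rg τ rj)) 0 u
      ... | inj₁ (_ , e) = inj₁ e
      ... | inj₂ (ne , e) with inv u
      ...   | inj₁ z = inj₁ (trans e z)
      ...   | inj₂ (j , i≤j , j<s , vj , qj) = inj₂ (j , ≤∧≢⇒< i≤j (λ { refl → ne (trans (cong₂ (λ g x → g x) (fA fr QU) (cong₂ _+_ (trans (fR fr rB) eB) xi)) qj) }) , j<s , trans e vj , qj)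

    occ : (ℕ → ℕ) → ℕ → ℕ → ℕ
    occ f x = sum (λ j → δ (f j) x)

    count-time : ∀ D → D * (60 + fc rj ($ rD)) + fc rj ($ rD) ≤ K * suc D
    count-time s = ≤-trans (+-mono-≤ (*-monoʳ-≤ s (num {60 + fc rj ($ rD)} {K})) (num {fc rj ($ rD)} {K})) (≤-reflexive (lem s K))
      where
      lem : ∀ s K → s * K + K ≡ K * suc s
      lem = solve-∀

    bump-ok : ∀ {σ b D} → rg σ rB ≡ b → rg σ rD ≡ D → D ≤ V → (∀ x → ar σ CO x + D ≤ V) →
      Runs bump σ (λ t τ → t ≤ K * suc D × (∀ x → ar τ CO x ≡ ar σ CO x + occ (λ j → ar σ QU (b + j)) x D))
    bump-ok {σ} {b} {D} eB eD D≤V room = post (runs-for′ rj ($ rD) body {c = 60} Iv D≤V (λ f → trans (fR f rD) eD)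
        (λ x → sym (+-identityʳ _))
        (λ {i} {τ} i<D fr xi inv → block body (tt , fits {τ = τ} i<D inv) (num , stp′ i<D fr xi inv)))
      λ { fr (t≤ , inv) → ≤-trans t≤ (count-time D) , inv }
      where
      body = ru := QU ⟨ $ rB ⊕ $ rj ⟩ ▸ CO ⟨ $ ru ⟩:= CO ⟨ $ ru ⟩ ⊕ ` 1
      Qb : ℕ → ℕ
      Qb j = ar σ QU (b + j)
      Iv : ℕ → Store → Set
      Iv i τ = ∀ x → ar τ CO x ≡ ar σ CO x + occ Qb x i
      occ≤ : ∀ x i → occ Qb x i ≤ i
      occ≤ x i = ≤-trans (sum-mono i (λ j _ → bit≤1 (Qb j ≡ᵇ x))) (≤-reflexive (trans (sum-const 1 i) (*-identityʳ i)))
      fits : ∀ {i τ x} → i < D → Iv i τ → ar τ CO x + 1 ≤ V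
      fits {i} {τ} {x} i<D inv = ≤-trans (≤-reflexive (trans (cong (_+ 1) (inv x)) (+-assoc (ar σ CO x) (occ Qb x i) 1)))
        (≤-trans (+-monoʳ-≤ (ar σ CO x) (≤-trans (+-monoˡ-≤ 1 (occ≤ x i)) (≤-trans (≤-reflexive (+-comm i 1)) i<D))) (room x))
      stp′ : ∀ {i τ} → i < D → Frame bump σ τ → rg τ rj ≡ i → Iv i τ → Iv (suc i) (setR rj (suc i) (exec body τ))
      stp′ {i} {τ} i<D fr xi inv x with setf-cases (ar τ CO) (ar τ QU (rg τ rB + rg τ rj)) (ar τ CO (ar τ QU (rg τ rB + rg τ rj)) + 1) x
      ... | inj₁ (refl , e) = trans e (trans (cong (_+ 1) (inv x₀)) (trans (lem (ar σ CO x₀) (occ Qb x₀ i))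
          (cong (λ z → ar σ CO x₀ + (z + occ Qb x₀ i)) (sym (trans (cong (λ z → δ z x₀) qe) (δ-refl x₀))))))
        where
        x₀ = ar τ QU (rg τ rB + rg τ rj)
        lem : ∀ a o → a + o + 1 ≡ a + (1 + o)
        lem = solve-∀
        qe : Qb i ≡ x₀
        qe = sym (cong₂ (λ g x → g x) (fA fr QU) (cong₂ _+_ (trans (fR fr rB) eB) xi))
      ... | inj₂ (ne , e) = trans e (trans (inv x) (cong (λ z → ar σ CO x + (z + occ Qb x i)) (sym (δ-≢ {Qb i} {x} λ e → ne (trans (cong₂ (λ g x → g x) (fA fr QU) (cong₂ _+_ (trans (fR fr rB) eB) xi)) e)))))

    -- Stated additively because subtraction is truncated. The hypothesis on `occ` guarantees that
    -- each decrement finds a positive counter.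
    drop-ok : ∀ {σ v D} → rg σ rv ≡ v → rg σ rD ≡ D → D ≤ V → (∀ x → occ (λ j → ar σ QU (v * D + j)) x D ≤ ar σ CO x) →
      Runs drop-all σ (λ t τ → t ≤ K * suc D × (∀ x → ar τ CO x + occ (λ j → ar σ QU (v * D + j)) x D ≡ ar σ CO x))
    drop-ok {σ} {v} {D} eB eD D≤V room = post (runs-for′ rj ($ rD) body {c = 60} Iv D≤V (λ f → trans (fR f rD) eD)
        (λ x → +-identityʳ _)
        (λ {i} {τ} i<D fr xi inv → block body (tt , tt) (num , stp′ i<D fr xi inv)))
      λ { fr (t≤ , inv) → ≤-trans t≤ (count-time D) , inv }
      where
      body = ru := QU ⟨ $ rv ⊗ $ rD ⊕ $ rj ⟩ ▸ CO ⟨ $ ru ⟩:= CO ⟨ $ ru ⟩ ⊖ ` 1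
      Qb : ℕ → ℕ
      Qb j = ar σ QU (v * D + j)
      Iv : ℕ → Store → Set
      Iv i τ = ∀ x → ar τ CO x + occ Qb x i ≡ ar σ CO x
      occ-mono : ∀ x i → i ≤ D → occ Qb x i ≤ occ Qb x D
      occ-mono x i i≤D = go D i≤D
        where
        go : ∀ D → i ≤ D → occ Qb x i ≤ occ Qb x D
        go D l with i ≟ D
        ... | yes refl = ≤-refl
        go zero z≤n | no ne = ≤-refl
        go (suc D) l | no ne = ≤-trans (go D (s≤s⁻¹ (≤∧≢⇒< l ne))) (m≤n+m _ _)
      stp′ : ∀ {i τ} → i < D → Frame drop-all σ τ → rg τ rj ≡ i → Iv i τ → Iv (suc i) (setR rj (suc i) (exec body τ))
      stp′ {i} {τ} i<D fr xi inv x with setf-cases (ar τ CO) (ar τ QU (rg τ rv * rg τ rD + rg τ rj)) (ar τ CO (ar τ QU (rg τ rv * rg τ rD + rg τ rj)) ∸ 1) x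
      ... | inj₁ (refl , e) = trans (cong₂ _+_ e (cong (_+ occ Qb x₀ i) d1)) (trans (lem (ar τ CO x₀) (occ Qb x₀ i) pos) (inv x₀))
        where
        x₀ = ar τ QU (rg τ rv * rg τ rD + rg τ rj)
        qe : x₀ ≡ Qb i
        qe = cong₂ (λ g x → g x) (fA fr QU) (cong₂ _+_ (cong₂ _*_ (trans (fR fr rv) eB) (trans (fR fr rD) eD)) xi)
        d1 : δ (Qb i) x₀ ≡ 1
        d1 = trans (cong (λ z → δ z x₀) (sym qe)) (δ-refl x₀)
        pos : 1 ≤ ar τ CO x₀
        pos = +-cancelʳ-≤ (occ Qb x₀ i) 1 (ar τ CO x₀) (≤-trans (≤-reflexive (cong (_+ occ Qb x₀ i) (sym d1)))
          (≤-trans (occ-mono x₀ (suc i) i<D) (≤-trans (room x₀) (≤-reflexive (sym (inv x₀))))))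
        lem : ∀ a o → 1 ≤ a → a ∸ 1 + (1 + o) ≡ a + o
        lem (suc a) o (s≤s _) = +-suc a o
      ... | inj₂ (ne , e) = trans (cong₂ _+_ e (cong (_+ occ Qb x i) (δ-≢ {Qb i} {x} (λ z → ne (trans (cong₂ (λ g x → g x) (fA fr QU) (cong₂ _+_ (cong₂ _*_ (trans (fR fr rv) eB) (trans (fR fr rD) eD)) xi)) z))))) (inv x)

    relax-ok : ∀ a i {σ} → rg σ re ≢ 0 → Runs (relax a i) σ (λ t τ → t ≤ 80 × Relaxed (ar σ a) (rg σ i) (rg σ re) (ar τ a))
    relax-ok a i {σ} e≢0 = runs-iff
        (λ nz → runs-iff
          (λ l → block (a ⟨ $ i ⟩:= $ re) tt (num , subst (Relaxed (ar σ a) (rg σ i) (rg σ re)) (sym arr≡) (updated (λ _ → <⇒≤ (bit-< l)))))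
          (λ ge → runs-nop (num , record { other = λ _ _ → refl ; here≢ = nz ; here≤ = bit-≥ ge ; mono≤ = λ _ → ≤-refl ; which = inj₁ refl })))
        (λ z → block (a ⟨ $ i ⟩:= $ re) tt (num , subst (Relaxed (ar σ a) (rg σ i) (rg σ re)) (sym arr≡) (updated (λ nz → ⊥-elim (nz z)))))
      where
      arr≡ : ar (setA a (rg σ i) (rg σ re) σ) a ≡ setf (ar σ a) (rg σ i) (rg σ re)
      arr≡ rewrite ==-refl a = refl
      updated : (ar σ a (rg σ i) ≢ 0 → rg σ re ≤ ar σ a (rg σ i)) → Relaxed (ar σ a) (rg σ i) (rg σ re) (setf (ar σ a) (rg σ i) (rg σ re))
      updated h = record
        { other = λ j ne → setf-ne (ar σ a) _ _ j (≢-sym ne)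
        ; here≢ = λ z → e≢0 (trans (sym (setf-eq (ar σ a) _ _)) z)
        ; here≤ = ≤-reflexive (setf-eq (ar σ a) _ _)
        ; mono≤ = λ nz → ≤-trans (≤-reflexive (setf-eq (ar σ a) _ _)) (h nz)
        ; which = inj₂ (setf-eq (ar σ a) _ _) }

    -- The stored lists

    InRow : (Q d : ℕ → ℕ) → ℕ → ℕ → ℕ → Set
    InRow Q d s u ℓ = ∃[ j ] (j < s × Q j ≡ u × d j ≤ ℓ)

    -- `c≥1` makes the length a proper modulus in `hop`; `inj` limits the contribution of a list to
    -- each counter to 1.
    record Row (Q d : ℕ → ℕ) (c v : ℕ) : Set where
      field
        c≥1 : 1 ≤ c
        c≤D : c ≤ D
        Q<n : ∀ j → j < c → Q j < n
        rwk : ∀ j → j < c → Wk v (Q j) (d j)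
        d≤n : ∀ j → j < c → d j ≤ n
        inj : ∀ i j → i < c → j < c → Q i ≡ Q j → i ≡ j

    Whole : (Q d : ℕ → ℕ) → ℕ → ℕ → Set
    Whole Q d c v = ∀ {u ℓ} → Wk v u ℓ → InRow Q d c u ℓ

    Part : (Q d : ℕ → ℕ) → (c v ra : ℕ) → Set
    Part Q d c v ra = c ≡ D × ∃[ r ] (ra ≡ suc r × (∀ {u ℓ} → Wk v u ℓ → ℓ ≤ r → InRow Q d c u ℓ) × (∀ j → j < c → d j ≤ suc r))

    module _ {Q d Q′ d′ : ℕ → ℕ} {c v : ℕ} (hQ : ∀ j → j < c → Q′ j ≡ Q j) (hd : ∀ j → j < c → d′ j ≡ d j) where
      in-ext : ∀ {u ℓ} → InRow Q d c u ℓ → InRow Q′ d′ c u ℓ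
      in-ext (j , l , a , b) = j , l , trans (hQ j l) a , subst (_≤ _) (sym (hd j l)) b

      row-ext : Row Q d c v → Row Q′ d′ c v
      row-ext R = record
        { c≥1 = c≥1 ; c≤D = c≤D ; Q<n = λ j l → subst (_< n) (sym (hQ j l)) (Q<n j l)
        ; rwk = λ j l → subst₂ (Wk v) (sym (hQ j l)) (sym (hd j l)) (rwk j l)
        ; d≤n = λ j l → subst (_≤ n) (sym (hd j l)) (d≤n j l)
        ; inj = λ i j a b e → inj i j a b (trans (sym (hQ i a)) (trans e (hQ j b))) }
        where open Row R

      part-ext : ∀ {ra} → Part Q d c v ra → Part Q′ d′ c v ra
      part-ext (e , r , a , f , g) = e , r , a , (λ p l → in-ext (f p l)) , λ j l → subst (_≤ suc r) (sym (hd j l)) (g j l)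

    Qr dr : Store → ℕ → ℕ → ℕ
    Qr σ v j = ar σ QU (v * D + j)
    dr σ v j = ar σ QD (v * D + j)

    -- Only truncated lists are to be hit. A list known to be a whole component contains balls of
    -- every radius around its vertex, so no pick is required there.
    record Rows (i : ℕ) (τ : Store) : Set where
      field
        rows : ∀ v → v < i → Row (Qr τ v) (dr τ v) (ar τ CN v) v
        kind : ∀ v → v < i → (Whole (Qr τ v) (dr τ v) (ar τ CN v) v × ar τ UN v ≡ 0)
                            ⊎ (Part (Qr τ v) (dr τ v) (ar τ CN v) v (ar τ RA v) × ar τ UN v ≡ 1)
        un0  : ∀ v → i ≤ v → ar τ UN v ≡ 0
        co   : ∀ x → ar τ CO x ≡ sum (λ v → ar τ UN v * occ (Qr τ v) x D) i
        vi0  : ∀ u → ar τ VI u ≡ 0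

    un≤1 : ∀ {i τ v} → Rows i τ → ar τ UN v ≤ 1
    un≤1 {i} {τ} {v} R with v <? i
    ... | no nl = subst (_≤ 1) (sym (Rows.un0 R v (≮⇒≥ nl))) z≤n
    ... | yes l with Rows.kind R v l
    ...   | inj₁ (_ , e) = ≤-trans (≤-reflexive e) z≤n
    ...   | inj₂ (_ , e) = ≤-reflexive e

    occ≤D : ∀ f x → occ f x D ≤ D
    occ≤D f x = ≤-trans (sum-mono D (λ j _ → bit≤1 (f j ≡ᵇ x))) (≤-reflexive (trans (sum-const 1 D) (*-identityʳ D)))

    blk▸ : ∀ P {Q σ Z} → {_ : T (straight P)} → {_ : T (okC P)} → Safe P σ → Runs Q (exec P σ) (λ t υ → Z (scost P + t) υ) → Runs (P ▸ Q) σ Z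
    blk▸ P {_} {σ} {_} {a} {b} s r = runs-▸ (block P {_} {_} {a} {b} s r)

    record Marked (σ : Store) (v t : ℕ) (τ : Store) : Set where
      field
        mt : t ≤ 300 * (D * D)
        mc : (rg σ rZ < D × (∀ v → ar τ UN v ≡ ar σ UN v) × (∀ v → ar τ RA v ≡ ar σ RA v) × (∀ x → ar τ CO x ≡ ar σ CO x))
           ⊎ (D ≤ rg σ rZ × (∀ u → u ≢ v → ar τ UN u ≡ ar σ UN u) × (∀ u → u ≢ v → ar τ RA u ≡ ar σ RA u) ×
              ar τ UN v ≡ 1 × ar τ RA v ≡ rg σ rd′ × (∀ x → ar τ CO x ≡ ar σ CO x + occ (Qr σ v) x D))

    D≥1 : 1 ≤ D
    D≥1 = ≤-trans (n≤1+n 1) D≥2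

    DD≥1 : 1 ≤ D * D
    DD≥1 = *-mono-≤ D≥1 D≥1

    D≤DD : D ≤ D * D
    D≤DD = ≤-trans (≤-reflexive (sym (*-identityʳ D))) (*-monoʳ-≤ D D≥1)

    sD≤ : suc D ≤ D * D
    sD≤ = ≤-trans (s≤s (m≤m+n D 0)) (≤-trans (+-monoˡ-≤ (D + 0) D≥1) (≤-trans (*-monoˡ-≤ D D≥2) ≤-refl))

    mark-ok : ∀ {σ v} → rg σ rv ≡ v → rg σ rD ≡ D → rg σ rB ≡ v * D → (∀ x → ar σ CO x + D ≤ V) →
      Runs (iff ($ rZ ≺ $ rD) nop mark) σ (Marked σ v)
    mark-ok {σ} {v} ev eD eB co≤ = runs-iff
      (λ l → runs-nop (record { mt = constB (D * D) (num {_} {300}) DD≥1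
        ; mc = inj₁ (subst (rg σ rZ <_) eD (bit-< l) , (λ _ → refl) , (λ _ → refl) , λ _ → refl) }))
      (λ l → blk▸ (UN ⟨ $ rv ⟩:= ` 1) tt (blk▸ (RA ⟨ $ rv ⟩:= $ rd′) tt (
         post (bump-ok {b = v * D} {D} eB eD D≤V co≤) λ { {t} f (t≤ , co) → record
           { mt = ≤-trans (addB (D * D) {x = 22} {c = 30} {d = 200} (constB (D * D) (num {22} {30}) DD≥1) (≤-trans t≤ (*-monoʳ-≤ 200 sD≤))) (*-monoˡ-≤ (D * D) (num {230} {300}))
           ; mc = inj₂ (subst (_≤ rg σ rZ) eD (bit-≥ l)
               , (λ u ne → trans (cong (λ g → g u) (fA f UN)) (setf-ne (ar σ UN) _ _ u (λ e → ne (trans (sym e) ev))))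
               , (λ u ne → trans (cong (λ g → g u) (fA f RA)) (setf-ne (ar σ RA) _ _ u (λ e → ne (trans (sym e) ev))))
               , trans (cong (λ g → g v) (fA f UN)) (setf-at (ar σ UN) ev)
               , trans (cong (λ g → g v) (fA f RA)) (setf-at (ar σ RA) ev)
               , co) } })))

    row-ok : ∀ {i τ} → i < n → rg τ rN ≡ n → rg τ rD ≡ D → rg τ rL ≡ D → Lists τ → rg τ rv ≡ i → Rows i τ →
      Runs row τ (λ t υ → t ≤ 2000 * (D * D) × Rows (suc i) υ)
    row-ok {i} {τ} i<n eN eD eL ls ei R =
      blk▸ (rB := $ rv ⊗ $ rD) iD≤V (blk▸ (rS := $ rv) tt (
      B.bfs-ok (record { eB = eB ; eL = eL ; eS = ei ; ls = record { hd = Lists.hd ls ; nx = Lists.nx ls ; tg = Lists.tg ls } }) (Rows.vi0 R) ⨟ λ {tb} {τ₁} f₁ X →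
      blk▸ (CN ⟨ $ rv ⟩:= $ rZ) tt (
      mark-ok {v = i} (trans (fR f₁ rv) ei) (trans (fR f₁ rD) eD) (trans (fR f₁ rB) eB)
        -- Each of at most `i` marked lists contributes at most `D` to a counter, so another `D`
        -- stays within `n * D`.
        (λ x → ≤-trans (+-monoˡ-≤ D (≤-trans (≤-reflexive (trans (cong (λ g → g x) (fA f₁ CO)) (Rows.co R x)))
           (≤-trans (sum-mono i (λ v _ → ≤-trans (*-mono-≤ (un≤1 {i} {τ} {v} R) (occ≤D (Qr τ v) x)) (≤-reflexive (*-identityˡ D)))) (≤-reflexive (sum-const D i)))))
           (≤-trans (≤-reflexive (+-comm (i * D) D)) (≤-trans (*-monoˡ-≤ D i<n) nD≤V))) ⨟ λ {tm} {τ₂} f₂ M →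
      post (clear-ok {τ₂} {i * D} (λ u → case Search.Queue.Qvis (B.Explored.queue X) u of λ
          { (inj₁ z) → inj₁ (trans (cong (λ g → g u) (fA f₂ VI)) z)
          ; (inj₂ (j , a , b , c)) → inj₂ (j , subst (j <_) (sym (fR f₂ rZ)) a , trans (cong (λ g → g u) (fA f₂ VI)) b , trans (cong (λ g → g (i * D + j)) (fA f₂ QU)) c) })
          (subst (_≤ V) (sym (fR f₂ rZ)) (≤-trans (B.Explored.size≤ X) D≤V)) (trans (fR f₂ rB) (trans (fR f₁ rB) eB)))
        λ { {tc} {υ} f₃ (tc≤ , v0) →
          tm-all tb tm tc (B.Explored.time-trunc X) (Marked.mt M) (tc-all tc≤ (subst (_≤ D) (sym (fR f₂ rZ)) (B.Explored.size≤ X))) ,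
          fin {tb} {τ₁} {tm} {τ₂} {υ} f₁ X f₂ M f₃ v0 })))
      where
      module B = At (i * D) D i D≥2 i<n
      eB : rg τ rv * rg τ rD ≡ i * D
      eB = cong₂ _*_ ei eD
      iD≤V : rg τ rv * rg τ rD ≤ V
      iD≤V = ≤-trans (≤-reflexive eB) (≤-trans (*-monoˡ-≤ D (<⇒≤ i<n)) nD≤V)
      τ₀ = setR rS (rg τ rv) (setR rB (rg τ rv * rg τ rD) τ)
      tc-all : ∀ {s t} → t ≤ K * suc s → s ≤ D → t ≤ 200 * suc D
      tc-all {s} h l = ≤-trans h (*-monoʳ-≤ 200 (s≤s l))
      tm-all : ∀ tb tm tc → tb ≤ 200 + D * (200 * suc D) → tm ≤ 300 * (D * D) → tc ≤ 200 * suc D →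
        4 + (2 + (tb + (9 + (tm + tc)))) ≤ 2000 * (D * D)
      tm-all tb tm tc h₁ h₂ h₃ = ≤-trans (≤-reflexive (lem tb tm tc)) (≤-trans (addB (D * D) {c = 615} {d = 500} (addB (D * D) {c = 15} {d = 600} (constB (D * D) (num {15} {15}) DD≥1) hb)
        (addB (D * D) {c = 300} {d = 200} h₂ (≤-trans h₃ (*-monoʳ-≤ 200 sD≤)))) (*-monoˡ-≤ (D * D) (num {1115} {2000})))
        where
        lem : ∀ a b c → 4 + (2 + (a + (9 + (b + c)))) ≡ (15 + a) + (b + c)
        lem = solve-∀
        eq₁ : ∀ c D → D * (c * suc D) ≡ c * (D * D) + c * D
        eq₁ = solve-∀
        hb : tb ≤ 600 * (D * D)
        hb = ≤-trans h₁ (≤-trans (+-monoʳ-≤ 200 (≤-reflexive (eq₁ 200 D)))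
          (addB (D * D) {c = 200} {d = 400} (constB (D * D) {200} ≤-refl DD≥1) (addB (D * D) {c = 200} {d = 200} ≤-refl (*-monoʳ-≤ 200 D≤DD))))
      fin : ∀ {tb τ₁ tm τ₂ υ} → Frame bfs τ₀ τ₁ → B.Explored τ₀ tb τ₁ → let τ₁′ = setA CN (rg τ₁ rv) (rg τ₁ rZ) τ₁ in
        Frame (iff ($ rZ ≺ $ rD) nop mark) τ₁′ τ₂ → Marked τ₁′ i tm τ₂ → Frame clear τ₂ υ → (∀ u → ar υ VI u ≡ 0) → Rows (suc i) υ
      fin {tb} {τ₁} {tm} {τ₂} {υ} f₁ X f₂ M f₃ v0 = record
        { rows = rows′ ; kind = kind′
        ; un0 = λ v l → trans (un-out v (λ { refl → <-irrefl refl l })) (Rows.un0 R v (<⇒≤ l))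
        ; co = co′ ; vi0 = v0 }
        where
        open B.Explored X
        ei₁ : rg τ₁ rv ≡ i
        ei₁ = trans (fR f₁ rv) ei
        qu : ∀ a → ar υ QU a ≡ ar τ₁ QU a
        qu a = cong (λ g → g a) (trans (fA f₃ QU) (fA f₂ QU))
        qd : ∀ a → ar υ QD a ≡ ar τ₁ QD a
        qd a = cong (λ g → g a) (trans (fA f₃ QD) (fA f₂ QD))
        cn : ∀ v → ar υ CN v ≡ setf (ar τ₁ CN) (rg τ₁ rv) (rg τ₁ rZ) v
        cn v = cong (λ g → g v) (trans (fA f₃ CN) (fA f₂ CN))
        cn-out : ∀ v → v ≢ i → ar υ CN v ≡ ar τ CN v
        cn-out v ne = trans (cn v) (trans (setf-ne (ar τ₁ CN) _ _ v (λ e → ne (trans (sym e) ei₁))) (cong (λ g → g v) (fA f₁ CN)))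
        cn-in : ar υ CN i ≡ rg τ₁ rZ
        cn-in = trans (cn i) (setf-at (ar τ₁ CN) ei₁)
        un-out : ∀ v → v ≢ i → ar υ UN v ≡ ar τ UN v
        un-out v ne with Marked.mc M
        ... | inj₁ (_ , u , _) = trans (cong (λ g → g v) (fA f₃ UN)) (trans (u v) (cong (λ g → g v) (fA f₁ UN)))
        ... | inj₂ (_ , u , _) = trans (cong (λ g → g v) (fA f₃ UN)) (trans (u v ne) (cong (λ g → g v) (fA f₁ UN)))
        ra-out : ∀ v → v ≢ i → ar υ RA v ≡ ar τ RA v
        ra-out v ne with Marked.mc M
        ... | inj₁ (_ , _ , u , _) = trans (cong (λ g → g v) (fA f₃ RA)) (trans (u v) (cong (λ g → g v) (fA f₁ RA)))
        ... | inj₂ (_ , _ , u , _) = trans (cong (λ g → g v) (fA f₃ RA)) (trans (u v ne) (cong (λ g → g v) (fA f₁ RA)))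
        oQ : ∀ v → v < i → ∀ j → j < D → Qr υ v j ≡ Qr τ v j
        oQ v l j jl = trans (qu _) (B.bQ below _ (<-slot l jl))
        od : ∀ v → v < i → ∀ j → j < D → dr υ v j ≡ dr τ v j
        od v l j jl = trans (qd _) (B.bD below _ (<-slot l jl))
        c≤ : ∀ v → v < i → ar τ CN v ≤ D
        c≤ v l = Row.c≤D (Rows.rows R v l)
        rows′ : ∀ v → v < suc i → Row (Qr υ v) (dr υ v) (ar υ CN v) v
        rows′ v (s≤s v≤i) with v ≟ i
        ... | no ne = subst (λ c → Row (Qr υ v) (dr υ v) c v) (sym (cn-out v ne))
                (row-ext (λ j jl → oQ v l j (<-≤-trans jl (c≤ v l))) (λ j jl → od v l j (<-≤-trans jl (c≤ v l))) (Rows.rows R v l))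
          where l = ≤∧≢⇒< v≤i ne
        ... | yes refl = subst (λ c → Row (Qr υ i) (dr υ i) c i) (sym cn-in) (row-ext {B.Qf τ₁} {B.df τ₁} (λ j _ → qu _) (λ j _ → qd _) (record
                { c≥1 = s≥1 ; c≤D = size≤ ; Q<n = Q< ; rwk = wk ; d≤n = λ j l → ≤-trans (d≤ j l) (≤-trans (<⇒≤ l) s≤n) ; inj = Q-inj }))
          where open Search.Queue queue
        kind′ : ∀ v → v < suc i → (Whole (Qr υ v) (dr υ v) (ar υ CN v) v × ar υ UN v ≡ 0) ⊎ (Part (Qr υ v) (dr υ v) (ar υ CN v) v (ar υ RA v) × ar υ UN v ≡ 1)
        kind′ v (s≤s v≤i) with v ≟ i
        kind′ v (s≤s v≤i) | no ne with Rows.kind R v (≤∧≢⇒< v≤i ne)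
        ... | inj₁ (h , e) = inj₁ ((λ {u} {ℓ} p → subst (λ c → InRow (Qr υ v) (dr υ v) c u ℓ) (sym (cn-out v ne))
                (in-ext {v = v} (λ j jl → oQ v l j (<-≤-trans jl (c≤ v l))) (λ j jl → od v l j (<-≤-trans jl (c≤ v l))) (h p))) , trans (un-out v ne) e)
          where l = ≤∧≢⇒< v≤i ne
        ... | inj₂ (h , e) = inj₂ (subst₂ (λ c ra → Part (Qr υ v) (dr υ v) c v ra) (sym (cn-out v ne)) (sym (ra-out v ne))
                (part-ext (λ j jl → oQ v l j (<-≤-trans jl (c≤ v l))) (λ j jl → od v l j (<-≤-trans jl (c≤ v l))) h) , trans (un-out v ne) e)
          where l = ≤∧≢⇒< v≤i ne
        kind′ v (s≤s v≤i) | yes refl with outcome | Marked.mc M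
        ... | inj₁ (h , s<D) | inj₁ (_ , u , _) = inj₁ ((λ {u} {ℓ} p → subst (λ c → InRow (Qr υ i) (dr υ i) c u ℓ) (sym cn-in)
                (in-ext {B.Qf τ₁} {B.df τ₁} {v = i} (λ j _ → qu _) (λ j _ → qd _) (h p)))
                , trans (cong (λ g → g i) (fA f₃ UN)) (trans (u i) (trans (cong (λ g → g i) (fA f₁ UN)) (Rows.un0 R i ≤-refl))))
        ... | inj₁ (h , s<D) | inj₂ (D≤s , _) = ⊥-elim (<⇒≱ s<D D≤s)
        ... | inj₂ (e , _) | inj₁ (s<D , _) = ⊥-elim (<⇒≢ s<D e)
        ... | inj₂ (e , r , er , bl , dd) | inj₂ (_ , _ , _ , un , ra , _) = inj₂
                (subst₂ (λ c ra → Part (Qr υ i) (dr υ i) c i ra) (sym cn-in) (sym (trans (cong (λ g → g i) (fA f₃ RA)) ra))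
                  (part-ext {B.Qf τ₁} {B.df τ₁} (λ j _ → qu _) (λ j _ → qd _) (e , r , er , bl , dd))
                , trans (cong (λ g → g i) (fA f₃ UN)) un)
        old-sum : ∀ x → sum (λ v → ar υ UN v * occ (Qr υ v) x D) i ≡ ar τ CO x
        old-sum x = trans (sum-cong i (λ v l → cong₂ _*_ (un-out v (<⇒≢ l)) (sum-cong D (λ j jl → cong (λ q → δ q x) (oQ v l j jl))))) (sym (Rows.co R x))
        co′ : ∀ x → ar υ CO x ≡ sum (λ v → ar υ UN v * occ (Qr υ v) x D) (suc i)
        co′ x with Marked.mc M
        ... | inj₁ (_ , u , _ , c) = trans (cong (λ g → g x) (fA f₃ CO)) (trans (c x) (trans (cong (λ g → g x) (fA f₁ CO)) (trans (sym (old-sum x))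
                (sym (cong (_+ sum (λ v → ar υ UN v * occ (Qr υ v) x D) i) (cong (_* occ (Qr υ i) x D)
                  (trans (cong (λ g → g i) (fA f₃ UN)) (trans (u i) (trans (cong (λ g → g i) (fA f₁ UN)) (Rows.un0 R i ≤-refl))))))))))
        ... | inj₂ (_ , _ , _ , un , _ , c) = trans (cong (λ g → g x) (fA f₃ CO)) (trans (c x) (trans (cong₂ _+_ (cong (λ g → g x) (fA f₁ CO))
                (sum-cong D (λ j _ → cong (λ q → δ q x) (sym (qu _))))) (trans (+-comm _ (occ (Qr υ i) x D))
                (cong₂ _+_ (sym (trans (cong (_* occ (Qr υ i) x D) (trans (cong (λ g → g i) (fA f₃ UN)) un)) (*-identityˡ _))) (sym (old-sum x))))))

    table-ok : ∀ {σ} → rg σ rN ≡ n → rg σ rD ≡ D → Lists σ → (∀ x → ar σ UN x ≡ 0) → (∀ x → ar σ CO x ≡ 0) → (∀ x → ar σ VI x ≡ 0) →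
      Runs table σ (λ t τ → t ≤ 3000 * (suc n * (D * D)) × Rows n τ)
    table-ok {σ} eN eD ls u0 c0 v0 = blk▸ (rL := $ rD) tt (
      post (runs-for′ rv ($ rN) row {c = 2000 * (D * D)} Rows (<⇒≤ n<V) (λ f → trans (fR f rN) eN)
        (record { rows = λ _ () ; kind = λ _ () ; un0 = λ v _ → u0 v ; co = c0 ; vi0 = v0 })
        (λ {i} {τ} i<n f ei R → post (row-ok i<n (trans (fR f rN) eN) (trans (fR f rD) eD) (trans (fR f rL) eD)
            (lists-frame (for rv ($ rN) row) f (record { hd = Lists.hd ls ; nx = Lists.nx ls ; tg = Lists.tg ls })) ei R)
          λ { _ (a , b) → a , record { rows = Rows.rows b ; kind = Rows.kind b ; un0 = Rows.un0 b ; co = Rows.co b ; vi0 = Rows.vi0 b } }))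
      λ { {t} _ (t≤ , R) → tm t t≤ , R })
      where
      tm : ∀ t → t ≤ n * (2000 * (D * D) + fc rv ($ rN)) + fc rv ($ rN) → 2 + t ≤ 3000 * (suc n * (D * D))
      tm t h = ≤-trans (+-monoʳ-≤ 2 (≤-trans h (+-monoˡ-≤ (fc rv ($ rN)) (*-monoʳ-≤ n (addB (D * D) {c = 2000} {d = 100} ≤-refl (constB (D * D) (num {_} {100}) DD≥1))))))
        (≤-trans (+-monoʳ-≤ 2 (+-monoʳ-≤ (n * (2100 * (D * D))) (constB (D * D) (num {_} {2098}) DD≥1)))
        (≤-trans (+-monoˡ-≤ _ (constB (D * D) (num {2} {2}) DD≥1)) (≤-trans (≤-reflexive (lem n (D * D) 2098)) (≤-trans (*-monoˡ-≤ (suc n * (D * D)) (num {2100} {3000})) ≤-refl))))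
        where
        lem : ∀ n X d → 2 * X + (n * ((2 + d) * X) + d * X) ≡ (2 + d) * (suc n * X)
        lem = solve-∀

    -- Hitting set and detours

    record Input (τ : Store) : Set where
      field
        eN : rg τ rN ≡ n
        eM : rg τ rM ≡ m
        eQ : rg τ rQ ≡ q
        eD : rg τ rD ≡ D
        ls : Lists τ
        ps : ∀ i → i < q → lw τ (3 + 2 * m + 2 * i) ≡ sp i
        pt : ∀ i → i < q → lw τ (4 + 2 * m + 2 * i) ≡ tp i

    input-frame : ∀ P {σ τ} → {_ : T (not (writesR P rN))} → {_ : T (not (writesR P rM))} → {_ : T (not (writesR P rQ))} → {_ : T (not (writesR P rD))} →
      {_ : T (not (writesA P HD))} → {_ : T (not (writesA P NX))} → {_ : T (not (writesA P TG))} → {_ : T (not (writesL P))} →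
      Frame P σ τ → Input σ → Input τ
    input-frame P {σ} {τ} {a} {b} {c} {d} {e} {f} {g} {h} F I = record
      { eN = trans (fR F rN {a}) eN ; eM = trans (fR F rM {b}) eM ; eQ = trans (fR F rQ {c}) eQ ; eD = trans (fR F rD {d}) eD
      ; ls = lists-frame P {σ} {τ} {e} {f} {g} F ls
      ; ps = λ i l → trans (cong (λ z → z _) (fL F {h})) (ps i l) ; pt = λ i l → trans (cong (λ z → z _) (fL F {h})) (pt i l) }
      where open Input I

    Dist : Store → ℕ → ℕ → Set
    Dist τ x v = (ar τ VI v ≡ 0 × (∀ ℓ → ¬ Wk x v ℓ))
      ⊎ (ar τ VI v ≢ 0 × ∃[ e ] (ar τ QD (n * D + (ar τ VI v ∸ 1)) ≡ e × Wk x v e × (∀ ℓ → Wk x v ℓ → e ≤ ℓ) × e ≤ n))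

    dist-same : ∀ {σ τ x v} → ar τ VI ≡ ar σ VI → ar τ QD ≡ ar σ QD → Dist σ x v → Dist τ x v
    dist-same {σ} {τ} {x} {v} e₁ e₂ d = subst₂ (λ V Q → (V v ≡ 0 × (∀ ℓ → ¬ Wk x v ℓ))
      ⊎ (V v ≢ 0 × ∃[ e ] (Q (n * D + (V v ∸ 1)) ≡ e × Wk x v e × (∀ ℓ → Wk x v ℓ → e ≤ ℓ) × e ≤ n))) (sym e₁) (sym e₂) d

    mod-small : ∀ x y → 1 ≤ y → ⟦ mod ⟧ x y < y
    mod-small x (suc y) _ = m%n<n x (suc y)

    mod-digit : ∀ i c y → i < y → ⟦ mod ⟧ (i + c * y) y ≡ i
    mod-digit i c (suc y) l = trans ([m+kn]%n≡m%n i c (suc y)) (m<n⇒m%n≡m l)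

    mod-id : ∀ i y → i < y → ⟦ mod ⟧ i y ≡ i
    mod-id i (suc y) l = m<n⇒m%n≡m l

    div-digit : ∀ i c y → i < y → ⟦ div ⟧ (i + c * y) y ≡ c
    div-digit i c (suc y) l = trans (+-distrib-/ i (c * suc y) small) (cong₂ _+_ (m<n⇒m/n≡0 l) (m*n/n≡m c (suc y)))
      where
      small : i % suc y + (c * suc y) % suc y < suc y
      small = subst (_< suc y) (sym (trans (cong₂ _+_ (m<n⇒m%n≡m l) (m*n%n≡0 c (suc y))) (+-identityʳ i))) l

    split : ∀ {s t} a {b} → Wk s t (a + b) → ∃[ p ] (Wk s p a × Wk p t b)
    split a {zero} p = _ , subst (Wk _ _) (+-identityʳ a) p , nil
    split {s} {t} a {suc b} p = last (+-suc a b) p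
      where
      last : ∀ {c t} → c ≡ suc (a + b) → Wk s t c → ∃[ p ] (Wk s p a × Wk p t (suc b))
      last e (snoc h r l x) with split a {b} (subst (Wk s _) (suc-injective e) r)
      ... | p , r₁ , r₂ = p , r₁ , snoc h r₂ l x

    -- Cells hold the estimate plus 1, with 0 for ∞. The upper bound is claimed for walks of every
    -- length `d` and is later applied to a shortest one.
    Answer : (ℕ → ℕ) → ℕ → Set
    Answer E i = (E i ≡ 0 ⊎ ∃[ e ] (E i ≡ suc e × Wk (sp i) (tp i) e))
      × (∀ d → Wk (sp i) (tp i) d → E i ≢ 0 × E i ≤ suc (d + 2 * ⌈ d ÷ 2 * k ⌉))

    QTime : ℕ
    QTime = q * (22 + 3 * (D ^ k * (100 * suc k + 300 + 8) + 8) + 8) + 8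

    -- The contents of the lists are fixed as functions, so that statements about lists do not
    -- depend on the store, although later searches keep writing to the same arrays from cell
    -- `n * D` on. `Tab` ties a store to these functions.
    record Stored : Set where
      field
        QT DT CT RT : ℕ → ℕ
        rowT : ∀ v → v < n → Row (λ j → QT (v * D + j)) (λ j → DT (v * D + j)) (CT v) v

    module Fixed (St : Stored) where
      open Stored St

      oc : ℕ → ℕ → ℕ
      oc v x = occ (λ j → QT (v * D + j)) x D

      WholeT PartT : ℕ → Set
      WholeT v = Whole (λ j → QT (v * D + j)) (λ j → DT (v * D + j)) (CT v) v
      PartT v = Part (λ j → QT (v * D + j)) (λ j → DT (v * D + j)) (CT v) v (RT v)

      record Tab (τ : Store) : Set where
        field
          tQ : ∀ a → a < n * D → ar τ QU a ≡ QT a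
          tD : ∀ a → a < n * D → ar τ QD a ≡ DT a
          tC : ∀ v → ar τ CN v ≡ CT v
          tR : ∀ v → ar τ RA v ≡ RT v

      tab-frame : ∀ P {σ τ} → {_ : T (not (writesA P QU))} → {_ : T (not (writesA P QD))} → {_ : T (not (writesA P CN))} → {_ : T (not (writesA P RA))} →
        Frame P σ τ → Tab σ → Tab τ
      tab-frame P {σ} {τ} {a} {b} {c} {d} F t = record
        { tQ = λ x l → trans (cong (λ g → g x) (fA F QU {a})) (Tab.tQ t x l) ; tD = λ x l → trans (cong (λ g → g x) (fA F QD {b})) (Tab.tD t x l)
        ; tC = λ x → trans (cong (λ g → g x) (fA F CN {c})) (Tab.tC t x) ; tR = λ x → trans (cong (λ g → g x) (fA F RA {d})) (Tab.tR t x) }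

      CountOK : Store → Set
      CountOK τ = ∀ x → ar τ CO x ≡ sum (λ v → ar τ UN v * oc v x) n

      U : Store → ℕ
      U τ = sum (ar τ UN) n

      -- Every route through `x` bounds the estimate; speaking of walks makes this applicable to any
      -- detour constructed later.
      Good : ℕ → (ℕ → ℕ) → ℕ → Set
      Good x E i = ∀ ℓ₁ ℓ₂ → Wk x (sp i) ℓ₁ → Wk x (tp i) ℓ₂ → E i ≢ 0 × E i ≤ suc (ℓ₁ + ℓ₂)

      Sound : (ℕ → ℕ) → Set
      Sound E = ∀ i → i < q → E i ≡ 0 ⊎ ∃[ e ] (E i ≡ suc e × Wk (sp i) (tp i) e)

      -- The order in which 0 is ∞. It carries bounds already secured through all later relaxations.
      Mono : (E E′ : ℕ → ℕ) → Set
      Mono E E′ = ∀ i → E i ≢ 0 → E′ i ≢ 0 × E′ i ≤ E i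

      HitState : (x : ℕ) (σ τ : Store) (v : ℕ) → Set
      HitState x σ τ v = (ar τ UN v ≡ ar σ UN v × (ar σ UN v ≢ 0 → ∀ ℓ → Wk x v ℓ → RT v < ℓ))
        ⊎ (ar σ UN v ≡ 1 × ar τ UN v ≡ 0 × ∃[ ℓ ] (Wk x v ℓ × ℓ ≤ RT v))

      -- `hti` is an amortised bound: `drop-all` costs up to `200 * suc D`, paid for by the decrease
      -- of `U`. Each list is removed at most once, so over all picks these removals cost at most
      -- `200 * suc D * n`.
      record Hit (x : ℕ) (σ : Store) (i t : ℕ) (τ : Store) : Set where
        field
          hco : CountOK τ
          hlo : ∀ v → v < i → HitState x σ τ v
          hhi : ∀ v → i ≤ v → ar τ UN v ≡ ar σ UN v
          hti : t + (200 * suc D) * U τ ≤ i * 200 + (200 * suc D) * U σ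

      slot< : ∀ {v j} → v < n → j < D → v * D + j < n * D
      slot< = <-slot

      oc≡ : ∀ {τ v} → Tab τ → v < n → ∀ x → occ (λ j → ar τ QU (v * D + j)) x D ≡ oc v x
      oc≡ {τ} {v} tb l x = sum-cong D (λ j jl → cong (λ z → δ z x) (Tab.tQ tb _ (slot< l jl)))

      hit-body-ok : ∀ {x σ i t τ} → i < n → Input τ → Tab τ → rg τ rB ≡ n * D → (∀ v → v < n → Dist τ x v) → (∀ v → v < n → ar σ UN v ≤ 1) →
        rg τ rv ≡ i → Hit x σ i t τ → Runs hit-body τ (λ t′ υ → Hit x σ (suc i) (t + t′ + fc rv ($ rN)) (setR rv (suc i) υ))
      hit-body-ok {x} {σ} {i} {t} {τ} i<n I tb eB ds un≤ refl h =
        runs-iff (λ u≢ → runs-iff (λ v≢ → runs-iff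
            (λ far → runs-nop (keep (num {_} {200}) (λ _ ℓ p → ≤-trans (subst (_< dd) (Tab.tR tb i) (bit-< far)) (far-≤ v≢ p))))
            (λ near → blk▸ (UN ⟨ $ rv ⟩:= ` 0) tt (post (drop-ok {σ₁} {i} {D} refl eD D≤V (room₁ u≢))
               λ { {t′} {υ} f (t≤ , co′) → dropˡ {t′} {υ} u≢ v≢ near f t≤ co′ })))
            (λ v≡ → runs-nop (keep (num {_} {200}) (λ _ ℓ p → ⊥-elim (none v≡ p)))))
          (λ u≡ → runs-nop (keep (num {_} {200}) (λ nz → ⊥-elim (nz (trans (sym (hhi i ≤-refl)) u≡)))))
        where
        open Hit h
        open Input I
        σ₁ = setA UN (rg τ rv) 0 τ
        none : ∀ {ℓ} → ar τ VI i ≡ 0 → Wk x i ℓ → ⊥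
        none {ℓ} z p with ds i i<n
        ... | inj₁ (_ , f) = f ℓ p
        ... | inj₂ (nz , _) = nz z
        dd = ar τ QD (rg τ rB + (ar τ VI i ∸ 1))
        dd≡ : dd ≡ ar τ QD (n * D + (ar τ VI i ∸ 1))
        dd≡ = cong (λ z → ar τ QD (z + (ar τ VI i ∸ 1))) eB
        far-≤ : ∀ {ℓ} → ar τ VI i ≢ 0 → Wk x i ℓ → dd ≤ ℓ
        far-≤ {ℓ} nz p with ds i i<n
        ... | inj₁ (z , _) = ⊥-elim (nz z)
        ... | inj₂ (_ , e , e≡ , _ , mn , _) = ≤-trans (≤-reflexive (trans dd≡ e≡)) (mn ℓ p)
        keep : ∀ {t′} → t′ + fc rv ($ rN) ≤ 200 → (ar σ UN i ≢ 0 → ∀ ℓ → Wk x i ℓ → RT i < ℓ) →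
          Hit x σ (suc i) (t + t′ + fc rv ($ rN)) (setR rv (suc i) τ)
        keep {t′} c≤ f = record
          { hco = hco
          ; hlo = below-suc (HitState x σ τ) hlo (inj₁ (hhi i ≤-refl , f))
          ; hhi = λ v l → hhi v (<⇒≤ l)
          ; hti = ≤-trans (≤-reflexive (lem t t′ (fc rv ($ rN)) ((200 * suc D) * U τ))) (≤-trans (+-mono-≤ c≤ hti) (≤-reflexive (sym (+-assoc 200 (i * 200) _)))) }
          where
          lem : ∀ t t′ f X → t + t′ + f + X ≡ (t′ + f) + (t + X)
          lem = solve-∀
        un1 : ar τ UN i ≢ 0 → ar σ UN i ≡ 1
        un1 nz = ≤-antisym (un≤ i i<n) (n≢0⇒n>0 (λ z → nz (trans (hhi i ≤-refl) z)))
        room₁ : ar τ UN i ≢ 0 → ∀ y → occ (λ j → ar τ QU (i * D + j)) y D ≤ ar τ CO y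
        room₁ nz y = ≤-trans (≤-reflexive (trans (oc≡ tb i<n y) (trans (sym (*-identityˡ _)) (cong (_* oc i y) (sym (trans (hhi i ≤-refl) (un1 nz)))))))
          (≤-trans (sum-≥ (λ v → ar τ UN v * oc v y) n i i<n) (≤-reflexive (sym (hco y))))
        dropˡ : ∀ {t′ υ} → ar τ UN i ≢ 0 → ar τ VI i ≢ 0 → bit (ar τ RA i <ᵇ dd) ≡ 0 → Frame drop-all σ₁ υ → t′ ≤ 200 * suc D →
          (∀ y → ar υ CO y + occ (λ j → ar τ QU (i * D + j)) y D ≡ ar τ CO y) →
          Hit x σ (suc i) (t + (56 + t′) + fc rv ($ rN)) (setR rv (suc i) υ)
        dropˡ {t′} {υ} u≢ v≢ near f t≤ co′ = record
          -- The weight of list `i` drops from 1 to 0; adding `oc i y` on both sides replaces a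
          -- subtraction.
          { hco = λ y → +-cancelʳ-≡ (oc i y) _ _ (trans (trans (cong (ar υ CO y +_) (sym (oc≡ tb i<n y))) (trans (co′ y) (hco y)))
              (trans (sym (+-identityʳ _)) (trans (cong (sum (λ v → ar τ UN v * oc v y) n +_) (cong (_* oc i y) (sym un-i)))
                (trans (sym (sum-upd (λ v → ar τ UN v * oc v y) (λ v → ar υ UN v * oc v y) n i i<n (λ v ne → cong (_* oc v y) (un-o v ne))))
                  (cong (sum (λ v → ar υ UN v * oc v y) n +_) (trans (cong (_* oc i y) (trans (hhi i ≤-refl) (un1 u≢))) (*-identityˡ _)))))))
          ; hlo = below-suc (HitState x σ υ) (λ v l → old v (<⇒≢ l) (hlo v l)) (inj₂ (un1 u≢ , un-i , wit))
          ; hhi = λ v l → trans (un-o v (≢-sym (<⇒≢ l))) (hhi v (<⇒≤ l))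
          ; hti = ≤-trans (≤-reflexive (lem t t′ ((200 * suc D) * U υ)))
              (≤-trans (+-mono-≤ (num {64} {200}) (≤-trans (+-monoʳ-≤ t (≤-trans (+-monoˡ-≤ ((200 * suc D) * U υ) t≤) (≤-reflexive
                (trans (sym (*-suc (200 * suc D) (U υ))) (cong ((200 * suc D) *_) U-suc))))) hti)) (≤-reflexive (sym (+-assoc 200 (i * 200) _)))) }
          where
          lem : ∀ t t′ X → t + (56 + t′) + 8 + X ≡ 64 + (t + (t′ + X))
          lem = solve-∀
          uυ : ∀ v → ar υ UN v ≡ setf (ar τ UN) i 0 v
          uυ v = cong (λ g → g v) (fA f UN)
          un-i : ar υ UN i ≡ 0
          un-i = trans (uυ i) (setf-at (ar τ UN) {i} {i} {0} refl)
          un-o : ∀ v → v ≢ i → ar υ UN v ≡ ar τ UN v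
          un-o v ne = trans (uυ v) (setf-ne (ar τ UN) i 0 v (≢-sym ne))
          U-suc : suc (U υ) ≡ U τ
          U-suc = trans (+-comm 1 (U υ)) (trans (cong (U υ +_) (sym (trans (hhi i ≤-refl) (un1 u≢))))
            (trans (sum-upd (ar τ UN) (ar υ UN) n i i<n un-o) (trans (cong (U τ +_) un-i) (+-identityʳ _))))
          wit : ∃[ ℓ ] (Wk x i ℓ × ℓ ≤ RT i)
          wit with ds i i<n
          ... | inj₁ (z , _) = ⊥-elim (v≢ z)
          ... | inj₂ (_ , e , e≡ , p , _) = e , p , subst₂ _≤_ (trans dd≡ e≡) (Tab.tR tb i) (bit-≥ near)
          old : ∀ v → v ≢ i → HitState x σ τ v → HitState x σ υ v
          old v ne (inj₁ (a , b)) = inj₁ (trans (un-o v ne) a , b)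
          old v ne (inj₂ (a , b , c)) = inj₂ (a , trans (un-o v ne) b , c)

      Pairs : ℕ → Store → Store
      Pairs i τ = setR rt (tp i) (setR rs (sp i) τ)

      pair-ok : ∀ {i τ} → Input τ → i < q → rg τ rv ≡ i → Runs pair-at τ (λ t υ → t ≡ 22 × υ ≡ Pairs i τ)
      pair-ok {i} {τ} I i<q refl = _ , _ , does-▸ (do-rd rs (` 3 ⊕ ` 2 ⊗ $ rM ⊕ ` 2 ⊗ $ rv) l₃) (do-rd rt (` 4 ⊕ ` 2 ⊗ $ rM ⊕ ` 2 ⊗ $ rv) l₄)
          , refl , cong₂ (λ a b → setR rt a (setR rs b τ)) (trans (cong (λ z → lw τ (4 + 2 * z + 2 * i)) eM) (pt i i<q)) (trans (cong (λ z → lw τ (3 + 2 * z + 2 * i)) eM) (ps i i<q))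
        where
        open Input I
        l₄ : 4 + 2 * rg τ rM + 2 * i < β
        l₄ = subst₂ (λ a b → 4 + 2 * a + 2 * i < b) (sym eM) (sym β≡) (≤-trans (≤-reflexive (lem m i)) (+-monoʳ-≤ (3 + 2 * m) (*-monoʳ-≤ 2 i<q)))
          where
          lem : ∀ m i → 5 + 2 * m + 2 * i ≡ 3 + 2 * m + 2 * suc i
          lem = solve-∀
        l₃ : 3 + 2 * rg τ rM + 2 * i < β
        l₃ = <-trans (n<1+n _) l₄

      record Upd (x : ℕ) (σ : Store) (i : ℕ) (τ : Store) : Set where
        field
          good : ∀ j → j < i → Good x (ar τ ES) j
          mono : Mono (ar σ ES) (ar τ ES)
          snd  : Sound (ar τ ES)

      mono-trans : ∀ {E F G} → Mono E F → Mono F G → Mono E G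
      mono-trans f g i nz = let a , b = f i nz ; c , d = g i a in c , ≤-trans d b

      good-mono : ∀ {x E F i} → Mono E F → Good x E i → Good x F i
      good-mono mo g ℓ₁ ℓ₂ p r = let a , b = g ℓ₁ ℓ₂ p r ; c , d = mo _ a in c , ≤-trans d b

      relaxed-mono : ∀ {E E′ i e} → Relaxed E i e E′ → Mono E E′
      relaxed-mono {i = i} R j nz with j ≟ i
      ... | yes refl = Relaxed.here≢ R , Relaxed.mono≤ R nz
      ... | no ne = subst (_≢ 0) (sym (Relaxed.other R j ne)) nz , ≤-reflexive (Relaxed.other R j ne)

      relaxed-sound : ∀ {E E′ i e} → Relaxed E i (suc e) E′ → Wk (sp i) (tp i) e → Sound E → Sound E′
      relaxed-sound {i = i} R p s j j<q with j ≟ i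
      ... | no ne = subst (λ z → z ≡ 0 ⊎ ∃[ e ] (z ≡ suc e × Wk (sp j) (tp j) e)) (sym (Relaxed.other R j ne)) (s j j<q)
      ... | yes refl with Relaxed.which R
      ...   | inj₁ e = subst (λ z → z ≡ 0 ⊎ ∃[ e ] (z ≡ suc e × Wk (sp j) (tp j) e)) (sym e) (s j j<q)
      ...   | inj₂ e = inj₂ (_ , e , p)

      mono-refl : ∀ {E} → Mono E E
      mono-refl i nz = nz , ≤-refl

      upd-body-ok : ∀ {x σ i τ} → i < q → Input τ → rg τ rB ≡ n * D → (∀ v → v < n → Dist τ x v) → rg τ rv ≡ i → Upd x σ i τ →
        Runs upd-body τ (λ t υ → t ≤ 300 × Upd x σ (suc i) (setR rv (suc i) υ))
      upd-body-ok {x} {σ} {i} {τ} i<q I eB ds ei u = pair-ok I i<q ei ⨟ λ { {s} _ (refl , refl) →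
          runs-iff (λ vs → runs-iff (λ vt → relaxing vs vt)
              (λ z → runs-nop (num , skip-at (λ ℓ₁ ℓ₂ _ p → none (tp< i i<q) z p))))
            (λ z → runs-nop (num , skip-at (λ ℓ₁ ℓ₂ p _ → none (sp< i i<q) z p))) }
        where
        open Upd u
        τ₁ = Pairs i τ
        none : ∀ {v ℓ} → v < n → ar τ VI v ≡ 0 → Wk x v ℓ → ⊥
        none {v} {ℓ} l z p with ds v l
        ... | inj₁ (_ , f) = f ℓ p
        ... | inj₂ (nz , _) = nz z
        skip-at : (∀ ℓ₁ ℓ₂ → Wk x (sp i) ℓ₁ → Wk x (tp i) ℓ₂ → ⊥) → Upd x σ (suc i) (setR rv (suc i) τ₁)
        skip-at f = record { good = below-suc (Good x (ar τ ES)) good (λ ℓ₁ ℓ₂ p r → ⊥-elim (f ℓ₁ ℓ₂ p r))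
                           ; mono = mono ; snd = snd }
        D₁ D₂ : ℕ
        D₁ = ar τ QD (rg τ rB + (ar τ VI (sp i) ∸ 1))
        D₂ = ar τ QD (rg τ rB + (ar τ VI (tp i) ∸ 1))
        get : ∀ v → v < n → ar τ VI v ≢ 0 → let d = ar τ QD (rg τ rB + (ar τ VI v ∸ 1)) in Wk x v d × (∀ ℓ → Wk x v ℓ → d ≤ ℓ) × d ≤ n
        get v l nz with ds v l
        ... | inj₁ (z , _) = ⊥-elim (nz z)
        ... | inj₂ (_ , e , e≡ , p , mn , e≤n) = subst (λ d → Wk x v d × (∀ ℓ → Wk x v ℓ → d ≤ ℓ) × d ≤ n)
                (sym (trans (cong (λ z → ar τ QD (z + (ar τ VI v ∸ 1))) eB) e≡)) (p , mn , e≤n)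
        relaxing : ar τ VI (sp i) ≢ 0 → ar τ VI (tp i) ≢ 0 → Runs _ τ₁ (λ t υ → 22 + suc (8 + suc (8 + t)) ≤ 300 × Upd x σ (suc i) (setR rv (suc i) υ))
        relaxing vs vt with get (sp i) (sp< i i<q) vs | get (tp i) (tp< i i<q) vt
        ... | p₁ , mn₁ , n₁ | p₂ , mn₂ , n₂ = blk▸ (re := QD ⟨ $ rB ⊕ (VI ⟨ $ rs ⟩ ⊖ ` 1) ⟩ ⊕ QD ⟨ $ rB ⊕ (VI ⟨ $ rt ⟩ ⊖ ` 1) ⟩ ⊕ ` 1)
            (≤-trans (≤-reflexive (+-comm (D₁ + D₂) 1)) (≤-trans (s≤s (+-mono-≤ n₁ n₂)) nn≤V))
            (post (relax-ok ES rv {setR re (D₁ + D₂ + 1) τ₁} (λ z → contradiction (trans (+-comm 1 (D₁ + D₂)) z) λ ()))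
              λ { {t} {υ} f (t≤ , R) → ≤-trans (+-monoʳ-≤ 82 t≤) num , done {υ} (subst₂ (λ a b → Relaxed (ar τ ES) a b (ar υ ES)) ei (+-comm (D₁ + D₂) 1) R) })
          where
          done : ∀ {υ} → Relaxed (ar τ ES) i (suc (D₁ + D₂)) (ar υ ES) → Upd x σ (suc i) (setR rv (suc i) υ)
          done {υ} R = record
            { good = below-suc (Good x (ar υ ES)) (λ j l → good-mono {x} {ar τ ES} {ar υ ES} {j} (relaxed-mono R) (good j l))
                (λ ℓ₁ ℓ₂ p r → Relaxed.here≢ R , ≤-trans (Relaxed.here≤ R) (s≤s (+-mono-≤ (mn₁ ℓ₁ p) (mn₂ ℓ₂ r))))
            ; mono = mono-trans {ar σ ES} {ar τ ES} {ar υ ES} mono (relaxed-mono R)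
            ; snd = relaxed-sound {ar τ ES} {ar υ ES} {i} R (wk-++ (wk-rev gs p₁) p₂) snd }

      Covered : Store → ℕ → Set
      Covered τ v = ∃[ x ] ∃[ ℓ ] (Wk x v ℓ × ℓ ≤ RT v × (∀ i → i < q → Good x (ar τ ES) i))

      UnState : Store → ℕ → Set
      UnState τ v = (ar τ UN v ≡ 0 × (WholeT v ⊎ (PartT v × Covered τ v))) ⊎ (ar τ UN v ≡ 1 × PartT v)

      record Inv (τ : Store) : Set where
        field
          inp : Input τ
          tab : Tab τ
          eL  : rg τ rL ≡ suc n
          eB  : rg τ rB ≡ n * D
          uns : ∀ v → v < n → UnState τ v
          cok : CountOK τ
          vi0 : ∀ u → ar τ VI u ≡ 0
          snd : Sound (ar τ ES)

      -- `gone` brings the counter of `x` to 0, below every positive threshold. `fewer` is what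
      -- limits the number of picks, and `time` passes on the potential of `Hit`.
      record Picked (x : ℕ) (τ : Store) (t : ℕ) (υ : Store) : Set where
        field
          inv  : Inv υ
          le   : ∀ v → v < n → ar υ UN v ≤ ar τ UN v
          gone : ∀ v → v < n → ar υ UN v * oc v x ≡ 0
          fewer : U υ + ar τ CO x ≤ U τ
          time : t + (200 * suc D) * U υ ≤ 2000 * (1 + n + H + q) + (200 * suc D) * U τ

      inv-set : ∀ x v {τ} → {_ : T (not (x == rN))} → {_ : T (not (x == rM))} → {_ : T (not (x == rQ))} → {_ : T (not (x == rD))} →
        {_ : T (not (x == rL))} → {_ : T (not (x == rB))} → Inv τ → Inv (setR x v τ)
      inv-set x v {τ} {a} {b} {c} {d} {e} {f} I = record
        { inp = input-frame (x := ` 0) {_} {_} {a} {b} {c} {d} F inp ; tab = tab-frame (x := ` 0) F tab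
        ; eL = trans (fR F rL {e}) eL ; eB = trans (fR F rB {f}) eB
        ; uns = uns ; cok = cok ; vi0 = vi0 ; snd = snd }
        where
        open Inv I
        F : Frame (x := ` 0) τ (setR x v τ)
        F = setR-frame {x := ` 0} {x} {v} {τ} (subst T (sym (==-refl x)) tt)

      un≤ : ∀ {τ} → Inv τ → ∀ v → v < n → ar τ UN v ≤ 1
      un≤ I v l with Inv.uns I v l
      ... | inj₁ (e , _) = ≤-trans (≤-reflexive e) z≤n
      ... | inj₂ (e , _) = ≤-reflexive e

      oc≤1 : ∀ {v} → PartT v → v < n → ∀ x → oc v x ≤ 1
      oc≤1 {v} (c≡D , _) l x = sum≤1 (λ j → δ (QT (v * D + j)) x) D (λ j _ → bit≤1 (QT (v * D + j) ≡ᵇ x)) (λ i j a b y y′ →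
        Row.inj (rowT v l) i j (subst (i <_) (sym c≡D) a) (subst (j <_) (sym c≡D) b) (trans (δ≢0 {QT (v * D + i)} {x} y) (sym (δ≢0 {QT (v * D + j)} {x} y′))))

      pick-ok : ∀ {x τ} → x < n → rg τ rX ≡ x → Inv τ → Runs pick τ (Picked x τ)
      pick-ok {x} {τ} x<n ex I = blk▸ (rS := $ rX) tt
        (B.bfs-ok {τ₀} (record { eB = eB ; eL = eL ; eS = ex ; ls = Input.ls I₀ }) vi0 ⨟ λ {tb} {τ₁} f₁ X →
         runs-for rv ($ rN) hit-body (λ i t υ → Hit x τ₁ i t υ) {_} {_} (<⇒≤ n<V) (λ f → trans (fR f rN) (trans (fR f₁ rN) (Input.eN inp)))
           (record { hco = λ y → trans (cong (λ g → g y) (fA f₁ CO)) (trans (cok y) (sum-cong n (λ v _ → cong (λ g → g v * oc v y) (sym (fA f₁ UN)))))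
                   ; hlo = λ _ () ; hhi = λ _ _ → refl ; hti = ≤-refl })
           (λ {i} {t} {υ} i<n f ei h → hit-body-ok {x} {τ₁} {i} {t} {υ} i<n (input-frame hit f (input-frame bfs f₁ I₀)) (tab-frame hit f (tab₁ f₁ X))
              (trans (fR f rB) (trans (fR f₁ rB) eB)) (λ v l → dist-same {τ₁} {υ} {x} {v} (fA f VI) (fA f QD) (dist₁ X v l))
              (λ v l → subst (λ g → g v ≤ 1) (sym (fA f₁ UN)) (un≤ I v l)) ei h) ⨟ λ {th} {τ₂} f₂ hh →
         runs-for′ rv ($ rQ) upd-body {c = 300} (Upd x τ₂) q≤V (λ f → trans (fR f rQ) (trans (fR f₂ rQ) (trans (fR f₁ rQ) (Input.eQ inp))))
           (record { good = λ _ () ; mono = mono-refl ; snd = subst Sound (sym (trans (fA f₂ ES) (fA f₁ ES))) snd })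
           (λ {i} {υ} i<q f ei u → upd-body-ok {x} {τ₂} {i} {υ} i<q (input-frame upd f (input-frame hit f₂ (input-frame bfs f₁ I₀)))
              (trans (fR f rB) (trans (fR f₂ rB) (trans (fR f₁ rB) eB)))
              (λ v l → dist-same {τ₁} {υ} {x} {v} (trans (fA f VI) (fA f₂ VI)) (trans (fA f QD) (fA f₂ QD)) (dist₁ X v l)) ei u) ⨟ λ {tu} {τ₃} f₃ (tu≤ , uu) →
         post (clear-ok {τ₃} {n * D} (λ u → case Search.Queue.Qvis (B.Explored.queue X) u of λ
           { (inj₁ z) → inj₁ (trans (cong (λ g → g u) (trans (fA f₃ VI) (fA f₂ VI))) z)
           ; (inj₂ (j , a , b , c)) → inj₂ (j , subst (j <_) (sym (trans (fR f₃ rZ) (fR f₂ rZ))) a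
                 , trans (cong (λ g → g u) (trans (fA f₃ VI) (fA f₂ VI))) b , trans (cong (λ g → g (n * D + j)) (trans (fA f₃ QU) (fA f₂ QU))) c) })
           (subst (_≤ V) (sym (trans (fR f₃ rZ) (fR f₂ rZ))) (≤-trans (Search.Queue.s≤n (B.Explored.queue X)) (<⇒≤ n<V)))
           (trans (fR f₃ rB) (trans (fR f₂ rB) (trans (fR f₁ rB) eB))))
           λ {tc} {υ} f₄ c → fin {tb} {τ₁} {th} {τ₂} {tu} {τ₃} {tc} {υ} f₁ X f₂ hh f₃ tu≤ uu f₄ c)
        where
        open Inv I
        module B = At (n * D) (suc n) x (s≤s (≤-trans (s≤s z≤n) x<n)) x<n
        τ₀ = setR rS (rg τ rX) τ
        I₀ : Input τ₀
        I₀ = Inv.inp (inv-set rS (rg τ rX) I)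
        tab₁ : ∀ {tb τ₁} → Frame bfs τ₀ τ₁ → B.Explored τ₀ tb τ₁ → Tab τ₁
        tab₁ f₁ X = record
          { tQ = λ a l → trans (B.bQ (B.Explored.below X) a l) (Tab.tQ tab a l) ; tD = λ a l → trans (B.bD (B.Explored.below X) a l) (Tab.tD tab a l)
          ; tC = λ v → trans (cong (λ g → g v) (fA f₁ CN)) (Tab.tC tab v) ; tR = λ v → trans (cong (λ g → g v) (fA f₁ RA)) (Tab.tR tab v) }
        dist₁ : ∀ {tb τ₁} → B.Explored τ₀ tb τ₁ → ∀ v → v < n → Dist τ₁ x v
        dist₁ {tb} {τ₁} X v l with B.Explored.outcome X
        ... | inj₂ (e , _) = ⊥-elim (<⇒≢ (s≤s (Search.Queue.s≤n (B.Explored.queue X))) e)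
        ... | inj₁ (h , _) with Search.Queue.Qvis (B.Explored.queue X) v
        ...   | inj₁ z = inj₁ (z , λ ℓ p → let j , j<s , qj , _ = h p in
                  contradiction (trans (sym (Search.Queue.visQ (B.Explored.queue X) j j<s)) (trans (cong (ar τ₁ VI) qj) z)) λ ())
        ...   | inj₂ (j , j<s , vj , qj) = inj₂ ((λ z → contradiction (trans (sym vj) z) λ ()) , B.df τ₁ j , cong (λ z → ar τ₁ QD (n * D + (z ∸ 1))) vj
                  , subst (λ z → Wk x z (B.df τ₁ j)) qj (wk j j<s)
                  , (λ ℓ p → let j′ , l′ , q′ , d′ = h p in subst (λ z → B.df τ₁ z ≤ ℓ) (Q-inj j′ j l′ j<s (trans q′ (sym qj))) d′)
                  , ≤-trans (d≤ j j<s) (≤-trans (<⇒≤ j<s) s≤n))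
          where open Search.Queue (B.Explored.queue X)
        fin : ∀ {tb τ₁ th τ₂ tu τ₃ tc υ} → Frame bfs τ₀ τ₁ → B.Explored τ₀ tb τ₁ → Frame hit τ₁ τ₂ →
          ∃[ t₀ ] (Hit x τ₁ n t₀ τ₂ × th ≤ t₀ + fc rv ($ rN)) → Frame upd τ₂ τ₃ → tu ≤ q * (300 + fc rv ($ rQ)) + fc rv ($ rQ) → Upd x τ₂ q τ₃ →
          Frame clear τ₃ υ → tc ≤ K * suc (rg τ₃ rZ) × (∀ u → ar υ VI u ≡ 0) → Picked x τ (2 + (tb + (th + (tu + tc)))) υ
        fin {tb} {τ₁} {th} {τ₂} {tu} {τ₃} {tc} {υ} f₁ X f₂ (t₀ , h , th≤) f₃ tu≤ u f₄ (tc≤ , v0) = record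
          { inv = record
            { inp = input-frame clear f₄ (input-frame upd f₃ (input-frame hit f₂ (input-frame bfs f₁ I₀)))
            ; tab = tab-frame clear f₄ (tab-frame upd f₃ (tab-frame hit f₂ (tab₁ f₁ X)))
            ; eL = trans (fR f₄ rL) (trans (fR f₃ rL) (trans (fR f₂ rL) (trans (fR f₁ rL) eL)))
            ; eB = trans (fR f₄ rB) (trans (fR f₃ rB) (trans (fR f₂ rB) (trans (fR f₁ rB) eB)))
            ; uns = uns′
            ; cok = λ y → trans (cong (λ g → g y) (trans (fA f₄ CO) (fA f₃ CO))) (trans (hco y) (sum-cong n (λ v _ → cong (λ g → g v * oc v y) (sym u₂))))
            ; vi0 = v0
            ; snd = subst Sound (sym (fA f₄ ES)) (Upd.snd u) }
          ; le = le′ ; gone = gone′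
          ; fewer = ≤-trans (≤-reflexive (trans (cong (U υ +_) (cok x)) (sym (sum-+ (ar υ UN) (λ v → ar τ UN v * oc v x) n)))) (sum-mono n less′)
          ; time = tim }
          where
          open Hit h
          u₂ : ar υ UN ≡ ar τ₂ UN
          u₂ = trans (fA f₄ UN) (fA f₃ UN)
          u₁ : ar τ₁ UN ≡ ar τ UN
          u₁ = fA f₁ UN
          mo : Mono (ar τ ES) (ar υ ES)
          mo = subst₂ Mono (trans (fA f₂ ES) (fA f₁ ES)) (sym (fA f₄ ES)) (Upd.mono u)
          hs : ∀ v → v < n → (ar υ UN v ≡ ar τ UN v × (ar τ UN v ≢ 0 → ∀ ℓ → Wk x v ℓ → RT v < ℓ))
            ⊎ (ar τ UN v ≡ 1 × ar υ UN v ≡ 0 × ∃[ ℓ ] (Wk x v ℓ × ℓ ≤ RT v))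
          hs v l = subst₂ (λ f g → (f v ≡ g v × (g v ≢ 0 → ∀ ℓ → Wk x v ℓ → RT v < ℓ)) ⊎ (g v ≡ 1 × f v ≡ 0 × ∃[ ℓ ] (Wk x v ℓ × ℓ ≤ RT v)))
            (sym u₂) u₁ (hlo v l)
          covm : ∀ v → Covered τ v → Covered υ v
          covm v (y , ℓ , p , le , g) = y , ℓ , p , le , λ i l → good-mono {y} {ar τ ES} {ar υ ES} {i} mo (g i l)
          newG : ∀ i → i < q → Good x (ar υ ES) i
          newG i l = subst (λ E → Good x E i) (sym (fA f₄ ES)) (Upd.good u i l)
          uns′ : ∀ v → v < n → UnState υ v
          uns′ v l with hs v l | uns v l
          ... | inj₁ (e , _) | inj₁ (z , inj₁ W) = inj₁ (trans e z , inj₁ W)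
          ... | inj₁ (e , _) | inj₁ (z , inj₂ (P , C)) = inj₁ (trans e z , inj₂ (P , covm v C))
          ... | inj₁ (e , _) | inj₂ (o , P) = inj₂ (trans e o , P)
          ... | inj₂ (o , z , ℓ , p , le) | inj₂ (_ , P) = inj₁ (z , inj₂ (P , x , ℓ , p , le , newG))
          ... | inj₂ (o , z , ℓ , p , le) | inj₁ (z′ , _) = contradiction (trans (sym z′) o) λ ()
          le′ : ∀ v → v < n → ar υ UN v ≤ ar τ UN v
          le′ v l with hs v l
          ... | inj₁ (e , _) = ≤-reflexive e
          ... | inj₂ (_ , z , _) = ≤-trans (≤-reflexive z) z≤n
          -- An entry of a truncated list lies within `RT v`, so a list which the pick fails to hit
          -- cannot contain it.
          oc0 : ∀ v → v < n → PartT v → (∀ ℓ → Wk x v ℓ → RT v < ℓ) → oc v x ≡ 0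
          oc0 v l (c≡D , r , er , _ , d≤) far with oc v x ≟ 0
          ... | yes z = z
          ... | no nz with sum≢0 (λ j → δ (QT (v * D + j)) x) D nz
          ...   | j , j<D , nz′ = ⊥-elim (<⇒≱ (far _ (wk-rev gs (subst (λ z → Wk v z _) (δ≢0 {QT (v * D + j)} {x} nz′) (Row.rwk (rowT v l) j j<c)))) (≤-trans (d≤ j j<c) (≤-reflexive (sym er))))
            where
            j<c : j < CT v
            j<c = subst (j <_) (sym c≡D) j<D
          gone′ : ∀ v → v < n → ar υ UN v * oc v x ≡ 0
          gone′ v l with hs v l | uns v l
          ... | inj₂ (_ , z , _) | _ = cong (_* oc v x) z
          ... | inj₁ (e , _) | inj₁ (z , _) = cong (_* oc v x) (trans e z)
          ... | inj₁ (e , far) | inj₂ (o , P) = trans (cong (ar υ UN v *_) (oc0 v l P (far (λ z → contradiction (trans (sym z) o) λ ())))) (*-zeroʳ (ar υ UN v))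
          less′ : ∀ v → v < n → ar υ UN v + ar τ UN v * oc v x ≤ ar τ UN v
          less′ v l with hs v l | uns v l
          ... | inj₁ (e , _) | _ = ≤-reflexive (trans (cong₂ _+_ e (trans (cong (_* oc v x) (sym e)) (gone′ v l))) (+-identityʳ _))
          ... | inj₂ (o , z , _) | inj₁ (z′ , _) = contradiction (trans (sym z′) o) λ ()
          ... | inj₂ (o , z , _) | inj₂ (_ , P) = ≤-trans (≤-reflexive (cong₂ _+_ z refl)) (≤-trans (*-monoʳ-≤ (ar τ UN v)
                (oc≤1 P l x)) (≤-reflexive (*-identityʳ _)))
          M : ℕ
          M = 1 + n + H + q
          tim : 2 + (tb + (th + (tu + tc))) + (200 * suc D) * U υ ≤ 2000 * M + (200 * suc D) * U τ
          tim = ≤-trans (≤-reflexive (lem₁ tb th tu tc ((200 * suc D) * U υ))) (≤-trans (+-mono-≤ (addB M {2 + tb} {tu + tc} {500} {600} tb′ (addB M {tu} {tc} {400} {200} tu′ tc′)) th′)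
            (≤-trans (≤-reflexive (sym (+-assoc (1100 * M) (300 * M) _))) (+-monoˡ-≤ ((200 * suc D) * U τ) (≤-trans (≤-reflexive (sym (*-distribʳ-+ M 1100 300))) (*-monoˡ-≤ M (num {1400} {2000}))))))
            where
            lem₁ : ∀ tb th tu tc X → 2 + (tb + (th + (tu + tc))) + X ≡ ((2 + tb) + (tu + tc)) + (th + X)
            lem₁ = solve-∀
            M≥1 : 1 ≤ M
            M≥1 = s≤s z≤n
            nH≤ : n + H ≤ M
            nH≤ = ≤-trans (n≤1+n _) (m≤m+n (suc (n + H)) q)
            n≤M : n ≤ M
            n≤M = ≤-trans (m≤m+n n H) nH≤
            q≤M : q ≤ M
            q≤M = m≤n+m q _
            tb′ : 2 + tb ≤ 500 * M
            tb′ = ≤-trans (+-monoʳ-≤ 2 (B.Explored.time-full X)) (≤-trans (addB M {202} {200 * (n + H)} {300} {200} (constB M (num {202} {300}) M≥1) (*-monoʳ-≤ 200 nH≤)) ≤-refl)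
            tu′ : tu ≤ 400 * M
            tu′ = ≤-trans tu≤ (addB M {q * 308} {8} {308} {92} (≤-trans (≤-reflexive (*-comm q 308)) (*-monoʳ-≤ 308 q≤M)) (constB M (num {8} {92}) M≥1))
            tc′ : tc ≤ 200 * M
            tc′ = ≤-trans tc≤ (*-monoʳ-≤ 200 (s≤s (≤-trans (subst (_≤ n) (sym (trans (fR f₃ rZ) (fR f₂ rZ))) (Search.Queue.s≤n (B.Explored.queue X))) (≤-trans (m≤m+n n H) (m≤m+n (n + H) q)))))
            th′ : th + (200 * suc D) * U υ ≤ 300 * M + (200 * suc D) * U τ
            th′ = ≤-trans (+-monoˡ-≤ _ th≤) (≤-trans (≤-reflexive (trans (lem₂ t₀ 8 ((200 * suc D) * U υ)) (cong (λ f → 8 + (t₀ + (200 * suc D) * sum f n)) u₂)))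
              (≤-trans (+-monoʳ-≤ 8 hti) (≤-trans (≤-reflexive (trans (sym (+-assoc 8 (n * 200) _)) (cong (λ f → 8 + n * 200 + (200 * suc D) * sum f n) u₁)))
                (+-monoˡ-≤ _ (addB M {8} {n * 200} {100} {200} (constB M (num {8} {100}) M≥1) (≤-trans (≤-reflexive (*-comm n 200)) (*-monoʳ-≤ 200 n≤M)))))))
              where
              lem₂ : ∀ t c X → t + c + X ≡ c + (t + X)
              lem₂ = solve-∀

      -- A truncated list has `D ≥ 2` distinct entries, so even its own vertex `v` is joined to
      -- another one by a walk and cannot be isolated.
      part-deg : ∀ {v x} → v < n → PartT v → oc v x ≢ 0 → 1 ≤ deg x
      part-deg {v} {x} l (c≡D , _) nz with sum≢0 (λ j → δ (QT (v * D + j)) x) D nz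
      ... | j , j<D , nz′ with v ≟ x
      ...   | no ne = proj₁ (deg≢0 gs (subst (λ z → Wk v z _) (δ≢0 {QT (v * D + j)} {x} nz′) (Row.rwk (rowT v l) j (subst (j <_) (sym c≡D) j<D))) ne)
      ...   | yes refl = other (j ≟ 0)
        where
        far : ∀ j′ → j′ < D → j ≢ j′ → 1 ≤ deg v
        far j′ j′<D ne = proj₂ (deg≢0 gs (Row.rwk (rowT v l) j′ (subst (j′ <_) (sym c≡D) j′<D))
          (λ e → ne (Row.inj (rowT v l) j j′ (subst (j <_) (sym c≡D) j<D) (subst (j′ <_) (sym c≡D) j′<D) (trans (δ≢0 {QT (v * D + j)} {v} nz′) e))))
        other : Dec (j ≡ 0) → 1 ≤ deg v
        other (yes refl) = far 1 D≥2 λ ()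
        other (no ne) = far 0 D≥1 ne

      -- Double counting: each list still to be hit has `D` entries, and every entry contributes to
      -- one counter.
      U*D≤ : ∀ {τ} → Inv τ → U τ * D ≤ sum (ar τ CO) n
      U*D≤ {τ} I = ≤-trans (≤-reflexive (sym (sum-*ʳ (ar τ UN) D n))) (≤-trans (sum-mono n row≤)
          (≤-reflexive (trans (sum-swap (λ v x → ar τ UN v * oc v x) n n) (sum-cong n (λ x _ → sym (Inv.cok I x))))))
        where
        row≤ : ∀ v → v < n → ar τ UN v * D ≤ sum (λ x → ar τ UN v * oc v x) n
        row≤ v l with Inv.uns I v l
        ... | inj₁ (z , _) rewrite z = z≤n
        ... | inj₂ (o , (c≡D , _)) rewrite o = ≤-trans (≤-reflexive (trans (+-identityʳ D) (trans (sym (*-identityʳ D)) (sym (sum-const 1 D)))))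
            (≤-trans (sum-mono D (λ j jl → ≤-trans (≤-reflexive (sym (δ-refl (QT (v * D + j)))))
               (sum-≥ (λ x → δ (QT (v * D + j)) x) n (QT (v * D + j)) (Row.Q<n (rowT v l) j (subst (j <_) (sym c≡D) jl)))))
            (≤-reflexive (trans (sum-swap (λ j x → δ (QT (v * D + j)) x) D n) (sum-cong n (λ x _ → sym (+-identityʳ _))))))

      U-n : ∀ {τ c} → Inv τ → (∀ x → x < n → ar τ CO x ≤ c) → U τ * D ≤ c * n
      U-n {c = c} I h = ≤-trans (U*D≤ I) (≤-trans (sum-mono n h) (≤-reflexive (trans (sum-const c n) (*-comm n c))))

      -- A nonzero counter belongs to a vertex of positive degree, so it is at most `deg x * c`, and
      -- the degrees add up to at most `H`.
      U-H : ∀ {τ c} → Inv τ → (∀ x → x < n → ar τ CO x ≤ c) → U τ * D ≤ c * H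
      U-H {τ} {c} I h = ≤-trans (U*D≤ I) (≤-trans (sum-mono n pt′) (≤-trans (≤-reflexive (trans (sum-*ʳ deg c n) (*-comm (sum deg n) c))) (*-monoʳ-≤ c (sum-deg gs))))
        where
        pt′ : ∀ x → x < n → ar τ CO x ≤ deg x * c
        pt′ x l with ar τ CO x ≟ 0
        ... | yes z = ≤-trans (≤-reflexive z) z≤n
        ... | no nz with sum≢0 (λ v → ar τ UN v * oc v x) n (λ z → nz (trans (Inv.cok I x) z))
        ...   | v , v<n , ne with Inv.uns I v v<n
        ...     | inj₁ (z , _) = ⊥-elim (ne (cong (_* oc v x) z))
        ...     | inj₂ (o , P) = ≤-trans (h x l) (≤-trans (≤-reflexive (sym (*-identityˡ c))) (*-monoˡ-≤ c (part-deg {v} {x} v<n P (λ z → ne (trans (cong (ar τ UN v *_) z) (*-zeroʳ (ar τ UN v)))))))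

      X : ℕ
      X = 200 * suc D

      M : ℕ
      M = 1 + n + H + q

      -- Counters only decrease, which preserves `low` for vertices already passed; each of the `p`
      -- picks lowers `U` by at least `T₀`, which gives `pU`.
      record Ph (T₀ : ℕ) (σ : Store) (i t : ℕ) (τ : Store) : Set where
        field
          inv : Inv τ
          low : ∀ y → y < i → ar τ CO y < T₀
          p   : ℕ
          pU  : p * T₀ + U τ ≤ U σ
          tt′ : t + X * U τ ≤ i * 40 + (p * (2000 * M) + X * U σ)

      -- The p picks satisfy p T₀ ≤ U σ, and U σ D ≤ Σ CO ≤ 2 T₀ N for N = n and N = H.
      phase-ok : ∀ {T₀ σ} → 1 ≤ T₀ → rg σ rT ≡ T₀ → Inv σ → (∀ x → x < n → ar σ CO x ≤ 2 * T₀) →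
        Runs phase σ (λ t υ → Inv υ × (∀ x → x < n → ar υ CO x < T₀) × t + X * U υ ≤ 40 * suc n + 2000 * Y + X * U σ)
      phase-ok {T₀} {σ} T≥1 eT I c≤ = post (runs-for rX ($ rN) (iff (CO ⟨ $ rX ⟩ ≺ $ rT) nop pick) {σ} {n} (Ph T₀ σ) {_} {_} (<⇒≤ n<V)
          (λ f → trans (fR f rN) (Input.eN (Inv.inp I)))
          (record { inv = inv-set rX 0 I ; low = λ _ () ; p = 0 ; pU = ≤-refl ; tt′ = ≤-refl })
          (λ {i} {t} {τ} i<n f ei ph → body {i} {t} {τ} i<n (trans (fR f rT) eT) ei ph))
        λ { {t} {υ} f (t₀ , ph , t≤) → Ph.inv ph , Ph.low ph , end {t} {t₀} {υ} ph t≤ }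
        where
        body : ∀ {i t τ} → i < n → rg τ rT ≡ T₀ → rg τ rX ≡ i → Ph T₀ σ i t τ →
          Runs (iff (CO ⟨ $ rX ⟩ ≺ $ rT) nop pick) τ (λ t′ υ → Ph T₀ σ (suc i) (t + t′ + fc rX ($ rN)) (setR rX (suc i) υ))
        body {i} {t} {τ} i<n eT′ ei ph = runs-iff
            (λ l → runs-nop (record { inv = inv-set rX (suc i) inv
              ; low = below-suc (λ y → ar τ CO y < T₀) low (subst₂ (λ a b → ar τ CO a < b) ei eT′ (bit-< l))
              ; p = p ; pU = pU
              ; tt′ = ≤-trans (≤-reflexive (lem₁ t 12 8 (X * U τ))) (≤-trans (+-mono-≤ (num {20} {40}) tt′) (≤-reflexive (sym (+-assoc 40 (i * 40) _)))) }))
            (λ ge → post (pick-ok {i} {τ} i<n ei inv) λ { {t′} {υ} f P → picked {t′} {υ} (subst₂ (λ a b → b ≤ ar τ CO a) ei eT′ (bit-≥ ge)) P })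
          where
          open Ph ph
          lem₁ : ∀ t a b X → t + a + b + X ≡ (a + b) + (t + X)
          lem₁ = solve-∀
          picked : ∀ {t′ υ} → T₀ ≤ ar τ CO i → Picked i τ t′ υ → Ph T₀ σ (suc i) (t + suc (cst (CO ⟨ $ rX ⟩ ≺ $ rT) + t′) + fc rX ($ rN)) (setR rX (suc i) υ)
          picked {t′} {υ} ge P = record
            { inv = inv-set rX (suc i) (Picked.inv P)
            ; low = below-suc (λ y → ar υ CO y < T₀) (λ y l → ≤-<-trans (co≤ y) (low y l)) (subst (_< T₀) (sym co0) T≥1)
            ; p = suc p
            ; pU = ≤-trans (≤-reflexive (lem₂ T₀ (p * T₀) (U υ))) (≤-trans (+-monoʳ-≤ (p * T₀) (≤-trans (+-monoʳ-≤ (U υ) ge) (Picked.fewer P))) pU)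
            ; tt′ = ≤-trans (≤-reflexive (lem₃ t t′ (X * U υ))) (≤-trans (+-monoʳ-≤ (19 + t) (Picked.time P)) (≤-trans (≤-reflexive (lem₄ t (2000 * M) (X * U τ)))
                 (≤-trans (+-monoʳ-≤ (19 + 2000 * M) tt′) (≤-trans (≤-reflexive (lem₅ (2000 * M) i p (X * U σ))) (+-monoˡ-≤ _ (+-monoˡ-≤ (i * 40) (num {19} {40}))))))) }
            where
            co≤ : ∀ y → ar υ CO y ≤ ar τ CO y
            co≤ y = subst₂ _≤_ (sym (Inv.cok (Picked.inv P) y)) (sym (Inv.cok inv y)) (sum-mono n (λ v l → *-monoˡ-≤ (oc v y) (Picked.le P v l)))
            co0 : ar υ CO i ≡ 0
            co0 = trans (Inv.cok (Picked.inv P) i) (sum-zero n (Picked.gone P))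
            lem₂ : ∀ T a u → T + a + u ≡ a + (u + T)
            lem₂ = solve-∀
            lem₃ : ∀ t t′ X → t + (11 + t′) + 8 + X ≡ 19 + t + (t′ + X)
            lem₃ = solve-∀
            lem₄ : ∀ t a x → 19 + t + (a + x) ≡ 19 + a + (t + x)
            lem₄ = solve-∀
            lem₅ : ∀ a i p x → 19 + a + (i * 40 + (p * a + x)) ≡ 19 + i * 40 + (suc p * a + x)
            lem₅ = solve-∀
        end : ∀ {t t₀ υ} → Ph T₀ σ n t₀ υ → t ≤ t₀ + 8 → t + X * U υ ≤ 40 * suc n + 2000 * Y + X * U σ
        end {t} {t₀} {υ} ph t≤ = ≤-trans (+-monoˡ-≤ _ t≤) (≤-trans (≤-reflexive (lem₁ t₀ 8 (X * U υ))) (≤-trans (+-monoʳ-≤ 8 tt′) (≤-trans (≤-reflexive (lem₂ n (p * (2000 * M)) (X * U σ)))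
            (+-monoˡ-≤ (X * U σ) (+-mono-≤ (≤-trans (+-monoˡ-≤ (40 * n) (num {8} {40})) (≤-reflexive (sym (*-suc 40 n)))) pY)))))
          where
          open Ph ph
          lem₁ : ∀ t a x → t + a + x ≡ a + (t + x)
          lem₁ = solve-∀
          lem₂ : ∀ n a x → 8 + (n * 40 + (a + x)) ≡ 8 + 40 * n + a + x
          lem₂ = solve-∀
          lem₃ : ∀ p D T → p * D * T ≡ p * T * D
          lem₃ = solve-∀
          lem₄ : ∀ T N → 2 * T * N ≡ 2 * N * T
          lem₄ = solve-∀
          pD : ∀ N → U σ * D ≤ 2 * T₀ * N → p * D ≤ 2 * N
          pD N h = *-cancelʳ-≤ (p * D) (2 * N) T₀ {{>-nonZero T≥1}} (≤-trans (≤-reflexive (lem₃ p D T₀)) (≤-trans (*-monoˡ-≤ D (≤-trans (m≤m+n (p * T₀) (U υ)) pU)) (≤-trans h (≤-reflexive (lem₄ T₀ N)))))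
          pY : p * (2000 * M) ≤ 2000 * Y
          pY = ≤-trans (≤-reflexive (trans (sym (*-assoc p 2000 M)) (trans (cong (_* M) (*-comm p 2000)) (*-assoc 2000 p M))))
            (*-monoʳ-≤ 2000 (picks≤ p (pD n (U-n I c≤)) (pD H (U-H I c≤))))

      -- `tl` combines two potentials: the lists still to be hit, and the rounds still to come at
      -- this threshold and below.
      record Lp (σ : Store) (T₀ t : ℕ) (τ : Store) : Set where
        field
          inv : Inv τ
          eT  : rg τ rT ≡ T₀
          c≤  : ∀ x → x < n → ar τ CO x ≤ 2 * T₀
          tl  : t + X * U τ + halvings T₀ * (60 * suc n + 2000 * Y) ≤ halvings n * (60 * suc n + 2000 * Y) + X * U σ

      hitting-ok : ∀ {σ} → Input σ → Tab σ → (∀ v → v < n → UnState σ v) → CountOK σ → (∀ u → ar σ VI u ≡ 0) → Sound (ar σ ES) →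
        Runs hitting σ (λ t τ → Inv τ × (∀ v → v < n → ar τ UN v ≡ 0) × t ≤ 20 + (halvings n * (60 * suc n + 2000 * Y) + X * n))
      hitting-ok {σ} I tb us co v0 sd = blk▸ (rL := $ rN ⊕ ` 1) n+1≤V (blk▸ (rB := $ rN ⊗ $ rD) (subst₂ (λ a b → a * b ≤ V) (sym (Input.eN I)) (sym (Input.eD I)) nD≤V)
        (blk▸ (rT := $ rN) tt (post (runs-wh ($ rT) (phase ▸ rT := $ rT ⊘ ` 2) {σ₀} {n} (Lp σ₀) (λ {v} {t} {τ} f l nz → body {v} {t} {τ} l nz)
          (record { inv = inv₀ ; eT = Input.eN I ; c≤ = λ x l → ≤-trans (co≤n x) (m≤m+n n _) ; tl = ≤-reflexive (+-comm (X * U σ₀) _) }))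
        λ { {t} {τ} f (T₀ , t₀ , l , z , refl) → Lp.inv l , un0 {τ} (Lp.inv l) (λ x x<n → n≤0⇒n≡0 (≤-trans (Lp.c≤ l x x<n) (≤-reflexive (cong (2 *_) (trans (sym (Lp.eT l)) z)))))
              , ≤-trans (≤-trans (≤-reflexive (lem t₀)) (+-monoʳ-≤ 12 (≤-trans (m≤m+n t₀ (X * U τ)) (≤-trans (m≤m+n _ _) (≤-trans (Lp.tl l) (+-monoʳ-≤ (halvings n * (60 * suc n + 2000 * Y)) (*-monoʳ-≤ X U≤n))))))) (+-monoˡ-≤ _ (num {12} {20})) })))
        where
        lem : ∀ t → 4 + (4 + (2 + (t + 2))) ≡ 12 + t
        lem = solve-∀
        n+1≤V : rg σ rN + 1 ≤ V
        n+1≤V = subst (λ z → z + 1 ≤ V) (sym (Input.eN I)) (subst (_≤ V) (+-comm 1 n) n<V)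
        σ₁ = setR rL (rg σ rN + 1) σ
        σ₂ = setR rB (rg σ rN * rg σ rD) σ₁
        σ₀ = setR rT (rg σ rN) σ₂
        inv₀ : Inv σ₀
        inv₀ = record
          { inp = record { eN = eN ; eM = eM ; eQ = eQ ; eD = eD ; ls = record { hd = Lists.hd ls ; nx = Lists.nx ls ; tg = Lists.tg ls } ; ps = ps ; pt = pt }
          ; tab = record { tQ = Tab.tQ tb ; tD = Tab.tD tb ; tC = Tab.tC tb ; tR = Tab.tR tb }
          ; eL = trans (cong (_+ 1) eN) (+-comm n 1) ; eB = cong₂ _*_ eN eD ; uns = us ; cok = co ; vi0 = v0 ; snd = sd }
          where open Input I
        U≤n : U σ₀ ≤ n
        U≤n = ≤-trans (sum-mono n (un≤ inv₀)) (≤-reflexive (trans (sum-const 1 n) (*-identityʳ n)))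
        co≤n : ∀ x → ar σ₀ CO x ≤ n
        co≤n x = ≤-trans (≤-reflexive (co x)) (≤-trans (sum-mono n one) U≤n)
          where
          one : ∀ v → v < n → ar σ UN v * oc v x ≤ ar σ UN v
          one v l with us v l
          ... | inj₁ (z , _) rewrite z = z≤n
          ... | inj₂ (o , P) = ≤-trans (*-monoʳ-≤ (ar σ UN v) (oc≤1 P l x)) (≤-reflexive (*-identityʳ _))
        -- At threshold 0 all counters vanish, and by `U*D≤` with `D ≥ 1` no list is left.
        un0 : ∀ {τ} → Inv τ → (∀ x → x < n → ar τ CO x ≡ 0) → ∀ v → v < n → ar τ UN v ≡ 0
        un0 {τ} J z v l = n≤0⇒n≡0 (≤-trans (sum-≥ (ar τ UN) n v l) (*-cancelʳ-≤ (U τ) 0 D {{>-nonZero D≥1}} (≤-trans (U*D≤ J) (≤-reflexive (sum-zero n z)))))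
        body : ∀ {v t τ} → Lp σ₀ v t τ → ⟪ $ rT ⟫ τ ≢ 0 → Runs (phase ▸ rT := $ rT ⊘ ` 2) τ (λ t′ υ → ∃[ v′ ] (v′ < v × Lp σ₀ v′ (2 + (t + t′)) υ))
        body {v} {t} {τ} l nz = phase-ok {v} {τ} v≥1 eT inv c≤ ⨟ λ {t′} {υ} f (J , lo , tm) →
            block (rT := $ rT ⊘ ` 2) tt (v / 2 , m/n<m v 2 {{≢-nonZero v≢}} (s≤s (s≤s z≤n)) , record
              { inv = inv-set rT (rg υ rT / 2) J ; eT = cong (_/ 2) (trans (fR f rT) eT)
              ; c≤ = λ x x<n → ≤-trans (<⇒≤pred (lo x x<n)) (pred≤ (ar υ CO x) (lo x x<n))
              ; tl = fin t′ υ tm })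
          where
          open Lp l
          v≢ : v ≢ 0
          v≢ z = nz (trans eT z)
          v≥1 : 1 ≤ v
          v≥1 = n≢0⇒n>0 v≢
          Z = 60 * suc n + 2000 * Y
          -- Halving an odd threshold loses 1, which is made up for by the counters being strictly
          -- below `v`.
          pred≤ : ∀ c → c < v → v ∸ 1 ≤ 2 * (v / 2)
          pred≤ c _ = ≤-trans (∸-monoˡ-≤ 1 (≤-trans (≤-reflexive (m≡m%n+[m/n]*n v 2)) (+-monoˡ-≤ (v / 2 * 2) (s≤s⁻¹ (m%n<n v 2))))) (≤-reflexive (*-comm (v / 2) 2))
          fin : ∀ t′ υ → t′ + X * U υ ≤ 40 * suc n + 2000 * Y + X * U τ → 2 + (t + (t′ + 4)) + X * U υ + halvings (v / 2) * Z ≤ halvings n * Z + X * U σ₀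
          fin t′ υ tm = ≤-trans (≤-reflexive (lem₁ t t′ (X * U υ) (halvings (v / 2) * Z))) (≤-trans (+-monoʳ-≤ (6 + t + halvings (v / 2) * Z) tm)
            (≤-trans (≤-reflexive (lem₂ t (halvings (v / 2) * Z) (40 * suc n) (2000 * Y) (X * U τ))) (≤-trans (+-monoʳ-≤ (t + X * U τ) (≤-trans
              (+-monoˡ-≤ (halvings (v / 2) * Z) (+-monoˡ-≤ (2000 * Y) (six n))) (*-monoˡ-≤ Z (halvings-half v v≢)))) tl)))
            where
            lem₁ : ∀ t t′ a h → 2 + (t + (t′ + 4)) + a + h ≡ 6 + t + h + (t′ + a)
            lem₁ = solve-∀
            lem₂ : ∀ t h a b c → 6 + t + h + (a + b + c) ≡ t + c + (6 + a + b + h)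
            lem₂ = solve-∀
            six : ∀ n → 6 + 40 * suc n ≤ 60 * suc n
            six n = ≤-trans (+-monoˡ-≤ (40 * suc n) (constB (suc n) {20} {6} num (s≤s z≤n))) (≤-reflexive (sym (*-distribʳ-+ (suc n) 20 40)))

      -- Hop sequences and queries

      digits : ℕ → ℕ → ℕ
      digits c zero = c
      digits c (suc j) = ⟦ div ⟧ (digits c j) D

      entry : ℕ → ℕ → ℕ
      entry c v = v * D + ⟦ mod ⟧ (⟦ mod ⟧ c D) (CT v)

      vert dst : ℕ → ℕ → ℕ → ℕ
      vert c s zero = s
      vert c s (suc j) = QT (entry (digits c j) (vert c s j))
      dst c s zero = 0
      dst c s (suc j) = dst c s j + DT (entry (digits c j) (vert c s j))

      data Hops : ℕ → ℕ → ℕ → ℕ → Set where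
        stop : ∀ {s} → Hops 0 s s 0
        go   : ∀ {j s v d} i → i < CT s → Hops j (QT (s * D + i)) v d → Hops (suc j) s v (DT (s * D + i) + d)

      -- The loop appends hops at the end, whereas `Hops` is built from its start; this and the next
      -- two lemmas split off the first hop.
      digits-shift : ∀ c j → digits c (suc j) ≡ digits (⟦ div ⟧ c D) j
      digits-shift c zero = refl
      digits-shift c (suc j) = cong (λ z → ⟦ div ⟧ z D) (digits-shift c j)

      vert-shift : ∀ c s j → vert c s (suc j) ≡ vert (⟦ div ⟧ c D) (vert c s 1) j
      vert-shift c s zero = refl
      vert-shift c s (suc j) = cong₂ (λ a b → QT (entry a b)) (digits-shift c j) (vert-shift c s j)

      dst-shift : ∀ c s j → dst c s (suc j) ≡ dst c s 1 + dst (⟦ div ⟧ c D) (vert c s 1) j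
      dst-shift c s zero = sym (+-identityʳ _)
      dst-shift c s (suc j) = trans (cong₂ _+_ (dst-shift c s j) (cong₂ (λ a b → DT (entry a b)) (digits-shift c j) (vert-shift c s j))) (+-assoc (dst c s 1) _ _)

      -- The positions of the chosen entries become digits in base `D`, with the first hop in the
      -- least digit; both reductions in `entry` then act trivially.
      encode : ∀ {j s v d} → s < n → Hops j s v d → ∃[ c ] (c < D ^ j × vert c s j ≡ v × dst c s j ≡ d)
      encode s<n stop = 0 , s≤s z≤n , refl , refl
      encode {suc j} {s} s<n (go i i<c h) with encode (Row.Q<n (rowT s s<n) i i<c) h
      ... | c , c< , ev , ed = i + c * D , bound , trans (vert-shift _ s j) (trans (cong₂ (λ a b → vert a b j) dv v1) ev)
          , trans (dst-shift _ s j) (cong₂ _+_ d1 (trans (cong₂ (λ a b → dst a b j) dv v1) ed))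
        where
        i<D : i < D
        i<D = <-≤-trans i<c (Row.c≤D (rowT s s<n))
        dv : ⟦ div ⟧ (i + c * D) D ≡ c
        dv = div-digit i c D i<D
        en : entry (i + c * D) s ≡ s * D + i
        en = cong (s * D +_) (trans (cong (λ z → ⟦ mod ⟧ z (CT s)) (mod-digit i c D i<D)) (mod-id i (CT s) i<c))
        v1 : vert (i + c * D) s 1 ≡ QT (s * D + i)
        v1 = cong QT en
        d1 : dst (i + c * D) s 1 ≡ DT (s * D + i)
        d1 = cong DT en
        bound : i + c * D < D * D ^ j
        bound = ≤-trans (+-monoˡ-≤ (c * D) i<D) (≤-trans (≤-reflexive (*-comm (suc c) D)) (*-monoʳ-≤ D c<))

      entry-ok : ∀ c v → v < n → ∃[ i ] (i < CT v × entry c v ≡ v * D + i)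
      entry-ok c v l = _ , mod-small _ (CT v) (Row.c≥1 (rowT v l)) , refl

      entry< : ∀ c v → v < n → entry c v < n * D
      entry< c v l = slot< l (<-≤-trans (mod-small _ (CT v) (Row.c≥1 (rowT v l))) (Row.c≤D (rowT v l)))

      -- For soundness every number has to yield a genuine walk, not only the code of a hop
      -- sequence. The reduction modulo the length of the list ensures this.
      reach : ∀ c s j → s < n → vert c s j < n × Wk s (vert c s j) (dst c s j) × dst c s j ≤ j * n
      reach c s zero l = l , nil , z≤n
      reach c s (suc j) l with reach c s j l
      ... | vl , p , d≤ with entry-ok (digits c j) (vert c s j) vl
      ...   | i , i< , e = subst (_< n) (sym (cong QT e)) (Row.Q<n R i i<)
            , wk-++ p (subst₂ (Wk (vert c s j)) (sym (cong QT e)) (sym (cong DT e)) (Row.rwk R i i<))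
            , ≤-trans (+-mono-≤ d≤ (subst (_≤ n) (sym (cong DT e)) (Row.d≤n R i i<))) (≤-reflexive (+-comm (j * n) n))
        where R = rowT (vert c s j) vl

      record Hopped (c s i : ℕ) (τ : Store) : Set where
        field
          hu : rg τ ru ≡ vert c s i
          he : rg τ re ≡ dst c s i
          hw : rg τ rW ≡ digits c i

      walk-ok : ∀ from {σ c s} → {_ : T (not (from == ru))} → Tab σ → rg σ rD ≡ D → rg σ from ≡ s → s < n → rg σ rc ≡ c →
        Runs (walk from) σ (λ t υ → t ≤ 100 * suc k × Hopped c s k υ)
      walk-ok from {σ} {c} {s} tb eD ef s<n ec = blk▸ (ru := $ from) tt (blk▸ (re := ` 0) tt (blk▸ (rW := $ rc) tt
        (post (runs-for′ rj par hop {σ₀} {k} {c = 60} (Hopped c s) k≤V (λ _ → refl)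
           (record { hu = ef ; he = refl ; hw = ec })
           (λ {i} {τ} i<k f ei h → block hop (rx≤ i τ f h , re≤ i τ i<k f h , tt , tt) (num , record
              { hu = trans (cong (ar τ QU) (en i τ f h)) (Tab.tQ (tb′ f) _ (entry< _ _ (vl i)))
              ; he = cong₂ _+_ (Hopped.he h) (trans (cong (ar τ QD) (en i τ f h)) (Tab.tD (tb′ f) _ (entry< _ _ (vl i))))
              ; hw = cong₂ ⟦ div ⟧ (Hopped.hw h) (trans (fR f rD) eD) })))
         λ { {t} _ (t≤ , h) → tm t t≤ , h })))
        where
        σ₀ = setR rW (rg σ rc) (setR re 0 (setR ru (rg σ from) σ))
        tb′ : ∀ {τ} → Frame (for rj par hop) σ₀ τ → Tab τ
        tb′ f = tab-frame (for rj par hop) f (record { tQ = Tab.tQ tb ; tD = Tab.tD tb ; tC = Tab.tC tb ; tR = Tab.tR tb })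
        vl : ∀ i → vert c s i < n
        vl i = proj₁ (reach c s i s<n)
        en : ∀ i τ → Frame (for rj par hop) σ₀ τ → Hopped c s i τ →
          rg τ ru * rg τ rD + ⟦ mod ⟧ (⟦ mod ⟧ (rg τ rW) (rg τ rD)) (ar τ CN (rg τ ru)) ≡ entry (digits c i) (vert c s i)
        en i τ f h = trans (cong₂ (λ a b → a * rg τ rD + ⟦ mod ⟧ (⟦ mod ⟧ b (rg τ rD)) (ar τ CN a)) (Hopped.hu h) (Hopped.hw h))
          (cong₂ (λ a b → vert c s i * a + ⟦ mod ⟧ (⟦ mod ⟧ (digits c i) a) b) (trans (fR f rD) eD) (Tab.tC (tb′ f) _))
        rx≤ : ∀ i τ → Frame (for rj par hop) σ₀ τ → Hopped c s i τ → rg τ ru * rg τ rD + ⟦ mod ⟧ (⟦ mod ⟧ (rg τ rW) (rg τ rD)) (ar τ CN (rg τ ru)) ≤ V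
        rx≤ i τ f h = ≤-trans (≤-reflexive (en i τ f h)) (≤-trans (<⇒≤ (entry< _ _ (vl i))) nD≤V)
        re≤ : ∀ i τ → i < k → Frame (for rj par hop) σ₀ τ → (h : Hopped c s i τ) →
          rg τ re + ar τ QD (rg τ ru * rg τ rD + ⟦ mod ⟧ (⟦ mod ⟧ (rg τ rW) (rg τ rD)) (ar τ CN (rg τ ru))) ≤ V
        re≤ i τ i<k f h = ≤-trans (≤-reflexive (cong₂ _+_ (Hopped.he h) (trans (cong (ar τ QD) (en i τ f h)) (Tab.tD (tb′ f) _ (entry< _ _ (vl i))))))
          (≤-trans (proj₂ (proj₂ (reach c s (suc i) s<n))) (≤-trans (*-monoˡ-≤ n i<k) (≤-trans (m≤m+n (k * n) (k * n)) (≤-trans (n≤1+n _) kn≤V))))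
        tm : ∀ t → t ≤ k * (60 + fc rj par) + fc rj par → 2 + (2 + (2 + t)) ≤ 100 * suc k
        tm t h = ≤-trans (+-monoʳ-≤ 6 h) (≤-trans (≤-reflexive (lem k)) (addB′ k))
          where
          lem : ∀ k → 6 + (k * 68 + 8) ≡ 14 + 68 * k
          lem = solve-∀
          addB′ : ∀ k → 14 + 68 * k ≤ 100 * suc k
          addB′ k = ≤-trans (+-mono-≤ (num {14} {100}) (*-monoˡ-≤ k (num {68} {100}))) (≤-reflexive (sym (*-suc 100 k)))

      -- `sound` and `least` serve the meeting of the two ends, `from` serves `wipe`: it locates all
      -- nonzero cells.
      record Gathered (s c : ℕ) (τ : Store) : Set where
        field
          sound : ∀ v → ar τ AA v ≡ 0 ⊎ ∃[ e ] (ar τ AA v ≡ suc e × Wk s v e × e ≤ k * n)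
          from  : ∀ v → ar τ AA v ≢ 0 → ∃[ c′ ] (c′ < c × v ≡ vert c′ s k)
          least : ∀ c′ → c′ < c → ar τ AA (vert c′ s k) ≢ 0 × ar τ AA (vert c′ s k) ≤ suc (dst c′ s k)

      W₀ : ℕ
      W₀ = 100 * suc k + 300

      Q₀ : Store → ℕ → Set
      Q₀ τ i = Input τ × Tab τ × rg τ rP ≡ D ^ k × rg τ rs ≡ sp i × rg τ rt ≡ tp i × rg τ rv ≡ i

      Q₀-frame : ∀ P {σ τ i} → {_ : T (not (writesR P rN))} → {_ : T (not (writesR P rM))} → {_ : T (not (writesR P rQ))} → {_ : T (not (writesR P rD))} →
        {_ : T (not (writesA P HD))} → {_ : T (not (writesA P NX))} → {_ : T (not (writesA P TG))} → {_ : T (not (writesL P))} →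
        {_ : T (not (writesA P QU))} → {_ : T (not (writesA P QD))} → {_ : T (not (writesA P CN))} → {_ : T (not (writesA P RA))} →
        {_ : T (not (writesR P rP))} → {_ : T (not (writesR P rs))} → {_ : T (not (writesR P rt))} → {_ : T (not (writesR P rv))} →
        Frame P σ τ → Q₀ σ i → Q₀ τ i
      Q₀-frame P {σ} {τ} {i} {a} {b} {c} {d} {e} {f} {g} {h} {a′} {b′} {c′} {d′} {e′} {f′} {g′} {h′} F (I , tb , ep , es , et , ev) =
        input-frame P {σ} {τ} {a} {b} {c} {d} {e} {f} {g} {h} F I , tab-frame P {σ} {τ} {a′} {b′} {c′} {d′} F tb
        , trans (fR F rP {e′}) ep , trans (fR F rs {f′}) es , trans (fR F rt {g′}) et , trans (fR F rv {h′}) ev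

      gather-ok : ∀ {σ i} → i < q → Q₀ σ i → (∀ v → ar σ AA v ≡ 0) → Runs gather σ (λ t υ → t ≤ D ^ k * (W₀ + 8) + 8 × Gathered (sp i) (D ^ k) υ)
      gather-ok {σ} {i} i<q q0 z = runs-for′ rc ($ rP) (walk rs ▸ re := $ re ⊕ ` 1 ▸ relax AA ru) {σ} {D ^ k} {W₀} (Gathered s) pw≤V
        (λ f → trans (fR f rP) (proj₁ (proj₂ (proj₂ q0))))
        (record { sound = λ v → inj₁ (z v) ; from = λ v nz → ⊥-elim (nz (z v)) ; least = λ _ () })
        (λ {c} {τ} c<D f ec G → body {c} {τ} f ec G)
        where
        s = sp i
        body : ∀ {c τ} → Frame gather σ τ → rg τ rc ≡ c → Gathered s c τ →
          Runs (walk rs ▸ re := $ re ⊕ ` 1 ▸ relax AA ru) τ (λ t υ → t ≤ W₀ × Gathered s (suc c) (setR rc (suc c) υ))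
        body {c} {τ} f ec G with Q₀-frame gather {σ} {τ} {i} f q0
        ... | I , tb , ep , es , et , ev = walk-ok rs {τ} {c} {s} tb (Input.eD I) es (sp< i i<q) ec ⨟ λ {t₁} {τ₁} f₁ (t₁≤ , h) →
            blk▸ (re := $ re ⊕ ` 1) (subst (λ z → z + 1 ≤ V) (sym (Hopped.he h)) d+1≤V)
              (post (relax-ok AA ru {setR re (rg τ₁ re + 1) τ₁} (λ z → contradiction (trans (+-comm 1 (rg τ₁ re)) z) λ ()))
               λ { {t₂} {υ} f₂ (t₂≤ , R) → ≤-trans (+-mono-≤ t₁≤ (+-monoʳ-≤ 4 t₂≤)) (+-monoʳ-≤ (100 * suc k) (num {84} {300}))
                 , done {υ} (subst (λ A₀ → Relaxed A₀ (vert c s k) (suc (dst c s k)) (ar υ AA)) (fA f₁ AA)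
                     (subst₂ (λ a b → Relaxed (ar τ₁ AA) a b (ar υ AA)) (Hopped.hu h) (trans (+-comm (rg τ₁ re) 1) (cong suc (Hopped.he h))) R)) })
          where
          open Gathered G
          rch = reach c s k (sp< i i<q)
          d+1≤V : dst c s k + 1 ≤ V
          d+1≤V = ≤-trans (≤-reflexive (+-comm _ 1)) (≤-trans (s≤s (≤-trans (proj₂ (proj₂ rch)) (m≤m+n _ _))) kn≤V)
          done : ∀ {υ} → Relaxed (ar τ AA) (vert c s k) (suc (dst c s k)) (ar υ AA) → Gathered s (suc c) (setR rc (suc c) υ)
          done {υ} R = record { sound = sd ; from = fm
            ; least = below-suc (λ c′ → ar υ AA (vert c′ s k) ≢ 0 × ar υ AA (vert c′ s k) ≤ suc (dst c′ s k))
                (λ c′ l → let a , b = least c′ l ; a′ , b′ = relaxed-mono {ar τ AA} {ar υ AA} R _ a in a′ , ≤-trans b′ b)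
                (Relaxed.here≢ R , Relaxed.here≤ R) }
            where
            sd : ∀ v → ar υ AA v ≡ 0 ⊎ ∃[ e ] (ar υ AA v ≡ suc e × Wk s v e × e ≤ k * n)
            sd v with v ≟ vert c s k
            ... | no ne = subst (λ z → z ≡ 0 ⊎ ∃[ e ] (z ≡ suc e × Wk s v e × e ≤ k * n)) (sym (Relaxed.other R v ne)) (sound v)
            ... | yes refl with Relaxed.which R
            ...   | inj₁ e = subst (λ z → z ≡ 0 ⊎ ∃[ e ] (z ≡ suc e × Wk s v e × e ≤ k * n)) (sym e) (sound v)
            ...   | inj₂ e = inj₂ (_ , e , proj₁ (proj₂ rch) , proj₂ (proj₂ rch))
            fm : ∀ v → ar υ AA v ≢ 0 → ∃[ c′ ] (c′ < suc c × v ≡ vert c′ s k)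
            fm v nz with v ≟ vert c s k
            ... | yes e = c , ≤-refl , e
            ... | no ne = let c′ , l , e = from v (λ z → nz (trans (Relaxed.other R v ne) z)) in c′ , m≤n⇒m≤1+n l , e

      record Met (σ : Store) (i c : ℕ) (τ : Store) : Set where
        field
          snd  : Sound (ar τ ES)
          mono : Mono (ar σ ES) (ar τ ES)
          met  : ∀ c′ → c′ < c → ar σ AA (vert c′ (tp i) k) ≢ 0 → ar τ ES i ≢ 0 × ar τ ES i ≤ dst c′ (tp i) k + ar σ AA (vert c′ (tp i) k)

      meet-ok : ∀ {σ i} → i < q → Q₀ σ i → Gathered (sp i) (D ^ k) σ → Sound (ar σ ES) → Runs meet σ (λ t υ → t ≤ D ^ k * (W₀ + 8) + 8 × Met σ i (D ^ k) υ)
      meet-ok {σ} {i} i<q q0 G sd = runs-for′ rc ($ rP) (walk rt ▸ iff (AA ⟨ $ ru ⟩) (re := $ re ⊕ AA ⟨ $ ru ⟩ ▸ relax ES rv) nop) {σ} {D ^ k} {W₀} (Met σ i) pw≤V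
        (λ f → trans (fR f rP) (proj₁ (proj₂ (proj₂ q0))))
        (record { snd = sd ; mono = mono-refl ; met = λ _ () })
        (λ {c} {τ} c<D f ec M → body {c} {τ} f ec M)
        where
        t₀ = tp i
        body : ∀ {c τ} → Frame meet σ τ → rg τ rc ≡ c → Met σ i c τ →
          Runs (walk rt ▸ iff (AA ⟨ $ ru ⟩) (re := $ re ⊕ AA ⟨ $ ru ⟩ ▸ relax ES rv) nop) τ (λ t υ → t ≤ W₀ × Met σ i (suc c) (setR rc (suc c) υ))
        body {c} {τ} f ec M with Q₀-frame meet {σ} {τ} {i} f q0
        ... | I , tb , ep , es , et , ev = walk-ok rt {τ} {c} {t₀} tb (Input.eD I) et (tp< i i<q) ec ⨟ λ {t₁} {τ₁} f₁ (t₁≤ , h) →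
            runs-iff
              (λ nz → blk▸ (re := $ re ⊕ AA ⟨ $ ru ⟩) (subst (_≤ V) (sym (sumE f₁ h)) (fit (subst (_≢ 0) (aa f₁ h) nz)))
                (post (relax-ok ES rv {setR re (rg τ₁ re + ar τ₁ AA (rg τ₁ ru)) τ₁} (λ z → nz (m+n≡0⇒n≡0 (rg τ₁ re) z)))
                 λ { {t₂} {υ} f₂ (t₂≤ , R) → ≤-trans (+-mono-≤ t₁≤ (+-monoʳ-≤ 20 t₂≤)) (+-monoʳ-≤ (100 * suc k) (num {100} {300}))
                   , done {υ} (subst (_≢ 0) (aa f₁ h) nz) (subst (λ E → Relaxed E i (dst c t₀ k + ar σ AA (vert c t₀ k)) (ar υ ES)) (fA f₁ ES)
                       (subst₂ (λ a b → Relaxed (ar τ₁ ES) a b (ar υ ES)) (trans (fR f₁ rv) ev) (sumE f₁ h) R)) }))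
              (λ z → runs-nop (≤-trans (+-mono-≤ t₁≤ (≤-refl {10})) (+-monoʳ-≤ (100 * suc k) (num {10} {300})) , record
                 { snd = subst Sound (sym (fA f₁ ES)) snd ; mono = subst (Mono (ar σ ES)) (sym (fA f₁ ES)) mono
                 ; met = below-suc (λ c′ → ar σ AA (vert c′ t₀ k) ≢ 0 → ar τ₁ ES i ≢ 0 × ar τ₁ ES i ≤ dst c′ t₀ k + ar σ AA (vert c′ t₀ k))
                     (λ c′ l → subst (λ E → ar σ AA (vert c′ t₀ k) ≢ 0 → E i ≢ 0 × E i ≤ dst c′ t₀ k + ar σ AA (vert c′ t₀ k)) (sym (fA f₁ ES)) (met c′ l))
                     (λ nz → ⊥-elim (nz (trans (sym (aa f₁ h)) z))) }))
          where
          open Met M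
          rch = reach c t₀ k (tp< i i<q)
          aa : ∀ {τ₁} → Frame (walk rt) τ τ₁ → Hopped c t₀ k τ₁ → ar τ₁ AA (rg τ₁ ru) ≡ ar σ AA (vert c t₀ k)
          aa f₁ h = cong₂ (λ g x → g x) (trans (fA f₁ AA) (fA f AA)) (Hopped.hu h)
          sumE : ∀ {τ₁} → Frame (walk rt) τ τ₁ → Hopped c t₀ k τ₁ → rg τ₁ re + ar τ₁ AA (rg τ₁ ru) ≡ dst c t₀ k + ar σ AA (vert c t₀ k)
          sumE f₁ h = cong₂ _+_ (Hopped.he h) (aa f₁ h)
          val : ar σ AA (vert c t₀ k) ≢ 0 → ∃[ e ] (ar σ AA (vert c t₀ k) ≡ suc e × Wk (sp i) (vert c t₀ k) e × e ≤ k * n)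
          val nz with Gathered.sound G (vert c t₀ k)
          ... | inj₁ z = ⊥-elim (nz z)
          ... | inj₂ x = x
          fit : ar σ AA (vert c t₀ k) ≢ 0 → dst c t₀ k + ar σ AA (vert c t₀ k) ≤ V
          fit nz with val nz
          ... | e , e≡ , _ , e≤ rewrite e≡ = ≤-trans (≤-reflexive (+-suc _ e)) (≤-trans (s≤s (+-mono-≤ (proj₂ (proj₂ rch)) e≤)) kn≤V)
          done : ∀ {υ} → ar σ AA (vert c t₀ k) ≢ 0 → Relaxed (ar τ ES) i (dst c t₀ k + ar σ AA (vert c t₀ k)) (ar υ ES) → Met σ i (suc c) (setR rc (suc c) υ)
          done {υ} nz R with val nz
          ... | e , e≡ , p , _ = record
            { snd = relaxed-sound {ar τ ES} {ar υ ES} {i} (subst (λ z → Relaxed (ar τ ES) i z (ar υ ES)) (trans (cong (dst c t₀ k +_) e≡) (trans (+-suc _ e) (cong suc (+-comm _ e)))) R)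
                (wk-++ p (wk-rev gs (proj₁ (proj₂ rch)))) snd
            ; mono = mono-trans {ar σ ES} {ar τ ES} {ar υ ES} mono (relaxed-mono R)
            ; met = below-suc (λ c′ → ar σ AA (vert c′ t₀ k) ≢ 0 → ar υ ES i ≢ 0 × ar υ ES i ≤ dst c′ t₀ k + ar σ AA (vert c′ t₀ k))
                (λ c′ l nz′ → let a , b = met c′ l nz′ ; a′ , b′ = relaxed-mono {ar τ ES} {ar υ ES} R i a in a′ , ≤-trans b′ b)
                (λ _ → Relaxed.here≢ R , Relaxed.here≤ R) }

      wipe-ok : ∀ {σ i} → i < q → Q₀ σ i → (∀ v → ar σ AA v ≢ 0 → ∃[ c ] (c < D ^ k × v ≡ vert c (sp i) k)) →
        Runs wipe σ (λ t υ → t ≤ D ^ k * (W₀ + 8) + 8 × (∀ v → ar υ AA v ≡ 0))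
      wipe-ok {σ} {i} i<q q0 h₀ = post (runs-for′ rc ($ rP) (walk rs ▸ AA ⟨ $ ru ⟩:= ` 0) {σ} {D ^ k} {W₀}
        -- A cell that is still nonzero belongs to the end of a sequence yet to be repeated; after
        -- all `D ^ k` rounds there is none.
        (λ c τ → ∀ v → ar τ AA v ≢ 0 → ∃[ c′ ] (c ≤ c′ × c′ < D ^ k × v ≡ vert c′ s k)) pw≤V
        (λ f → trans (fR f rP) (proj₁ (proj₂ (proj₂ q0))))
        (λ v nz → let c , l , e = h₀ v nz in c , z≤n , l , e)
        (λ {c} {τ} c<D f ec J → body {c} {τ} f ec J))
        λ { {_} {υ} _ (t≤ , J) → t≤ , λ v → zero′ (ar υ AA v) (J v) }
        where
        s = sp i
        zero′ : ∀ {v} a → (a ≢ 0 → ∃[ c′ ] (D ^ k ≤ c′ × c′ < D ^ k × v ≡ vert c′ s k)) → a ≡ 0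
        zero′ zero _ = refl
        zero′ (suc a) J = let _ , x , y , _ = J (λ ()) in ⊥-elim (<⇒≱ y x)
        body : ∀ {c τ} → Frame wipe σ τ → rg τ rc ≡ c → (∀ v → ar τ AA v ≢ 0 → ∃[ c′ ] (c ≤ c′ × c′ < D ^ k × v ≡ vert c′ s k)) →
          Runs (walk rs ▸ AA ⟨ $ ru ⟩:= ` 0) τ (λ t υ → t ≤ W₀ × (∀ v → ar υ AA v ≢ 0 → ∃[ c′ ] (suc c ≤ c′ × c′ < D ^ k × v ≡ vert c′ s k)))
        body {c} {τ} f ec J with Q₀-frame wipe {σ} {τ} {i} f q0
        ... | I , tb , ep , es , et , ev = walk-ok rs {τ} {c} {s} tb (Input.eD I) es (sp< i i<q) ec ⨟ λ {t₁} {τ₁} f₁ (t₁≤ , h) →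
            block (AA ⟨ $ ru ⟩:= ` 0) tt (+-mono-≤ t₁≤ (num {_} {300}) , done {τ₁} f₁ h)
          where
          done : ∀ {τ₁} → Frame (walk rs) τ τ₁ → Hopped c s k τ₁ → ∀ v → setf (ar τ₁ AA) (rg τ₁ ru) 0 v ≢ 0 → ∃[ c′ ] (suc c ≤ c′ × c′ < D ^ k × v ≡ vert c′ s k)
          done {τ₁} f₁ h v nz with setf-cases (ar τ₁ AA) (rg τ₁ ru) 0 v
          ... | inj₁ (_ , e) = ⊥-elim (nz e)
          ... | inj₂ (ne , e) with J v (λ z → nz (trans e (trans (cong (λ g → g v) (fA f₁ AA)) z)))
          ...   | c′ , a , b , e′ = c′ , ≤∧≢⇒< a (λ { refl → ne (trans (Hopped.hu h) (sym e′)) }) , b , e′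

      Near : (ℕ → ℕ) → ℕ → Set
      Near E i = ∀ {v d₁ d₂} → Hops k (sp i) v d₁ → Hops k (tp i) v d₂ → E i ≢ 0 × E i ≤ suc (d₁ + d₂)

      record Queried (σ : Store) (i : ℕ) (τ : Store) : Set where
        field
          aa0  : ∀ v → ar τ AA v ≡ 0
          snd  : Sound (ar τ ES)
          mono : Mono (ar σ ES) (ar τ ES)
          near : ∀ j → j < i → Near (ar τ ES) j

      QT₁ : ℕ
      QT₁ = 22 + 3 * (D ^ k * (W₀ + 8) + 8)

      query-ok : ∀ {σ} → Input σ → Tab σ → rg σ rP ≡ D ^ k → (∀ v → ar σ AA v ≡ 0) → Sound (ar σ ES) →
        Runs query σ (λ t υ → t ≤ q * (QT₁ + 8) + 8 × Queried σ q υ)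
      query-ok {σ} I tb ep z sd = runs-for′ rv ($ rQ) (pair-at ▸ gather ▸ meet ▸ wipe) {σ} {q} {QT₁} (Queried σ) q≤V (λ f → trans (fR f rQ) (Input.eQ I))
        (record { aa0 = z ; snd = sd ; mono = mono-refl ; near = λ _ () })
        (λ {i} {τ} i<q f ei Q → body {i} {τ} i<q f ei Q)
        where
        body : ∀ {i τ} → i < q → Frame query σ τ → rg τ rv ≡ i → Queried σ i τ →
          Runs (pair-at ▸ gather ▸ meet ▸ wipe) τ (λ t υ → t ≤ QT₁ × Queried σ (suc i) (setR rv (suc i) υ))
        body {i} {τ} i<q f ei Q = pair-ok (input-frame query f I) i<q ei ⨟ λ { {_} fp (refl , refl) →
            gather-ok {Pairs i τ} {i} i<q (q₁ fp) aa0 ⨟ λ {t₁} {τ₁} f₁ (t₁≤ , G) →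
            meet-ok {τ₁} {i} i<q (q₂ fp f₁) G (subst Sound (sym (fA f₁ ES)) snd) ⨟ λ {t₂} {τ₂} f₂ (t₂≤ , M) →
            post (wipe-ok {τ₂} {i} i<q (Q₀-frame meet {τ₁} {τ₂} {i} f₂ (q₂ fp f₁)) (λ v nz → Gathered.from G v (λ z → nz (trans (cong (λ g → g v) (fA f₂ AA)) z))))
            λ { {t₃} {υ} f₃ (t₃≤ , z₃) → +-monoʳ-≤ 22 (≤-trans (+-mono-≤ t₁≤ (+-mono-≤ t₂≤ t₃≤)) (≤-reflexive (three (D ^ k * (W₀ + 8) + 8))))
               , done {τ₁} {τ₂} {υ} f₁ G M f₃ z₃ } }
          where
          open Queried Q
          three : ∀ x → x + (x + x) ≡ 3 * x
          three = solve-∀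
          q₁ : Frame pair-at τ (Pairs i τ) → Q₀ (Pairs i τ) i
          q₁ fp = input-frame pair-at fp (input-frame query f I) , tab-frame pair-at fp (tab-frame query f tb) , trans (fR f rP) ep , refl , refl , ei
          q₂ : Frame pair-at τ (Pairs i τ) → ∀ {τ₁} → Frame gather (Pairs i τ) τ₁ → Q₀ τ₁ i
          q₂ fp {τ₁} f₁ = Q₀-frame gather {Pairs i τ} {τ₁} {i} f₁ (q₁ fp)
          done : ∀ {τ₁ τ₂ υ} → Frame gather (Pairs i τ) τ₁ → Gathered (sp i) (D ^ k) τ₁ → Met τ₁ i (D ^ k) τ₂ → Frame wipe τ₂ υ → (∀ v → ar υ AA v ≡ 0) →
            Queried σ (suc i) (setR rv (suc i) υ)
          done {τ₁} {τ₂} {υ} f₁ G M f₃ z₃ = record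
            { aa0 = z₃ ; snd = subst Sound (sym (fA f₃ ES)) (Met.snd M) ; mono = mono-trans {ar σ ES} {ar τ ES} {ar υ ES} mono mo
            ; near = below-suc (Near (ar υ ES)) (λ j l {v} {d₁} {d₂} a b → let x , y = near j l a b ; x′ , y′ = mo j x in x′ , ≤-trans y′ y) newN }
            where
            mo : Mono (ar τ ES) (ar υ ES)
            mo = subst₂ Mono (fA f₁ ES) (sym (fA f₃ ES)) (Met.mono M)
            newN : Near (ar υ ES) i
            newN {v} {d₁} {d₂} a b with encode (sp< i i<q) a | encode (tp< i i<q) b
            ... | c₁ , l₁ , v₁ , e₁ | c₂ , l₂ , v₂ , e₂ = subst (λ E → E i ≢ 0 × E i ≤ suc (d₁ + d₂)) (sym (fA f₃ ES)) (proj₁ mt , ≤-trans (proj₂ mt) le)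
              where
              vv : vert c₂ (tp i) k ≡ vert c₁ (sp i) k
              vv = trans v₂ (sym v₁)
              ls′ = Gathered.least G c₁ l₁
              mt = Met.met M c₂ l₂ (subst (λ x → ar τ₁ AA x ≢ 0) (sym vv) (proj₁ ls′))
              -- The cell of the meeting vertex holds a minimum over all sequences ending there, in
              -- particular over the one coded by `c₁`.
              le : dst c₂ (tp i) k + ar τ₁ AA (vert c₂ (tp i) k) ≤ suc (d₁ + d₂)
              le = ≤-trans (+-mono-≤ (≤-reflexive e₂) (≤-trans (≤-reflexive (cong (ar τ₁ AA) vv)) (≤-trans (proj₂ ls′) (s≤s (≤-reflexive e₁)))))
                (≤-reflexive (trans (+-suc d₂ d₁) (cong suc (+-comm d₂ d₁))))

      -- The approximation guarantee

      module Estimate (E : ℕ → ℕ)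
        (cov : ∀ v → v < n → WholeT v ⊎ (PartT v × ∃[ x ] ∃[ ℓ ] (Wk x v ℓ × ℓ ≤ RT v × (∀ i → i < q → Good x E i))))
        (near : ∀ i → i < q → Near E i) where

        Detour : ℕ → ℕ → ℕ → ℕ → Set
        Detour L s t ℓ = ∃[ x ] ∃[ a ] ∃[ b ] (Wk s x a × Wk x t b × a + b ≤ ℓ + 2 * L × (∀ i → i < q → Good x E i))

        -- Cut the walk into j pieces of length at most L: either every cut vertex
        -- stores its whole L-ball, or the first one that does not is within L of a pick.
        chain : ∀ L j {s t} ℓ → s < n → Wk s t ℓ → ℓ ≤ j * L → Detour L s t ℓ ⊎ ∃[ d ] (Hops j s t d × d ≤ ℓ)
        chain L zero ℓ l nil z≤n = inj₂ (0 , stop , z≤n)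
        chain L (suc j) {s} {t} ℓ l p h = look (cov s l)
          where
          a b : ℕ
          -- Pieces are cut greedily and the last ones may be empty: a hop of length 0 stays at its
          -- vertex, so the number of hops is always exactly `suc j`.
          a = L ⊓ ℓ
          b = ℓ ∸ a
          ab : a + b ≡ ℓ
          ab = m+[n∸m]≡n (m⊓n≤n L ℓ)
          b≤ : b ≤ j * L
          b≤ with ≤-total L ℓ
          ... | inj₁ L≤ℓ = ≤-trans (≤-reflexive (cong (ℓ ∸_) (m≤n⇒m⊓n≡m L≤ℓ))) (≤-trans (∸-monoˡ-≤ L h) (≤-reflexive (m+n∸m≡n L (j * L))))
          ... | inj₂ ℓ≤L = ≤-trans (≤-reflexive (trans (cong (ℓ ∸_) (m≥n⇒m⊓n≡n ℓ≤L)) (n∸n≡0 ℓ))) z≤n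
          rs′ = rowT s l
          onward : (∀ {u ℓ} → Wk s u ℓ → ℓ ≤ L → InRow (λ i → QT (s * D + i)) (λ i → DT (s * D + i)) (CT s) u ℓ) → Detour L s t ℓ ⊎ ∃[ d ] (Hops (suc j) s t d × d ≤ ℓ)
          onward ball with split a {b} (subst (Wk s t) (sym ab) p)
          ... | v , p₁ , p₂ with ball p₁ (m⊓n≤m L ℓ)
          ...   | i , i<c , refl , d≤ with chain L j b (Row.Q<n rs′ i i<c) p₂ b≤
          ...     | inj₂ (d , hs , dl) = inj₂ (_ , go i i<c hs , ≤-trans (+-mono-≤ d≤ dl) (≤-reflexive ab))
          ...     | inj₁ (x , a′ , b′ , r₁ , r₂ , le , g) = inj₁ (x , a + a′ , b′ , wk-++ p₁ r₁ , r₂ , ≤-trans (≤-reflexive (+-assoc a a′ b′)) (≤-trans (+-monoʳ-≤ a le)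
                    (≤-reflexive (trans (sym (+-assoc a b _)) (cong (_+ 2 * L) ab)))) , g)
          look : WholeT s ⊎ (PartT s × ∃[ x ] ∃[ ℓ ] (Wk x s ℓ × ℓ ≤ RT s × (∀ i → i < q → Good x E i))) → Detour L s t ℓ ⊎ ∃[ d ] (Hops (suc j) s t d × d ≤ ℓ)
          look (inj₁ W) = onward (λ r _ → W r)
          -- The radius is `suc r`. If `L ≤ r`, the ball of radius `L` is stored; otherwise
          -- `suc r ≤ L`, so the pick is within `L`, and going there and back costs at most `2 * L`.
          look (inj₂ ((_ , r , er , ball , _) , x , ℓ′ , px , le , g)) with L ≤? r
          ... | yes L≤r = onward (λ p′ l′ → ball p′ (≤-trans l′ L≤r))
          ... | no nl = inj₁ (x , ℓ′ , ℓ′ + ℓ , wk-rev gs px , wk-++ px p , ≤-trans (≤-reflexive (lem ℓ′ ℓ)) (+-monoʳ-≤ ℓ (*-monoʳ-≤ 2 (≤-trans le (≤-trans (≤-reflexive er) (≰⇒> nl))))) , g)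
            where
            lem : ∀ a b → a + (a + b) ≡ b + 2 * a
            lem = solve-∀

        -- Both halves are traversed from their outer ends towards the common middle vertex. A
        -- detour found on one half is extended by the other half without further loss, so `2 * L`
        -- is paid at most once.
        estimate-ok : ∀ i → i < q → ∀ d → Wk (sp i) (tp i) d → E i ≢ 0 × E i ≤ suc (d + 2 * ⌈ d ÷ 2 * k ⌉)
        estimate-ok i i<q d p = cut (split a {b} (subst (Wk (sp i) (tp i)) (sym ab) p))
          where
          L a b : ℕ
          L = ⌈ d ÷ 2 * k ⌉
          a = (k * L) ⊓ d
          b = d ∸ a
          ab : a + b ≡ d
          ab = m+[n∸m]≡n (m⊓n≤n (k * L) d)
          b≤ : b ≤ k * L
          b≤ with ≤-total (k * L) d
          ... | inj₁ le = ≤-trans (≤-reflexive (cong (d ∸_) (m≤n⇒m⊓n≡m le))) (≤-trans (∸-monoˡ-≤ (k * L) (⌈÷⌉-spec d k k≥1)) (≤-reflexive (m+n∸m≡n (k * L) (k * L))))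
          ... | inj₂ le = ≤-trans (≤-reflexive (trans (cong (d ∸_) (m≥n⇒m⊓n≡n le)) (n∸n≡0 d))) z≤n
          lem₁ : ∀ x y b → x + (y + b) ≡ x + y + b
          lem₁ = solve-∀
          lem₂ : ∀ a b L → a + 2 * L + b ≡ a + b + 2 * L
          lem₂ = solve-∀
          lem₃ : ∀ x y a → y + a + x ≡ x + y + a
          lem₃ = solve-∀
          lem₄ : ∀ a b L → b + 2 * L + a ≡ a + b + 2 * L
          lem₄ = solve-∀
          fin : ∀ {x} → E i ≢ 0 × E i ≤ suc x → x ≤ a + b + 2 * L → E i ≢ 0 × E i ≤ suc (d + 2 * L)
          fin (nz , le) h = nz , ≤-trans le (s≤s (≤-trans h (≤-reflexive (cong (_+ 2 * L) ab))))
          joinˡ : ∀ {v} → Wk (sp i) v a → Wk v (tp i) b → Detour L (sp i) v a ⊎ ∃[ e ] (Hops k (sp i) v e × e ≤ a) → Detour L (tp i) v b ⊎ ∃[ e ] (Hops k (tp i) v e × e ≤ b) →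
            E i ≢ 0 × E i ≤ suc (d + 2 * L)
          joinˡ p₁ p₂ (inj₁ (x , a′ , b′ , r₁ , r₂ , le , g)) _ = fin (g i i<q a′ (b′ + b) (wk-rev gs r₁) (wk-++ r₂ p₂))
            (≤-trans (≤-reflexive (lem₁ a′ b′ b)) (≤-trans (+-monoˡ-≤ b le) (≤-reflexive (lem₂ a b L))))
          joinˡ p₁ p₂ (inj₂ _) (inj₁ (x , a′ , b′ , r₁ , r₂ , le , g)) = fin (g i i<q (b′ + a) a′ (wk-++ r₂ (wk-rev gs p₁)) (wk-rev gs r₁))
            (≤-trans (≤-reflexive (lem₃ a′ b′ a)) (≤-trans (+-monoˡ-≤ a le) (≤-reflexive (lem₄ a b L))))
          joinˡ p₁ p₂ (inj₂ (e₁ , h₁ , l₁)) (inj₂ (e₂ , h₂ , l₂)) = fin (near i i<q h₁ h₂) (≤-trans (+-mono-≤ l₁ l₂) (m≤m+n _ _))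
          cut : ∃[ v ] (Wk (sp i) v a × Wk v (tp i) b) → E i ≢ 0 × E i ≤ suc (d + 2 * L)
          cut (v , p₁ , p₂) = joinˡ p₁ p₂ (chain L k a (sp< i i<q) p₁ (m⊓n≤m (k * L) d)) (chain L k b (tp< i i<q) (wk-rev gs p₂) b≤)

      solve-ok : ∀ {σ} → Input σ → Tab σ → (∀ v → v < n → UnState σ v) → CountOK σ → (∀ u → ar σ VI u ≡ 0) → Sound (ar σ ES) →
        rg σ rP ≡ D ^ k → (∀ v → ar σ AA v ≡ 0) →
        Runs (hitting ▸ query ▸ output) σ (λ t τ → t ≤ 20 + (halvings n * (60 * suc n + 2000 * Y) + (200 * suc D) * n) + (QTime + 200 * suc q)
          × (∀ i → i < q → Answer (lw τ) i))
      solve-ok {σ} I tb us co v0 sd eP aa = hitting-ok {σ} I tb us co v0 sd ⨟ λ {t₁} {τ₁} f₁ (J , un0 , t₁≤) →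
          query-ok {τ₁} (Inv.inp J) (Inv.tab J) (trans (fR f₁ rP) eP) (λ v → trans (cong (λ g → g v) (fA f₁ AA)) (aa v)) (Inv.snd J) ⨟ λ {t₂} {τ₂} f₂ (t₂≤ , Q) →
          post (output-ok {τ₂} {q} (trans (fR f₂ rQ) (Input.eQ (Inv.inp J))) q≤β q≤V)
          λ { {t₃} {υ} f₃ (t₃≤ , lo) → +-mono-≤ t₁≤ (+-mono-≤ t₂≤ t₃≤) , λ i l → answer {τ₁} {τ₂} {υ} J un0 Q lo i l }
        where
        q≤β : q ≤ β
        q≤β = ≤-trans (m≤m+n q (q + 0)) (≤-trans (m≤n+m (2 * q) (3 + 2 * m)) (≤-reflexive (sym β≡)))
        answer : ∀ {τ₁ τ₂ υ} → Inv τ₁ → (∀ v → v < n → ar τ₁ UN v ≡ 0) → Queried τ₁ q τ₂ → (∀ i → i < q → lw υ i ≡ ar τ₂ ES i) → ∀ i → i < q → Answer (lw υ) i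
        answer {τ₁} {τ₂} {υ} J un0 Q lo i l = subst (λ z → (z ≡ 0 ⊎ ∃[ e ] (z ≡ suc e × Wk (sp i) (tp i) e))
            × (∀ d → Wk (sp i) (tp i) d → z ≢ 0 × z ≤ suc (d + 2 * ⌈ d ÷ 2 * k ⌉))) (sym (lo i l)) (Queried.snd Q i l , Es.estimate-ok i l)
          where
          cov : ∀ v → v < n → WholeT v ⊎ (PartT v × ∃[ x ] ∃[ ℓ ] (Wk x v ℓ × ℓ ≤ RT v × (∀ i → i < q → Good x (ar τ₂ ES) i)))
          cov v l with Inv.uns J v l
          ... | inj₂ (o , _) = contradiction (trans (sym (un0 v l)) o) λ ()
          ... | inj₁ (_ , inj₁ W) = inj₁ W
          ... | inj₁ (_ , inj₂ (P , x , ℓ , p , le , g)) = inj₂ (P , x , ℓ , p , le , λ i l → good-mono {x} {ar τ₁ ES} {ar τ₂ ES} {i} (Queried.mono Q) (g i l))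
          module Es = Estimate (ar τ₂ ES) cov (Queried.near Q)

  -- Composition of the stages

  record Job : Set where
    field
      n m q a : ℕ
      src tgt : ℕ → ℕ
      gs   : Graphs.Simple n (m + m) src tgt
      sp tp : ℕ → ℕ
      sp<  : ∀ i → i < q → sp i < n
      tp<  : ∀ i → i < q → tp i < n
      srcᵐ : ∀ e → e < m → src (m + e) ≡ tgt e
      tgtᵐ : ∀ e → e < m → tgt (m + e) ≡ src e
      β≡   : β ≡ 3 + 2 * m + 2 * q
      k≥2  : 2 ≤ k
      mn   : m ≤ n * n
      q≤   : q ≤ a * n
      q≤V  : q ≤ V
      n2≤V : 2 + n ≤ V
      k1≤V : k + 1 ≤ V
      H<V  : m + m < V
      nn≤V : suc (n + n) ≤ V
      kn≤V : suc (k * n + k * n) ≤ V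
      nD≤V : n * (2 + n) ≤ V
      pw≤V : (2 + n) ^ (k + 1) ≤ V

  module Whole (J : Job) where
    open Job J

    n<V : n < V
    n<V = ≤-trans (n≤1+n _) n2≤V

    k≥1 : 1 ≤ k
    k≥1 = ≤-trans (n≤1+n 1) k≥2

    open Adjacency n m (m + m) src tgt (≤-trans (m≤m+n m m) (<⇒≤ H<V)) H<V

    record Loaded (σ : Store) : Set where
      field
        zeros : ∀ a i → ar σ a i ≡ 0
        es : ∀ e → e < m → lw σ (3 + 2 * e) ≡ src e
        et : ∀ e → e < m → lw σ (4 + 2 * e) ≡ tgt e
        ps : ∀ i → i < q → lw σ (3 + 2 * m + 2 * i) ≡ sp i
        pt : ∀ i → i < q → lw σ (4 + 2 * m + 2 * i) ≡ tp i

    runsb : ∀ P {Q σ Z} → {_ : T (straight P)} → {_ : T (okC P)} → Safe P σ → Runs Q (exec P σ) (λ t υ → Z (scost P + t) υ) → Runs (P ▸ Q) σ Z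
    runsb P {_} {σ} {_} {a} {b} s r = runs-▸ (block P {_} {_} {a} {b} s r)

    record Prepared (σ : Store) (D t : ℕ) (τ : Store) : Set where
      field
        pt≤ : t ≤ (k * 38 + 100) + 400 * suc m
        lst : Listed (m + m) τ
        pP  : rg τ rP ≡ D ^ k

    idx< : ∀ e → e < m → 4 + 2 * e < β
    idx< e l = subst (4 + 2 * e <_) (sym β≡) (≤-trans (≤-trans (≤-reflexive (lem e)) (+-monoʳ-≤ 3 (*-monoʳ-≤ 2 l))) (m≤m+n (3 + 2 * m) (2 * q)))
      where
      lem : ∀ e → 5 + 2 * e ≡ 3 + 2 * suc e
      lem = solve-∀

    prep-ok : ∀ {σ D} → 1 ≤ D → D ^ k ≤ V → Loaded σ → rg σ rM ≡ m → rg σ rD ≡ D → Runs prep σ (Prepared σ D)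
    prep-ok {σ} {D} D≥1 DV L eM eD = power-ok par {σ} {D} {k} eD D≥1 refl k≤V DV ⨟ λ {t₀} {τ₀} f₀ (t₀≤ , e₀) →
        runsb (rP := $ rx) tt (runsb (rs := ` 3) tt (runsb (rt := ` 4) tt (runsb (rS := ` 0) tt
        (build-ok {σ₁ τ₀} {3} {4} {0} (trans (fR f₀ rM) eM) refl refl refl (m≤m+n m m)
            (λ e l → <-trans (n<1+n _) (idx< e l)) idx<
            (λ e l → trans (cong (λ g → g (3 + 2 * e)) (fL f₀)) (Loaded.es L e l)) (λ e l → trans (cong (λ g → g (4 + 2 * e)) (fL f₀)) (Loaded.et L e l))
            (record { hd = λ u → trans (cong (λ g → g u) (fA f₀ HD)) (Loaded.zeros L HD u) ; nx = λ _ () ; tg = λ _ () }) ⨟ λ {t₁} {τ₁} f₁ (t₁≤ , L₁) →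
         runsb (rs := ` 4) tt (runsb (rt := ` 3) tt (runsb (rS := $ rM) tt
         (post (build-ok {σ₂ τ₁} {4} {3} {m} (trans (fR f₁ rM) (trans (fR f₀ rM) eM)) refl refl (trans (fR f₁ rM) (trans (fR f₀ rM) eM)) ≤-refl
            idx< (λ e l → <-trans (n<1+n _) (idx< e l))
            (λ e l → trans (cong (λ g → g (4 + 2 * e)) (trans (fL f₁) (fL f₀))) (trans (Loaded.et L e l) (sym (srcᵐ e l))))
            (λ e l → trans (cong (λ g → g (3 + 2 * e)) (trans (fL f₁) (fL f₀))) (trans (Loaded.es L e l) (sym (tgtᵐ e l))))
            (record { hd = Listed.hd L₁ ; nx = Listed.nx L₁ ; tg = Listed.tg L₁ }))
          λ { {t₂} {υ} f₂ (t₂≤ , L₂) → record { pt≤ = tm t₀ t₁ t₂ t₀≤ t₁≤ t₂≤ ; lst = L₂ ; pP = trans (fR f₂ rP) (trans (fR f₁ rP) e₀) } })))))))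
      where
      σ₁ σ₂ : Store → Store
      σ₁ τ₀ = setR rS 0 (setR rt 4 (setR rs 3 (setR rP (rg τ₀ rx) τ₀)))
      σ₂ τ₁ = setR rS (rg τ₁ rM) (setR rt 3 (setR rs 4 τ₁))
      tm : ∀ t₀ t₁ t₂ → t₀ ≤ k * 38 + 8 + 2 → t₁ ≤ 200 * suc m → t₂ ≤ 200 * suc m →
        t₀ + (2 + (2 + (2 + (2 + (t₁ + (2 + (2 + (2 + t₂)))))))) ≤ (k * 38 + 100) + 400 * suc m
      tm t₀ t₁ t₂ h₀ h₁ h₂ = ≤-trans (≤-reflexive (lem t₀ t₁ t₂)) (+-mono-≤ (≤-trans (+-monoˡ-≤ 14 h₀) (≤-trans (≤-reflexive (lem′ (k * 38))) (+-monoʳ-≤ (k * 38) (num {24} {100}))))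
          (≤-trans (+-mono-≤ h₁ h₂) (≤-reflexive (sym (*-distribʳ-+ (suc m) 200 200)))))
        where
        lem : ∀ a b c → a + (2 + (2 + (2 + (2 + (b + (2 + (2 + (2 + c)))))))) ≡ a + 14 + (b + c)
        lem = solve-∀
        lem′ : ∀ x → x + 8 + 2 + 14 ≡ x + 24
        lem′ = solve-∀

    Result : (ℕ → ℕ) → Set
    Result E = ∀ i → i < q → (E i ≡ 0 ⊎ ∃[ e ] (E i ≡ suc e × Graphs.Wk n (m + m) src tgt (sp i) (tp i) e))
      × (∀ d → Graphs.Wk n (m + m) src tgt (sp i) (tp i) d → E i ≢ 0 × E i ≤ suc (d + 2 * ⌈ d ÷ 2 * k ⌉))

    module Rest (D : ℕ) (sz : Sized n m mn (<⇒≤ n<V) n2≤V k1≤V pw≤V k≥1 D) where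
      open Sized sz

      big′ : m ≤ D ^ suc k
      big′ = subst (λ z → m ≤ D ^ z) (+-comm k 1) big

      open Budget k n m q a D k≥2 D≥2 D≤ big′ q≤

      D≤V : D ≤ V
      D≤V = ≤-trans D≤ n2≤V

      DV : D ^ k ≤ V
      DV = ≤-trans (^-monoˡ-≤ k D≤) (≤-trans (^-monoʳ-≤ (2 + n) (m≤m+n k 1)) pw≤V)

      E : Env
      E = record
        { n = n ; H = m + m ; src = src ; tgt = tgt ; gs = gs ; n<V = n<V ; D = D ; D≥2 = D≥2 ; D≤V = D≤V ; nD≤V = ≤-trans (*-monoʳ-≤ n D≤) nD≤V
        ; m = m ; q = q ; sp = sp ; tp = tp ; sp< = sp< ; tp< = tp< ; q≤V = q≤V ; nn≤V = nn≤V ; β≡ = β≡ ; Y = Y ; picks≤ = picks≤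
        ; kn≤V = kn≤V ; pw≤V = DV ; k≥1 = k≥1 }

      stored : ∀ {τ} → OnEnv.Rows E n τ → OnEnv.Stored E
      stored {τ} R = record { QT = ar τ QU ; DT = ar τ QD ; CT = ar τ CN ; RT = ar τ RA ; rowT = OnEnv.Rows.rows R }

      TR : ℕ
      TR = T₂ + (T₃ + (T₄ + (T₅ + T₆)))

      total′ : 200 * (k + 2) * suc n + TR ≤ costK k a * (lg n * (suc n * D ^ k))
      total′ = total

      rest-ok : ∀ {σ} → Loaded σ → rg σ rN ≡ n → rg σ rM ≡ m → rg σ rQ ≡ q → rg σ rD ≡ D →
        Runs (prep ▸ table ▸ hitting ▸ query ▸ output) σ (λ t τ → t ≤ TR × Result (lw τ))
      rest-ok {σ} L eN eM eQ eD = prep-ok {σ} {D} D≥1 DV L eM eD ⨟ λ {t₁} {τ₁} f₁ P →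
          OnEnv.table-ok E {τ₁} (trans (fR f₁ rN) eN) (trans (fR f₁ rD) eD) (lists P)
            (λ x → trans (cong (λ g → g x) (fA f₁ UN)) (Loaded.zeros L UN x)) (λ x → trans (cong (λ g → g x) (fA f₁ CO)) (Loaded.zeros L CO x)) (λ x → trans (cong (λ g → g x) (fA f₁ VI)) (Loaded.zeros L VI x)) ⨟ λ {t₂} {τ₂} f₂ (t₂≤ , R) →
          post (OnEnv.Fixed.solve-ok E (stored R) {τ₂}
              (OnEnv.input-frame E table {τ₁} {τ₂} f₂ (inp f₁ P)) (record { tQ = λ _ _ → refl ; tD = λ _ _ → refl ; tC = λ _ → refl ; tR = λ _ → refl })
              (unstate {τ₂} R)
              (OnEnv.Rows.co R) (OnEnv.Rows.vi0 R) (λ i _ → inj₁ (trans (cong (λ g → g i) (trans (fA f₂ ES) (fA f₁ ES))) (Loaded.zeros L ES i)))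
              (trans (fR f₂ rP) (Prepared.pP P)) (λ v → trans (cong (λ g → g v) (trans (fA f₂ AA) (fA f₁ AA))) (Loaded.zeros L AA v)))
          λ { {t₃} {υ} f₃ (t₃≤ , ans) → ≤-trans (+-mono-≤ (Prepared.pt≤ P) (+-mono-≤ t₂≤ t₃≤)) (≤-reflexive (+-assoc T₂ T₃ (T₄ + (T₅ + T₆)))) , ans }
        where
        unstate : ∀ {τ} → (R : OnEnv.Rows E n τ) → ∀ v → v < n → OnEnv.Fixed.UnState E (stored R) τ v
        unstate R v l with OnEnv.Rows.kind R v l
        ... | inj₁ (W , z) = inj₁ (z , inj₁ W)
        ... | inj₂ (P , o) = inj₂ (o , P)
        lists : ∀ {t₁ τ₁} → Prepared σ D t₁ τ₁ → OnEnv.Lists E τ₁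
        lists P = record { hd = Listed.hd (Prepared.lst P) ; nx = Listed.nx (Prepared.lst P) ; tg = Listed.tg (Prepared.lst P) }
        inp : ∀ {t₁ τ₁} → Frame prep σ τ₁ → Prepared σ D t₁ τ₁ → OnEnv.Input E τ₁
        inp f₁ P = record { eN = trans (fR f₁ rN) eN ; eM = trans (fR f₁ rM) eM ; eQ = trans (fR f₁ rQ) eQ ; eD = trans (fR f₁ rD) eD ; ls = lists P
          ; ps = λ i l → trans (cong (λ g → g (3 + 2 * m + 2 * i)) (fL f₁)) (Loaded.ps L i l) ; pt = λ i l → trans (cong (λ g → g (4 + 2 * m + 2 * i)) (fL f₁)) (Loaded.pt L i l) }

    record Solved (t : ℕ) (τ : Store) : Set where
      field
        D     : ℕ
        D>0   : 1 ≤ D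
        tight : D ^ suc k ≤ 2 ^ suc k * (1 ⊔ m)
        time  : t ≤ 9 + costK k a * (lg n * (suc n * D ^ k))
        res   : Result (lw τ)

    -- By minimality `D` is 2 or `suc E` with `E ^ (k + 1) < m`, and in the latter case
    -- `suc E ≤ 2 * E`. The maximum with 1 takes care of `D = 2` in a graph without edges.
    tight-≤ : ∀ {D} → D ≡ 2 ⊎ (∃[ E ] (D ≡ suc E × 2 ≤ E × E ^ (k + 1) < m)) → D ^ suc k ≤ 2 ^ suc k * (1 ⊔ m)
    tight-≤ (inj₁ refl) = ≤-trans (≤-reflexive (sym (*-identityʳ (2 ^ suc k)))) (*-monoʳ-≤ (2 ^ suc k) (m≤m⊔n 1 m))
    tight-≤ (inj₂ (E , refl , E≥2 , l)) = ≤-trans (^-monoˡ-≤ (suc k) (≤-trans (+-monoˡ-≤ E (≤-trans (n≤1+n 1) E≥2)) (≤-reflexive (lem E))))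
        (≤-trans (≤-reflexive (^-distribʳ-* (suc k) 2 E)) (*-monoʳ-≤ (2 ^ suc k) (≤-trans (≤-trans (≤-reflexive (cong (E ^_) (+-comm 1 k))) (<⇒≤ l)) (m≤n⊔m 1 m))))
      where
      lem : ∀ E → E + E ≡ 2 * E
      lem = solve-∀

    main-ok : ∀ {σ} → Loaded σ → lw σ 0 ≡ n → lw σ 1 ≡ m → lw σ 2 ≡ q → Runs main σ Solved
    main-ok {σ} L l₀ l₁ l₂ = runs-▸ (_ , _ , do-rd rN (` 0) (β>2 z≤n) , runs-▸ (_ , _ , do-rd rM (` 1) (β>2 (s≤s z≤n)) , runs-▸ (_ , _ , do-rd rQ (` 2) (β>2 ≤-refl) ,
        (search-ok n m mn (<⇒≤ n<V) n2≤V k1≤V pw≤V k≥1 {σ₁} l₀ l₁ ⨟ λ {t₁} {τ₁} f₁ (t₁≤ , sz) →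
         post (Rest.rest-ok (rg τ₁ rD) sz {τ₁} (loaded f₁) (trans (fR f₁ rN) l₀) (trans (fR f₁ rM) l₁) (trans (fR f₁ rQ) l₂) refl)
         λ { {t₂} {υ} f₂ (t₂≤ , r) → record { D = rg τ₁ rD ; D>0 = ≤-trans (s≤s z≤n) (Sized.D≥2 sz) ; tight = tight-≤ (Sized.tight sz)
           ; time = +-monoʳ-≤ 9 (≤-trans (+-mono-≤ t₁≤ t₂≤) (Rest.total′ (rg τ₁ rD) sz)) ; res = r } }))))
      where
      β>2 : ∀ {x} → x ≤ 2 → x < β
      β>2 h = subst (_ <_) (sym β≡) (≤-trans (s≤s h) (≤-trans (m≤m+n 3 (2 * m)) (m≤m+n (3 + 2 * m) (2 * q))))
      σ₁ = setR rQ (lw σ 2) (setR rM (lw σ 1) (setR rN (lw σ 0) σ))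
      loaded : ∀ {τ} → Frame search σ₁ τ → Loaded τ
      loaded f = record
        { zeros = λ a i → trans (cong (λ g → g i) (fA f a {noarr a})) (Loaded.zeros L a i)
        ; es = λ e l → trans (cong (λ g → g (3 + 2 * e)) (fL f)) (Loaded.es L e l) ; et = λ e l → trans (cong (λ g → g (4 + 2 * e)) (fL f)) (Loaded.et L e l)
        ; ps = λ e l → trans (cong (λ g → g (3 + 2 * m + 2 * e)) (fL f)) (Loaded.ps L e l) ; pt = λ e l → trans (cong (λ g → g (4 + 2 * m + 2 * e)) (fL f)) (Loaded.pt L e l) }
        where
        noarr : ∀ a → T (not (writesA search a))
        noarr a = tt

-- Word length

n<2^lg : ∀ n → n < 2 ^ lg n
n<2^lg = <-rec _ go
  where
  go : ∀ n → (∀ {m} → m < n → m < 2 ^ lg m) → n < 2 ^ lg n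
  go 0 _ = s≤s z≤n
  go 1 _ = s≤s (s≤s z≤n)
  go n@(suc (suc _)) rec = ≤-trans (s≤s (≤-reflexive (sym (⌊n/2⌋+⌈n/2⌉≡n n)))) (≤-trans (s≤s (+-monoʳ-≤ ⌊ n /2⌋ half≤)) (≤-trans (≤-reflexive (lem ⌊ n /2⌋))
      (≤-trans (*-monoʳ-≤ 2 (rec (⌊n/2⌋<n _))) (≤-reflexive (cong (2 *_) (cong (2 ^_) lg≡))))))
    where
    lem : ∀ h → suc (h + suc h) ≡ 2 * suc h
    lem = solve-∀
    half≤ : ⌈ n /2⌉ ≤ suc ⌊ n /2⌋
    half≤ = ⌈n/2⌉≤1+⌊n/2⌋ n
      where
      ⌈n/2⌉≤1+⌊n/2⌋ : ∀ n → ⌈ n /2⌉ ≤ suc ⌊ n /2⌋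
      ⌈n/2⌉≤1+⌊n/2⌋ zero = z≤n
      ⌈n/2⌉≤1+⌊n/2⌋ (suc zero) = ≤-refl
      ⌈n/2⌉≤1+⌊n/2⌋ (suc (suc n)) = s≤s (⌈n/2⌉≤1+⌊n/2⌋ n)
    lg≡ : lg ⌊ n /2⌋ ≡ ⌊log₂ n ⌋
    lg≡ = trans (cong suc (⌊log₂⌊n/2⌋⌋≡⌊log₂n⌋∸1 n)) (pos ⌊log₂ n ⌋ (⌊log₂⌋-mono-≤ {2} {n} (s≤s (s≤s z≤n))))
      where
      pos : ∀ a → 1 ≤ a → suc (a ∸ 1) ≡ a
      pos (suc a) _ = refl

n≤2^n : ∀ n → n ≤ 2 ^ n
n≤2^n zero = z≤n
n≤2^n (suc n) = ≤-trans (+-mono-≤ (m^n>0 2 n) (n≤2^n n)) (≤-reflexive (cong (2 ^ n +_) (sym (+-identityʳ _))))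

base-expr : Expr (suc NR)
base-expr = bin add (lit 3) (bin mul (lit 2) (bin add (load (lit 1)) (load (lit 2))))

program : ℕ → Prog (suc NR)
program k = zero ≔ base-expr ⨾ compC k main

-- Read off from `room` below: `X₀` is at most 2 to the power `(a + k + 13) * lg n`, `V` is its
-- power with exponent `k + 3`, and the memory needed is at most 27, hence at most `2 ^ 5`, times
-- `V ^ 16`.
word-exp : ℕ → ℕ → ℕ
word-exp k a = 5 + 16 * ((a + k + 13) * (k + 3))

module Sizes (k a n m q w : ℕ) (k≥2 : 2 ≤ k) (mn : m ≤ n * n) (q≤ : q ≤ a * n) (w≥ : word-exp k a * lg n ≤ w) where

  -- The exponent `k + 3` covers the powers up to `(2 + n) ^ (k + 1)` met in the search for `D`, and
  -- also the cubic bound behind `kn≤V`.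
  X₀ V β L : ℕ
  X₀ = n + m + q + k + 9
  V = X₀ ^ (k + 3)
  β = 3 + 2 * m + 2 * q
  L = lg n

  X≥9 : 9 ≤ X₀
  X≥9 = m≤n+m 9 _

  X≥1 : 1 ≤ X₀
  X≥1 = ≤-trans (s≤s z≤n) X≥9

  k≤X : k + 9 ≤ X₀
  k≤X = ≤-trans (m≤n+m (k + 9) (n + m + q)) (≤-reflexive (sym (+-assoc (n + m + q) k 9)))

  n+9≤X : n + 9 ≤ X₀
  n+9≤X = +-monoˡ-≤ 9 (≤-trans (m≤m+n n m) (≤-trans (m≤m+n (n + m) q) (m≤m+n (n + m + q) k)))

  m+9≤X : m + 9 ≤ X₀
  m+9≤X = +-monoˡ-≤ 9 (≤-trans (m≤n+m m n) (≤-trans (m≤m+n (n + m) q) (m≤m+n (n + m + q) k)))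

  q≤X : q ≤ X₀
  q≤X = ≤-trans (m≤n+m q (n + m)) (≤-trans (m≤m+n (n + m + q) k) (m≤m+n _ 9))

  pow≤V : ∀ {e} → e ≤ k + 3 → X₀ ^ e ≤ V
  pow≤V = ^-monoʳ-≤ X₀ {{>-nonZero X≥1}}

  X≤V : X₀ ≤ V
  X≤V = ≤-trans (≤-reflexive (sym (^-identityʳ X₀))) (pow≤V (≤-trans (s≤s z≤n) (m≤n+m 3 k)))

  XX≤V : X₀ * X₀ ≤ V
  XX≤V = ≤-trans (≤-reflexive (cong (X₀ *_) (sym (^-identityʳ X₀)))) (pow≤V {2} (≤-trans (n≤1+n 2) (m≤n+m 3 k)))

  XXX≤V : X₀ * (X₀ * X₀) ≤ V
  XXX≤V = ≤-trans (≤-reflexive (cong (λ z → X₀ * (X₀ * z)) (sym (^-identityʳ X₀)))) (pow≤V {3} (m≤n+m 3 k))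

  V≥9 : 9 ≤ V
  V≥9 = ≤-trans X≥9 X≤V

  k≤V : k ≤ V
  k≤V = ≤-trans (≤-trans (m≤m+n k 9) k≤X) X≤V

  n≤X : n ≤ X₀
  n≤X = ≤-trans (m≤m+n n 9) n+9≤X

  2+n≤X : 2 + n ≤ X₀
  2+n≤X = ≤-trans (≤-trans (≤-reflexive (+-comm 2 n)) (+-monoʳ-≤ n (s≤s (s≤s z≤n)))) n+9≤X

  k1≤V : k + 1 ≤ V
  k1≤V = ≤-trans (≤-trans (+-monoʳ-≤ k (s≤s z≤n)) k≤X) X≤V

  dbl : ∀ {x} → x ≤ X₀ → suc (x + x) ≤ V
  dbl {x} h = ≤-trans (+-mono-≤ X≥1 (+-mono-≤ h h)) (≤-trans (≤-reflexive (lem X₀)) (≤-trans (*-monoˡ-≤ X₀ (≤-trans (s≤s (s≤s (s≤s z≤n))) X≥9)) XX≤V))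
    where
    lem : ∀ x → x + (x + x) ≡ 3 * x
    lem = solve-∀

  H<V : m + m < V
  H<V = dbl (≤-trans (m≤m+n m 9) m+9≤X)

  nn≤V : suc (n + n) ≤ V
  nn≤V = dbl n≤X

  kn≤V : suc (k * n + k * n) ≤ V
  kn≤V = ≤-trans (+-mono-≤ (*-mono-≤ X≥1 X≥1) (+-mono-≤ kn kn)) (≤-trans (≤-reflexive (lem (X₀ * X₀))) (≤-trans (*-monoˡ-≤ (X₀ * X₀) (≤-trans (s≤s (s≤s (s≤s z≤n))) X≥9)) XXX≤V))
    where
    kn : k * n ≤ X₀ * X₀
    kn = *-mono-≤ (≤-trans (m≤m+n k 9) k≤X) n≤X
    lem : ∀ x → x + (x + x) ≡ 3 * x
    lem = solve-∀

  nD≤V : n * (2 + n) ≤ V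
  nD≤V = ≤-trans (*-mono-≤ n≤X 2+n≤X) XX≤V

  pw≤V : (2 + n) ^ (k + 1) ≤ V
  pw≤V = ≤-trans (^-monoˡ-≤ (k + 1) 2+n≤X) (pow≤V (+-monoʳ-≤ k (s≤s z≤n)))

  X≤2^ : X₀ ≤ 2 ^ ((a + k + 13) * L)
  X≤2^ = begin
    n + m + q + k + 9                 ≤⟨ +-mono-≤ (+-mono-≤ (+-mono-≤ (+-mono-≤ ny my) qy) ky) 9y ⟩
    y * y + y * y + a * (y * y) + k * (y * y) + 9 * (y * y) ≡⟨ lem a k (y * y) ⟩
    (a + k + 11) * (y * y)            ≤⟨ *-monoˡ-≤ (y * y) (n≤2^n (a + k + 11)) ⟩
    2 ^ (a + k + 11) * (y * y)        ≤⟨ *-monoˡ-≤ (y * y) (^-monoʳ-≤ 2 {a + k + 11} (≤-trans (≤-reflexive (sym (*-identityʳ (a + k + 11)))) (*-monoʳ-≤ (a + k + 11) {1} {L} (s≤s z≤n)))) ⟩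
    2 ^ ((a + k + 11) * L) * (y * y)  ≡⟨ cong (2 ^ ((a + k + 11) * L) *_) (^-distribˡ-+-* 2 L L) ⟨
    2 ^ ((a + k + 11) * L) * 2 ^ (L + L) ≡⟨ ^-distribˡ-+-* 2 ((a + k + 11) * L) (L + L) ⟨
    2 ^ ((a + k + 11) * L + (L + L))  ≡⟨ cong (2 ^_) (lem₂ a k L) ⟩
    2 ^ ((a + k + 13) * L) ∎
    where
    open ≤-Reasoning
    y = 2 ^ L
    y≥1 : 1 ≤ y
    y≥1 = m^n>0 2 L
    n≤y : n ≤ y
    n≤y = <⇒≤ (n<2^lg n)
    ny : n ≤ y * y
    ny = ≤-trans n≤y (≤-trans (≤-reflexive (sym (*-identityʳ y))) (*-monoʳ-≤ y y≥1))
    my : m ≤ y * y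
    my = ≤-trans mn (*-mono-≤ n≤y n≤y)
    qy : q ≤ a * (y * y)
    qy = ≤-trans q≤ (*-monoʳ-≤ a ny)
    yy≥1 : 1 ≤ y * y
    yy≥1 = *-mono-≤ y≥1 y≥1
    ky : k ≤ k * (y * y)
    ky = ≤-trans (≤-reflexive (sym (*-identityʳ k))) (*-monoʳ-≤ k yy≥1)
    9y : 9 ≤ 9 * (y * y)
    9y = *-monoʳ-≤ 9 yy≥1
    lem : ∀ a k z → z + z + a * z + k * z + 9 * z ≡ (a + k + 11) * z
    lem = solve-∀
    lem₂ : ∀ a k L → (a + k + 11) * L + (L + L) ≡ (a + k + 13) * L
    lem₂ = solve-∀

  room : β + (NA + NA * V ^ 16) ≤ 2 ^ w
  room = begin
    β + (12 + 12 * V ^ 16)                       ≤⟨ +-mono-≤ β≤ (+-monoˡ-≤ _ (≤-trans (≤-reflexive (sym (*-identityʳ 12))) (*-monoʳ-≤ 12 V16≥1))) ⟩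
    3 * V ^ 16 + (12 * V ^ 16 + 12 * V ^ 16)     ≡⟨ lem (V ^ 16) ⟩
    27 * V ^ 16                                  ≤⟨ *-monoˡ-≤ (V ^ 16) (≤ᵇ⇒≤ 27 32 tt) ⟩
    2 ^ 5 * V ^ 16                               ≤⟨ *-monoʳ-≤ (2 ^ 5) (^-monoˡ-≤ 16 (^-monoˡ-≤ (k + 3) X≤2^)) ⟩
    2 ^ 5 * ((2 ^ (c * L)) ^ (k + 3)) ^ 16       ≡⟨ cong (λ z → 2 ^ 5 * z ^ 16) (^-*-assoc 2 (c * L) (k + 3)) ⟩
    2 ^ 5 * (2 ^ (c * L * (k + 3))) ^ 16         ≡⟨ cong (2 ^ 5 *_) (^-*-assoc 2 (c * L * (k + 3)) 16) ⟩
    2 ^ 5 * 2 ^ (c * L * (k + 3) * 16)           ≡⟨ ^-distribˡ-+-* 2 5 (c * L * (k + 3) * 16) ⟨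
    2 ^ (5 + c * L * (k + 3) * 16)               ≤⟨ ^-monoʳ-≤ 2 exps ⟩
    2 ^ w ∎
    where
    open ≤-Reasoning
    c = a + k + 13
    V16≥1 : 1 ≤ V ^ 16
    V16≥1 = m^n>0 V {{>-nonZero (≤-trans (s≤s z≤n) V≥9)}} 16
    β≤ : β ≤ 3 * V ^ 16
    β≤ = ≤-trans (≤-trans (+-mono-≤ (+-mono-≤ {3} {X₀} (≤-trans (s≤s (s≤s (s≤s z≤n))) X≥9) (*-monoʳ-≤ 2 (≤-trans (m≤m+n m 9) m+9≤X))) (*-monoʳ-≤ 2 q≤X)) (≤-reflexive (lem₀ X₀)))
        (≤-trans (≤-trans (*-monoˡ-≤ X₀ (≤-trans (≤ᵇ⇒≤ 5 9 tt) X≥9)) XX≤V) (≤-trans V≤V16 (m≤m+n _ _)))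
      where
      lem₀ : ∀ x → x + 2 * x + 2 * x ≡ 5 * x
      lem₀ = solve-∀
      V≤V16 : V ≤ V ^ 16
      V≤V16 = ≤-trans (≤-reflexive (sym (^-identityʳ V))) (^-monoʳ-≤ V {{>-nonZero (≤-trans (s≤s z≤n) V≥9)}} {1} {16} (s≤s z≤n))
    lem : ∀ v → 3 * v + (12 * v + 12 * v) ≡ 27 * v
    lem = solve-∀
    exps : 5 + c * L * (k + 3) * 16 ≤ w
    exps = ≤-trans (≤-trans (+-monoˡ-≤ _ (≤-trans (≤-reflexive (sym (*-identityʳ 5))) (*-monoʳ-≤ 5 {1} {L} (s≤s z≤n)))) (≤-reflexive (lem₃ c L (k + 3)))) w≥
      where
      lem₃ : ∀ c L e → 5 * L + c * L * e * 16 ≡ (5 + 16 * (c * e)) * L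
      lem₃ = solve-∀

-- Transfer to the given graph

module Instance (k a : ℕ) (k≥2 : 2 ≤ k) {n m q : ℕ} (G : Graph n m) (pairs : Vec (Fin n × Fin n) q) (q≤ : q ≤ a * n)
  (w : ℕ) (w≥ : word-exp k a * lg n ≤ w) where
  open Arcs G
  open Sizes k a n m q w k≥2 edges≤ q≤ w≥
  open Graphs n (m + m) src tgt using (Wk)

  sp tp : ℕ → ℕ
  sp = extend (λ i → toℕ (proj₁ (lookup pairs i)))
  tp = extend (λ i → toℕ (proj₂ (lookup pairs i)))

  extend< : ∀ {l} (f : Fin l → ℕ) → (∀ i → f i < n) → ∀ i → i < l → extend f i < n
  extend< f h i l with index l
  ... | j , refl = subst (_< n) (sym (extend-at f j)) (h j)

  Mc : Mach
  Mc = record { k = k ; w = w ; β = β ; V = V ; V≥ = V≥9 ; k≤V = k≤V ; room = room }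

  J : OnMachine.Job Mc
  J = record
    { n = n ; m = m ; q = q ; a = a ; src = src ; tgt = tgt ; gs = simple ; sp = sp ; tp = tp
    ; sp< = extend< _ (λ i → toℕ<n (proj₁ (lookup pairs i))) ; tp< = extend< _ (λ i → toℕ<n (proj₂ (lookup pairs i)))
    ; srcᵐ = srcᵐ ; tgtᵐ = tgtᵐ ; β≡ = refl ; k≥2 = k≥2 ; mn = edges≤ ; q≤ = q≤ ; q≤V = ≤-trans q≤X X≤V ; n2≤V = ≤-trans 2+n≤X X≤V
    ; k1≤V = k1≤V ; H<V = H<V ; nn≤V = nn≤V ; kn≤V = kn≤V ; nD≤V = nD≤V ; pw≤V = pw≤V }

  infix 4 _~_
  _~_ : State w (suc NR) → Store → Set
  _~_ = OnMachine._~_ Mc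

  lit< : ∀ {x} → x ≤ V → x < 2 ^ w
  lit< = OnMachine.lit< Mc

  β<2^w : β < 2 ^ w
  β<2^w = OnMachine.β<2^w Mc

  memory : List ℕ
  memory = input G pairs

  σ₀ : Store
  σ₀ = st (λ _ → 0) (λ _ _ → 0) (nth memory)

  tail≤ : ∀ i → nth (codes (edges G) ++ codes pairs) i ≤ V
  tail≤ = nth-code≤ (edges G) (codes pairs) n≤V (λ i → subst (λ z → nth z i ≤ V) (++-identityʳ (codes pairs)) (nth-code≤ pairs [] n≤V (λ j → ≤-trans (≤-reflexive (nth-[] j)) z≤n) i))
    where
    n≤V : n ≤ V
    n≤V = ≤-trans n≤X X≤V

  memory≤ : ∀ i → nth memory i ≤ V
  memory≤ 0 = ≤-trans n≤X X≤V
  memory≤ 1 = ≤-trans (≤-trans (m≤m+n m 9) m+9≤X) X≤V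
  memory≤ 2 = ≤-trans q≤X X≤V
  memory≤ (suc (suc (suc i))) = tail≤ i

  -- All arrays lie behind the input, so this makes them start out as zero.
  beyond : ∀ j → nth memory (β + j) ≡ 0
  beyond j = trans (cong (nth (codes (edges G) ++ codes pairs)) (+-assoc (2 * m) (2 * q) j)) (trans (nth-skip (edges G) (codes pairs) (2 * q + j))
    (trans (cong (λ z → nth z (2 * q + j)) (sym (++-identityʳ (codes pairs)))) (trans (nth-skip pairs [] j) (nth-[] j))))

  initial-mem : ∀ ω i → i < 2 ^ w → toℕ (mem (initial w (suc NR) G pairs ω) (word w i)) ≡ nth memory i
  initial-mem ω i l = trans (toℕ-word {w} (lit< (memory≤ (toℕ (word w i))))) (cong (nth memory) (toℕ-word {w} l))

  small : ∀ {x} → x ≤ 9 → x < 2 ^ w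
  small h = lit< (≤-trans h V≥9)

  base-value : ∀ ω → toℕ (eval base-expr (initial w (suc NR) G pairs ω)) ≡ β
  base-value ω = trans (cong (λ z → toℕ (word w z)) (cong₂ _+_ (toℕ-word {w} (small num₃)) (trans (cong (λ z → toℕ (word w z)) (cong₂ _*_ (toℕ-word {w} (small num₂))
      (trans (cong (λ z → toℕ (word w z)) (cong₂ _+_ (at 1 (≤ᵇ⇒≤ 1 9 tt)) (at 2 (≤ᵇ⇒≤ 2 9 tt)))) (toℕ-word {w} (≤-<-trans (≤-trans (m≤m+n (m + q) _) e₁) β<2^w)))))
      (toℕ-word {w} (≤-<-trans e₁ β<2^w))))) (trans (cong (λ z → toℕ (word w z)) β-eq) (toℕ-word {w} β<2^w))
    where
    num₃ : 3 ≤ 9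
    num₃ = ≤ᵇ⇒≤ 3 9 tt
    num₂ : 2 ≤ 9
    num₂ = ≤ᵇ⇒≤ 2 9 tt
    β-eq : 3 + 2 * (m + q) ≡ β
    β-eq = lem m q
      where
      lem : ∀ m q → 3 + 2 * (m + q) ≡ 3 + 2 * m + 2 * q
      lem = solve-∀
    e₁ : 2 * (m + q) ≤ β
    e₁ = ≤-trans (m≤n+m _ 3) (≤-reflexive β-eq)
    at : ∀ i → i ≤ 9 → toℕ (mem (initial w (suc NR) G pairs ω) (word w i)) ≡ nth memory i
    at i h = initial-mem ω i (small h)

  c₁ : List Bool → State w (suc NR)
  c₁ ω = let c = initial w (suc NR) G pairs ω in ⟨ regs c [ zero ]≔ eval base-expr c , mem c , coins c ⟩

  start~ : ∀ ω → c₁ ω ~ σ₀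
  start~ ω = record
    { ~β = base-value ω
    ; ~R = λ x → trans (cong toℕ (lookup-replicate x (word w 0))) (toℕ-word {w} (m^n>0 2 w))
    ; ~A = λ a i l → trans (initial-mem ω (β + (toℕ a + NA * i)) l) (beyond (toℕ a + NA * i))
    ; ~L = λ i l → initial-mem ω i (<-trans l β<2^w)
    ; ~B = record { bR = λ _ → z≤n ; bA = λ _ _ → z≤n ; bL = λ i _ → memory≤ i } }

  loaded : OnMachine.Whole.Loaded Mc J σ₀
  loaded = record
    { zeros = λ _ _ → refl
    ; es = λ e l → edge₁ (index l) ; et = λ e l → edge₂ (index l) ; ps = λ i l → pair₁ (index l) ; pt = λ i l → pair₂ (index l) }
    where
    B : List ℕ
    B = codes pairs
    edge₁ : ∀ {e} → ∃[ i ] (toℕ {m} i ≡ e) → nth (codes (edges G) ++ B) (2 * e) ≡ src e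
    edge₁ (i , refl) = trans (nth-code₁ (edges G) B i) (sym (src-edge i))
    edge₂ : ∀ {e} → ∃[ i ] (toℕ {m} i ≡ e) → nth (codes (edges G) ++ B) (suc (2 * e)) ≡ tgt e
    edge₂ (i , refl) = trans (nth-code₂ (edges G) B i) (sym (tgt-edge i))
    pair₁ : ∀ {e} → ∃[ i ] (toℕ {q} i ≡ e) → nth (codes (edges G) ++ B) (2 * m + 2 * e) ≡ sp e
    pair₁ (i , refl) = trans (nth-skip (edges G) B (2 * toℕ i)) (trans (cong (λ z → nth z (2 * toℕ i)) (sym (++-identityʳ B))) (trans (nth-code₁ pairs [] i) (sym (extend-at _ i))))
    pair₂ : ∀ {e} → ∃[ i ] (toℕ {q} i ≡ e) → nth (codes (edges G) ++ B) (suc (2 * m + 2 * e)) ≡ tp e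
    pair₂ (i , refl) = trans (cong (nth (codes (edges G) ++ B)) (sym (+-suc (2 * m) (2 * toℕ i)))) (trans (nth-skip (edges G) B (suc (2 * toℕ i)))
      (trans (cong (λ z → nth z (suc (2 * toℕ i))) (sym (++-identityʳ B))) (trans (nth-code₂ pairs [] i) (sym (extend-at _ i)))))

  -- Opaque, since conversion checking would otherwise run the whole program.
  abstract
    solved : ∃[ t ] ∃[ τ ] (OnMachine.Does Mc main σ₀ t τ × OnMachine.Whole.Solved Mc J t τ)
    solved = OnMachine.Whole.main-ok Mc J loaded refl refl refl

  t₁ : ℕ
  t₁ = proj₁ solved

  τ₁ : Store
  τ₁ = proj₁ (proj₂ solved)

  open OnMachine.Whole.Solved {Mc} {J} (proj₂ (proj₂ (proj₂ solved))) using (D; D>0; tight; time; res)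

  prelude : ∀ ω → zero ≔ base-expr , initial w (suc NR) G pairs ω ⇓[ suc (cost base-expr) ] c₁ ω
  prelude ω = ⇓-≔

  -- The 10 additional units are spent on putting the length of the input into register 0.
  execution : ∀ ω → ∃[ τ ] (HaltsWithin (10 + t₁) (program k) (initial w (suc NR) G pairs ω) τ × τ ~ τ₁)
  execution ω = combine′ (OnMachine.Does.run (proj₁ (proj₂ (proj₂ solved))) {c₁ ω} (start~ ω))
    where
    combine′ : ∃[ c′ ] ∃[ t′ ] (t′ ≤ t₁ × compC k main , c₁ ω ⇓[ t′ ] c′ × c′ ~ τ₁) → ∃[ τ ] (HaltsWithin (10 + t₁) (program k) (initial w (suc NR) G pairs ω) τ × τ ~ τ₁)
    combine′ (c′ , t′ , t′≤ , r , c′~) = c′ , (10 + t′ , +-monoʳ-≤ 10 t′≤ , ⇓-⨾ {s = suc (cost base-expr)} {t = t′} (prelude ω) r) , c′~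

  answer : ∀ {τ} → τ ~ τ₁ → ∀ (i : Fin q) → ∃[ d ] (Distance G (proj₁ (lookup pairs i)) (proj₂ (lookup pairs i)) d
    × d ≤∞ estimate τ i × estimate τ i ≤∞ map (λ x → x + 2 * ⌈ x ÷ 2 * k ⌉) d)
  answer {τ} s i = subst (λ z → ∃[ d ] (Distance G u v d × d ≤∞ decode z × decode z ≤∞ map (λ x → x + 2 * ⌈ x ÷ 2 * k ⌉) d))
      (sym (OnMachine.~L s (toℕ i) (<-≤-trans (toℕ<n i) (≤-trans (m≤m+n q (q + 0)) (m≤n+m (2 * q) (3 + 2 * m))))))
      (go (lw τ₁ (toℕ i)) (proj₁ r) (proj₂ r))
    where
    u = proj₁ (lookup pairs i)
    v = proj₂ (lookup pairs i)
    r = subst₂ (λ x y → (lw τ₁ (toℕ i) ≡ 0 ⊎ ∃[ e ] (lw τ₁ (toℕ i) ≡ suc e × Wk x y e))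
      × (∀ d → Wk x y d → lw τ₁ (toℕ i) ≢ 0 × lw τ₁ (toℕ i) ≤ suc (d + 2 * ⌈ d ÷ 2 * k ⌉))) (extend-at _ i) (extend-at _ i) (res (toℕ i) (toℕ<n i))
    go : ∀ E → E ≡ 0 ⊎ ∃[ e ] (E ≡ suc e × Wk (toℕ u) (toℕ v) e) → (∀ d → Wk (toℕ u) (toℕ v) d → E ≢ 0 × E ≤ suc (d + 2 * ⌈ d ÷ 2 * k ⌉)) →
      ∃[ d ] (Distance G u v d × d ≤∞ decode E × decode E ≤∞ map (λ x → x + 2 * ⌈ x ÷ 2 * k ⌉) d)
    go .0 (inj₁ refl) h = ⊤⁺ , (λ ℓ p → proj₁ (h ℓ (to-wk p)) refl) , (⊤⁺ ≤⊤⁺) , (⊤⁺ ≤⊤⁺)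
    go .(suc e) (inj₂ (e , refl , p)) h with shortest e (from-wk p)
    ... | d , dist , d≤e = [ d ] , dist , [ d≤e ]≤ , [ s≤s⁻¹ (proj₂ (h d (to-wk (proj₁ dist)))) ]≤

  answers : ∀ ω τ → HaltsWithin (10 + t₁) (program k) (initial w (suc NR) G pairs ω) τ → ∀ (i : Fin q) → ∃[ d ]
    (Distance G (proj₁ (lookup pairs i)) (proj₂ (lookup pairs i)) d × d ≤∞ estimate τ i × estimate τ i ≤∞ map (λ x → x + 2 * ⌈ x ÷ 2 * k ⌉) d)
  answers ω τ (_ , _ , r) = let τ′ , (_ , _ , r′) , s = execution ω in answer (subst (_~ τ₁) (det r′ r) s)

  timeK : ℕ
  timeK = (19 + costK k a) * 2 * 2 ^ k

  -- The time is linear in `D ^ k`. Raised to the power `suc k`, this factor becomes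
  -- `(D ^ suc k) ^ k`, to which `tight` applies; no root of `m` is taken.
  time-bound : (10 + t₁) ^ suc k ≤ (timeK * lg n ^ 1 * (1 ⊔ n)) ^ suc k * (1 ⊔ m) ^ k
  time-bound = begin
    (10 + t₁) ^ suc k                                ≤⟨ ^-monoˡ-≤ (suc k) lin ⟩
    (A * D ^ k) ^ suc k                              ≡⟨ ^-distribʳ-* (suc k) A (D ^ k) ⟩
    A ^ suc k * (D ^ k) ^ suc k                      ≡⟨ cong (A ^ suc k *_) (trans (^-*-assoc D k (suc k)) (trans (cong (D ^_) (*-comm k (suc k))) (sym (^-*-assoc D (suc k) k)))) ⟩
    A ^ suc k * (D ^ suc k) ^ k                      ≤⟨ *-monoʳ-≤ (A ^ suc k) (^-monoˡ-≤ k tight) ⟩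
    A ^ suc k * (2 ^ suc k * (1 ⊔ m)) ^ k            ≡⟨ cong (A ^ suc k *_) (trans (^-distribʳ-* k (2 ^ suc k) (1 ⊔ m)) (cong (_* (1 ⊔ m) ^ k)
                                                          (trans (^-*-assoc 2 (suc k) k) (trans (cong (2 ^_) (*-comm (suc k) k)) (sym (^-*-assoc 2 k (suc k))))))) ⟩
    A ^ suc k * ((2 ^ k) ^ suc k * (1 ⊔ m) ^ k)      ≡⟨ *-assoc (A ^ suc k) _ _ ⟨
    A ^ suc k * (2 ^ k) ^ suc k * (1 ⊔ m) ^ k        ≡⟨ cong (_* (1 ⊔ m) ^ k) (^-distribʳ-* (suc k) A (2 ^ k)) ⟨
    (A * 2 ^ k) ^ suc k * (1 ⊔ m) ^ k                ≡⟨ cong (λ z → z ^ suc k * (1 ⊔ m) ^ k) (lem (19 + costK k a) (lg n) (1 ⊔ n) (2 ^ k)) ⟩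
    (timeK * lg n ^ 1 * (1 ⊔ n)) ^ suc k * (1 ⊔ m) ^ k ∎
    where
    open ≤-Reasoning
    A : ℕ
    A = (19 + costK k a) * 2 * (lg n * 1) * (1 ⊔ n)
    lem : ∀ c l x p → c * 2 * (l * 1) * x * p ≡ c * 2 * p * (l * 1) * x
    lem = solve-∀
    Z : ℕ
    Z = lg n * (suc n * D ^ k)
    Z≥1 : 1 ≤ Z
    Z≥1 = *-mono-≤ {1} {lg n} (s≤s z≤n) (*-mono-≤ {1} {suc n} (s≤s z≤n) (m^n>0 D {{>-nonZero D>0}} k))
    sn≤ : suc n ≤ 2 * (1 ⊔ n)
    sn≤ = ≤-trans (+-mono-≤ (m≤m⊔n 1 n) (m≤n⊔m 1 n)) (≤-reflexive (cong ((1 ⊔ n) +_) (sym (+-identityʳ _))))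
    lin : 10 + t₁ ≤ A * D ^ k
    lin = begin
      10 + t₁                            ≤⟨ +-monoʳ-≤ 10 time ⟩
      19 + costK k a * Z                 ≤⟨ +-monoˡ-≤ (costK k a * Z) (≤-trans (≤-reflexive (sym (*-identityʳ 19))) (*-monoʳ-≤ 19 Z≥1)) ⟩
      19 * Z + costK k a * Z             ≡⟨ *-distribʳ-+ Z 19 (costK k a) ⟨
      (19 + costK k a) * Z               ≤⟨ *-monoʳ-≤ (19 + costK k a) (*-monoʳ-≤ (lg n) (*-monoˡ-≤ (D ^ k) sn≤)) ⟩
      (19 + costK k a) * (lg n * (2 * (1 ⊔ n) * D ^ k)) ≡⟨ lem′ (19 + costK k a) (lg n) (1 ⊔ n) (D ^ k) ⟩
      A * D ^ k ∎
      where
      lem′ : ∀ c l x p → c * (l * (2 * x * p)) ≡ c * 2 * (l * 1) * x * p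
      lem′ = solve-∀

theorem11 : ∀ (k γ : ℕ) → 2 ≤ k →
    ∃[ r ] Σ[ P ∈ Prog r ] ∀ (a : ℕ) → ∃[ W ] ∃[ C ] ∃[ c ]
    (∀ {n m q} (G : Graph n m) (pairs : Vec (Fin n × Fin n) q) → q ≤ a * n →
     ∀ w → W * lg n ≤ w →
     ∃[ T ]
       ( T ^ suc k ≤ (C * lg n ^ c * (1 ⊔ n)) ^ suc k * (1 ⊔ m) ^ k
       × (∀ (ω : Vec Bool T) → ∃[ τ ] HaltsWithin T P (initial w r G pairs (toList ω)) τ)
       × FailsAtMost1/ (suc n ^ γ) (λ (ω : Vec Bool T) →
           ∀ τ → HaltsWithin T P (initial w r G pairs (toList ω)) τ →
           ∀ (i : Fin q) → ∃[ d ]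
             ( Distance G (proj₁ (lookup pairs i)) (proj₂ (lookup pairs i)) d
             × d ≤∞ estimate τ i
             × estimate τ i ≤∞ map (λ x → x + 2 * ⌈ x ÷ 2 * k ⌉) d))))
-- The program is fixed before `a`, which affects only the word length and the constant of the
-- running time.
theorem11 k γ k≥2 = suc NR , program k , λ a → word-exp k a , (19 + costK k a) * 2 * 2 ^ k , 1 ,
  λ G pairs q≤ w w≥ → let open Instance k a k≥2 G pairs q≤ w w≥ in
    10 + t₁ , time-bound , (λ ω → let τ , h , _ = execution (toList ω) in τ , h) , [] , z≤n , λ ω _ τ → answers (toList ω) τ
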